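{- For every composition $\eta$ and $1\le i\le n-1$, $x^{\underline{s_i\eta}}=\sigma_i^+(x^{\underline\eta})$ and $x^{\underline{\Phi\eta}}=\Phi^+(x^{\underline\eta})$.
   Context: Fix $n\ge1$; $r$ is an indeterminate, $\alpha=1/r$, $\mathbb{F}=\mathbb{Q}(r)$, polynomials in $\mathbb{F}[x_1,\dots,x_n]$. Compositions are $\eta\in\mathbb{N}^n$, $|\eta|=\sum\eta_i$, $x^\eta=\prod x_i^{\eta_i}$; partitions are weakly decreasing compositions; $\delta=(n-1,\dots,0)$; permutations act on vectors by $(wv)_{w(i)}=v_i$; $w_\gamma$ is the minimal-length permutation with $w_\gamma^{ -1}(\gamma)$ a partition, $\overline\gamma=\gamma+w_\gamma(r\delta)$. $E_\eta^{r\delta}$ is the unique polynomial of degree $|\eta|$ vanishing at all $\overline\gamma$ with $\gamma\ne\eta$, $|\gamma|\le|\eta|$, with coefficient $1$ on $x^\eta$; $E_\eta^{(\alpha)}$ its top homogeneous component. With $a_\eta(i,j)=\eta_i-j$, $l_\eta(i,j)=\#\{k>i:j\le\eta_k\le\eta_i\}+\#\{k<i:j\le\eta_k+1\le\eta_i\}$, $d_\eta(\alpha)=\prod_{1\le j\le\eta_i}(\alpha(a_\eta(i,j)+1)+l_\eta(i,j)+1)$, set $F_\eta^{(\alpha)}=d_\eta E_\eta^{(\alpha)}$, $F_\eta^{r\delta}(x)=(-1)^{|\eta|}d_\eta E_\eta^{r\delta}(-x)$; $\Xi$ is the unique $\mathbb{F}$-linear operator with $\Xi(F_\eta^{(\alpha)})=F_\eta^{r\delta}$;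 $x^{\underline\eta}=\Xi(x^\eta)$. On compositions, $s_i\eta$ swaps $\eta_i,\eta_{i+1}$ and $\Phi\eta=(\eta_2,\dots,\eta_n,\eta_1+1)$. On polynomials, $s_i$ swaps $x_i,x_{i+1}$, $\partial_if=(s_if-f)/(x_i-x_{i+1})$, $\sigma_i^+=s_i+r\partial_i$, $\Phi^+f(x)=x_nf(x_n+1,x_1,\dots,x_{n-1})$. -}

module Defs where

open import Data.Nat as ℕ using (ℕ; zero; suc; _∸_; _≤_; _<_; _≤?_; _<?_; compare; less; equal; greater)
open import Data.Integer using (+_)
open import Data.Rational as Q using (ℚ; 0ℚ; 1ℚ)
open import Data.List as L using (List; []; _∷_; _++_; map; concatMap; upTo; allFin; filter; length; foldr)
open import Data.Vec as V using (Vec; lookup; _[_]≔_; replicate; _∷ʳ_; zipWith)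
import Data.Vec.Properties as VP
open import Data.Fin as Fin using (Fin; inject₁; fromℕ)
open import Data.Product using (Σ; ∃; _×_; _,_; proj₁; proj₂)
open import Relation.Binary.PropositionalEquality using (_≡_; _≢_)
open import Relation.Nullary using (¬_; yes; no)
open import Relation.Nullary.Decidable using (_×-dec_)

-- ℚ[r] : polynomials in the indeterminate r, as coefficient lists
-- (lowest degree first), compared coefficientwise.

RPoly : Set
RPoly = List ℚ

rcoef : ℕ → RPoly → ℚ
rcoef k       []      = 0ℚ
rcoef zero    (a ∷ p) = a
rcoef (suc k) (a ∷ p) = rcoef k p

_+ᵣ_ : RPoly → RPoly → RPoly
[]      +ᵣ q       = q
(a ∷ p) +ᵣ []      = a ∷ p
(a ∷ p) +ᵣ (b ∷ q) = (a Q.+ b) ∷ (p +ᵣ q)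

_*ᵣ_ : RPoly → RPoly → RPoly
[]      *ᵣ q = []
(a ∷ p) *ᵣ q = map (a Q.*_) q +ᵣ (0ℚ ∷ (p *ᵣ q))

-ᵣ_ : RPoly → RPoly
-ᵣ_ = map (λ a → Q.- a)

_≈ᵣ_ : RPoly → RPoly → Set
p ≈ᵣ q = ∀ k → rcoef k p ≡ rcoef k q

NonZeroᵣ : RPoly → Set
NonZeroᵣ p = ∃ λ k → rcoef k p ≢ 0ℚ

NZ : Set
NZ = Σ RPoly NonZeroᵣ

prodᵣ : List NZ → RPoly
prodᵣ []       = 1ℚ ∷ []
prodᵣ (d ∷ ds) = proj₁ d *ᵣ prodᵣ ds

-- 𝔽 = ℚ(r): a fraction num / (product of the nonzero polynomials in den)

record 𝔽 : Set where
  constructor _⁄_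
  field
    num : RPoly
    den : List NZ
open 𝔽

_≈_ : 𝔽 → 𝔽 → Set
a ≈ b = (num a *ᵣ prodᵣ (den b)) ≈ᵣ (num b *ᵣ prodᵣ (den a))

infixl 6 _+F_
infixl 7 _*F_

_+F_ : 𝔽 → 𝔽 → 𝔽
a +F b = ((num a *ᵣ prodᵣ (den b)) +ᵣ (num b *ᵣ prodᵣ (den a))) ⁄ (den a ++ den b)

_*F_ : 𝔽 → 𝔽 → 𝔽
a *F b = (num a *ᵣ num b) ⁄ (den a ++ den b)

-F_ : 𝔽 → 𝔽
-F a = (-ᵣ num a) ⁄ den a

0F 1F : 𝔽
0F = [] ⁄ []
1F = (1ℚ ∷ []) ⁄ []

ℕ→𝔽 : ℕ → 𝔽
ℕ→𝔽 k = ((+ k Q./ 1) ∷ []) ⁄ []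

rF : 𝔽
rF = (0ℚ ∷ 1ℚ ∷ []) ⁄ []

1≢0 : 1ℚ ≢ 0ℚ
1≢0 ()

αF : 𝔽
αF = (1ℚ ∷ []) ⁄ (((0ℚ ∷ 1ℚ ∷ []) , (1 , 1≢0)) ∷ [])

_^F_ : 𝔽 → ℕ → 𝔽
a ^F zero  = 1F
a ^F suc k = a *F (a ^F k)

sumF : List 𝔽 → 𝔽
sumF = foldr _+F_ 0F

prodF : List 𝔽 → 𝔽
prodF = foldr _*F_ 1F

sgn : ℕ → 𝔽
sgn k = (-F 1F) ^F k

Comp : ℕ → Set
Comp n = Vec ℕ n

∣_∣ : ∀ {n} → Comp n → ℕ
∣ η ∣ = V.sum η

-- a polynomial is a formal finite sum of terms c·x^η
Poly : ℕ → Set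
Poly n = List (𝔽 × Comp n)

coeff : ∀ {n} → Poly n → Comp n → 𝔽
coeff []             η = 0F
coeff ((c , θ) ∷ p) η with VP.≡-dec ℕ._≟_ θ η
... | yes _ = c +F coeff p η
... | no  _ = coeff p η

_≈ₚ_ : ∀ {n} → Poly n → Poly n → Set
p ≈ₚ q = ∀ η → coeff p η ≈ coeff q η

_+ₚ_ : ∀ {n} → Poly n → Poly n → Poly n
_+ₚ_ = _++_

scale : ∀ {n} → 𝔽 → Poly n → Poly n
scale c = map (λ t → (c *F proj₁ t) , proj₂ t)

_*ₚ_ : ∀ {n} → Poly n → Poly n → Poly n
p *ₚ q = concatMap (λ t → map (λ u → (proj₁ t *F proj₁ u) , zipWith ℕ._+_ (proj₂ t) (proj₂ u)) q) p

mono : ∀ {n} → Comp n → Poly n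
mono η = (1F , η) ∷ []

constP : ∀ {n} → 𝔽 → Poly n
constP c = (c , replicate _ 0) ∷ []

var : ∀ {n} → Fin n → Poly n
var i = mono (replicate _ 0 [ i ]≔ 1)

_^ₚ_ : ∀ {n} → Poly n → ℕ → Poly n
p ^ₚ zero  = constP 1F
p ^ₚ suc k = p *ₚ (p ^ₚ k)

evalP : ∀ {n} → Poly n → Vec 𝔽 n → 𝔽
evalP p v = sumF (map (λ t → proj₁ t *F prodF (V.toList (zipWith _^F_ v (proj₂ t)))) p)

DegLe : ∀ {n} → Poly n → ℕ → Set
DegLe p d = ∀ η → d < ∣ η ∣ → coeff p η ≈ 0F

homog : ∀ {n} → ℕ → Poly n → Poly n
homog d = filter (λ t → ∣ proj₂ t ∣ ℕ.≟ d)

negArg : ∀ {n} → Poly n → Poly n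
negArg = map (λ t → (sgn ∣ proj₂ t ∣ *F proj₁ t) , proj₂ t)

#[_] : ∀ {n} {P : Fin n → Set} → (∀ k → Relation.Nullary.Dec (P k)) → ℕ
#[_] {n} P? = length (filter P? (allFin n))

-- γ̄ = γ + w_γ(rδ).  With w_γ minimal with w_γ⁻¹(γ) a partition, position p
-- of γ is sent to rank w_γ⁻¹(p) = 1 + #{k : γ_k > γ_p} + #{k < p : γ_k = γ_p},
-- so  γ̄_p = γ_p + r (n - 1 - #{k : γ_k > γ_p} - #{k < p : γ_k = γ_p}).

rank0 : ∀ {n} → Comp n → Fin n → ℕ
rank0 γ p = #[ (λ k → lookup γ p <? lookup γ k) ]
          ℕ.+ #[ (λ k → (k Fin.<? p) ×-dec (lookup γ k ℕ.≟ lookup γ p)) ]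

bar : ∀ {n} → Comp n → Vec 𝔽 n
bar {n} γ = V.tabulate (λ p → ℕ→𝔽 (lookup γ p) +F rF *F ℕ→𝔽 ((n ∸ 1) ∸ rank0 γ p))

record IsInterp {n} (η : Comp n) (P : Poly n) : Set where
  field
    degree    : DegLe P ∣ η ∣
    leading   : coeff P η ≈ 1F
    vanishing : ∀ γ → γ ≢ η → ∣ γ ∣ ≤ ∣ η ∣ → evalP P (bar γ) ≈ 0F

-- arm, leg and d_η(α)  (positions i, j are 1-based in the paper;
-- here i : Fin n and j ranges over 1..η_i)

leg : ∀ {n} → Comp n → Fin n → ℕ → ℕ
leg η i j = #[ (λ k → (i Fin.<? k) ×-dec ((j ≤? lookup η k) ×-dec (lookup η k ≤? lookup η i))) ]
          ℕ.+ #[ (λ k → (k Fin.<? i) ×-dec ((j ≤? suc (lookup η k)) ×-dec (suc (lookup η k) ≤? lookup η i))) ]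

arm : ∀ {n} → Comp n → Fin n → ℕ → ℕ
arm η i j = lookup η i ∸ j

dη : ∀ {n} → Comp n → 𝔽
dη {n} η = prodF (concatMap (λ i → map (λ j₀ → let j = suc j₀ in
              αF *F ℕ→𝔽 (suc (arm η i j)) +F ℕ→𝔽 (suc (leg η i j)))
            (upTo (lookup η i))) (allFin n))

Fα : ∀ {n} → (Comp n → Poly n) → Comp n → Poly n
Fα E η = scale (dη η) (homog ∣ η ∣ (E η))

Frδ : ∀ {n} → (Comp n → Poly n) → Comp n → Poly n
Frδ E η = scale (sgn ∣ η ∣ *F dη η) (negArg (E η))

record IsLinear {n} (Ξ : Poly n → Poly n) : Set where
  field
    respects : ∀ p q → p ≈ₚ q → Ξ p ≈ₚ Ξ q
    additive : ∀ p q → Ξ (p +ₚ q) ≈ₚ (Ξ p +ₚ Ξ q)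
    homogen  : ∀ c p → Ξ (scale c p) ≈ₚ scale c (Ξ p)

-- Operators.  n = suc m;  i : Fin m stands for the paper's i ∈ {1,…,n-1},
-- swapping the (0-based) positions inject₁ i and suc i.

swapC : ∀ {m} → Fin m → Comp (suc m) → Comp (suc m)
swapC i η = (η [ inject₁ i ]≔ lookup η (Fin.suc i)) [ Fin.suc i ]≔ lookup η (inject₁ i)

sP : ∀ {m} → Fin m → Poly (suc m) → Poly (suc m)
sP i = map (λ t → proj₁ t , swapC i (proj₂ t))

-- ∂_i on a term c x^η, with a = η_i, b = η_{i+1}:
--   (s_i − 1)(x_i^a x_{i+1}^b)/(x_i − x_{i+1})
--     = + Σ_{k=0}^{t} x_i^{a+k} x_{i+1}^{a+t−k}   if b = a+t+1
--     = 0                                         if a = b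
--     = − Σ_{k=0}^{t} x_i^{b+k} x_{i+1}^{b+t−k}   if a = b+t+1
-- set the exponents of x_i, x_{i+1} to u, v
setAB : ∀ {m} → Fin m → Comp (suc m) → ℕ → ℕ → Comp (suc m)
setAB i η u v = (η [ inject₁ i ]≔ u) [ Fin.suc i ]≔ v

∂aux : ∀ {m} → Fin m → 𝔽 → Comp (suc m) → (a b : ℕ) → ℕ.Ordering a b → Poly (suc m)
∂aux i c η _ _ (less a t)    = map (λ k → c , setAB i η (a ℕ.+ k) ((a ℕ.+ t) ∸ k)) (upTo (suc t))
∂aux i c η _ _ (equal _)     = []
∂aux i c η _ _ (greater b t) = map (λ k → (-F c) , setAB i η (b ℕ.+ k) ((b ℕ.+ t) ∸ k)) (upTo (suc t))

∂term : ∀ {m} → Fin m → 𝔽 × Comp (suc m) → Poly (suc m)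
∂term i (c , η) = ∂aux i c η _ _ (compare (lookup η (inject₁ i)) (lookup η (Fin.suc i)))

∂P : ∀ {m} → Fin m → Poly (suc m) → Poly (suc m)
∂P i = concatMap (∂term i)

σ⁺ : ∀ {m} → Fin m → Poly (suc m) → Poly (suc m)
σ⁺ i f = sP i f +ₚ scale rF (∂P i f)

ΦC : ∀ {m} → Comp (suc m) → Comp (suc m)
ΦC (a V.∷ η) = η ∷ʳ suc a

-- Φ⁺ f(x) = x_n f(x_n + 1, x_1, …, x_{n-1}); on a term c x^{(a,η')}:
--   c · x_n (x_n + 1)^a x^{(η',0)}
Φ⁺ : ∀ {m} → Poly (suc m) → Poly (suc m)
Φ⁺ {m} = concatMap term
  where
    xn : Poly (suc m)
    xn = var (fromℕ m)
    term : 𝔽 × Comp (suc m) → Poly (suc m)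
    term (c , (a V.∷ η)) = scale c (xn *ₚ (((xn +ₚ constP 1F) ^ₚ a) *ₚ mono (η ∷ʳ 0)))

{-# OPTIONS --safe #-}
-- Ξ(xᵑ) is characterised by interpolation: it is the polynomial
-- xᵑ + (terms of degree < |η|) that vanishes at −γ̄ for all |γ| < |η|.  The
-- operators σᵢ⁺ and Φ⁺ send such polynomials for η to such polynomials for sᵢη
-- and Φη (when γᵢ = γᵢ₊₁ the coordinates of γ̄ differ by r, so the two parts of
-- σᵢ⁺ cancel; every γ is Φγ′ or ends in 0, where the factor x_n vanishes), and
-- interpolation is unique.  To see that Ξ(xᵑ) is of this kind, take such a G
-- and correct it by a combination of the E_γ, |γ| = |η|, with (−1)^{|γ|} and
-- x ↦ −x applied, so that it also vanishes at −γ̄ for |γ| = |η|: the result is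
-- zero, its top component expresses xᵑ through the E_γ^{(α)}, and applying Ξ
-- gives back G.
module Submission where

open import Defs
open import Algebra.Bundles using (CommutativeRing; CommutativeSemiring)
import Algebra.Properties.Ring as RingProperties
import Algebra.Solver.Ring.NaturalCoefficients.Default as SemiringSolver
open import Data.Bool using (if_then_else_)
open import Data.Empty using (⊥-elim)
open import Data.Fin as Fin using (Fin; inject₁; fromℕ)
open import Data.Integer as ℤ using (+_)
import Data.Integer.Properties as ℤₚ
open import Data.List as List using (List; []; _∷_; _++_)
open import Data.List.Membership.Propositional using (_∈_)
open import Data.List.Membership.Propositional.Properties using (∈-concatMap⁺; ∈-filter⁺; ∈-map⁺; ∈-upTo⁺)
import Data.List.Properties as Listₚ
open import Data.List.Relation.Unary.All as All using (All; []; _∷_)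
import Data.List.Relation.Unary.All.Properties as Allₚ
open import Data.List.Relation.Unary.Any as Any using (here)
open import Data.Nat as ℕ using (ℕ; zero; suc; _≤_; _<_; z≤n; s≤s; _∸_)
import Data.Nat.Properties as ℕₚ
open import Data.Product using (∃; _×_; _,_; proj₁; proj₂)
open import Data.Rational as ℚ using (ℚ; 0ℚ; 1ℚ)
import Data.Rational.Properties as ℚₚ
import Data.Rational.Unnormalised as ℚᵘ
import Data.Rational.Unnormalised.Properties as ℚᵘₚ
open import Data.Sum using (_⊎_; inj₁; inj₂)
open import Data.Vec as Vec using (Vec; []; _∷_; _∷ʳ_; lookup; zipWith; replicate; tabulate; init; last)
import Data.Vec.Properties as Vecₚ
open import Function using (_∘_; _$_)
open import Level using (0ℓ)
open import Relation.Binary.Bundles using (Setoid)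
open import Relation.Binary.PropositionalEquality as ≡ using (_≡_; _≢_; refl; sym; trans; cong; cong₂; subst; subst₂)
import Relation.Binary.Reasoning.Setoid as SetoidReasoning
open import Relation.Nullary using (¬_; Dec; does; yes; no)
open import Relation.Nullary.Decidable using (_×-dec_)

-- Everything rests on uniqueness of interpolation, whose induction reuses the rotation behind `Φ⁺`.
-- The points -γ̄ fall into two families. If γ ends in 0, the point lies on one fixed hyperplane x_n
-- = c, and its other coordinates form an interpolation point in one variable fewer. Otherwise γ =
-- Φγ′, and the point is that of γ′ rotated, the moved coordinate being lowered by 1. So a
-- polynomial is restricted to the hyperplane and divided by x_n - c, and both results fall under
-- the induction. Dropping the final 0 leaves every other coefficient of r one too large for the
-- smaller n; the induction therefore runs over points with an arbitrary shift `s` of these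
-- coefficients. The encoding is the other obstacle: polynomials are term lists in which exponents
-- may repeat, and `Ξ` is only constrained up to equality of coefficients. Coefficients and values
-- are therefore both treated as linear functionals `pair φ`, each operator is studied through the
-- functional it pulls φ back to, and `pair-ext` shows once and for all that functionals depend on
-- coefficients alone.

open 𝔽

-- The polynomial ring ℚ[r]

-- Equality of coefficient lists is wrapped in a record so that its two
-- sides can be inferred; likewise _≃_ for _≈_ below.
record _≋_ (p q : RPoly) : Set where
  constructor mk≋
  field coef≡ : p ≈ᵣ q
open _≋_

infix 4 _≋_

≋-refl : ∀ {p} → p ≋ p
≋-refl = mk≋ λ _ → refl

≋-sym : ∀ {p q} → p ≋ q → q ≋ p
≋-sym (mk≋ e) = mk≋ (sym ∘ e)

≋-trans : ∀ {p q s} → p ≋ q → q ≋ s → p ≋ s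
≋-trans (mk≋ e) (mk≋ f) = mk≋ λ k → trans (e k) (f k)

rcoef-+ᵣ : ∀ p q k → rcoef k (p +ᵣ q) ≡ rcoef k p ℚ.+ rcoef k q
rcoef-+ᵣ []      q       k       = sym (ℚₚ.+-identityˡ _)
rcoef-+ᵣ (a ∷ p) []      k       = sym (ℚₚ.+-identityʳ _)
rcoef-+ᵣ (a ∷ p) (b ∷ q) zero    = refl
rcoef-+ᵣ (a ∷ p) (b ∷ q) (suc k) = rcoef-+ᵣ p q k

_·ᵣ_ : ℚ → RPoly → RPoly
a ·ᵣ p = List.map (a ℚ.*_) p

rcoef-·ᵣ : ∀ a p k → rcoef k (a ·ᵣ p) ≡ a ℚ.* rcoef k p
rcoef-·ᵣ a []      k       = sym (ℚₚ.*-zeroʳ a)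
rcoef-·ᵣ a (b ∷ p) zero    = refl
rcoef-·ᵣ a (b ∷ p) (suc k) = rcoef-·ᵣ a p k

rcoef--ᵣ : ∀ p k → rcoef k (-ᵣ p) ≡ ℚ.- rcoef k p
rcoef--ᵣ []      k       = refl
rcoef--ᵣ (b ∷ p) zero    = refl
rcoef--ᵣ (b ∷ p) (suc k) = rcoef--ᵣ p k

+ᵣ-cong : ∀ {p p′ q q′} → p ≋ p′ → q ≋ q′ → p +ᵣ q ≋ p′ +ᵣ q′
+ᵣ-cong {p} {p′} {q} {q′} (mk≋ e) (mk≋ f) = mk≋ λ k →
  trans (rcoef-+ᵣ p q k) (trans (cong₂ ℚ._+_ (e k) (f k)) (sym (rcoef-+ᵣ p′ q′ k)))

+ᵣ-congˡ : ∀ p {q q′} → q ≋ q′ → p +ᵣ q ≋ p +ᵣ q′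
+ᵣ-congˡ p = +ᵣ-cong (≋-refl {p})

+ᵣ-congʳ : ∀ q {p p′} → p ≋ p′ → p +ᵣ q ≋ p′ +ᵣ q
+ᵣ-congʳ q e = +ᵣ-cong e (≋-refl {q})

+ᵣ-comm : ∀ p q → p +ᵣ q ≋ q +ᵣ p
+ᵣ-comm p q = mk≋ λ k →
  trans (rcoef-+ᵣ p q k) (trans (ℚₚ.+-comm (rcoef k p) (rcoef k q)) (sym (rcoef-+ᵣ q p k)))

+ᵣ-assoc : ∀ p q s → (p +ᵣ q) +ᵣ s ≋ p +ᵣ (q +ᵣ s)
+ᵣ-assoc p q s = mk≋ λ k → begin
  rcoef k ((p +ᵣ q) +ᵣ s)                    ≡⟨ rcoef-+ᵣ (p +ᵣ q) s k ⟩
  rcoef k (p +ᵣ q) ℚ.+ rcoef k s             ≡⟨ cong (ℚ._+ rcoef k s) (rcoef-+ᵣ p q k) ⟩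
  rcoef k p ℚ.+ rcoef k q ℚ.+ rcoef k s      ≡⟨ ℚₚ.+-assoc (rcoef k p) (rcoef k q) (rcoef k s) ⟩
  rcoef k p ℚ.+ (rcoef k q ℚ.+ rcoef k s)    ≡⟨ cong (rcoef k p ℚ.+_) (rcoef-+ᵣ q s k) ⟨
  rcoef k p ℚ.+ rcoef k (q +ᵣ s)             ≡⟨ rcoef-+ᵣ p (q +ᵣ s) k ⟨
  rcoef k (p +ᵣ (q +ᵣ s))                    ∎
  where open ≡.≡-Reasoning

+ᵣ-identityʳ : ∀ p → p +ᵣ [] ≋ p
+ᵣ-identityʳ []      = ≋-refl
+ᵣ-identityʳ (a ∷ p) = ≋-refl

-ᵣ-cong : ∀ {p q} → p ≋ q → -ᵣ p ≋ -ᵣ q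
-ᵣ-cong {p} {q} (mk≋ e) = mk≋ λ k →
  trans (rcoef--ᵣ p k) (trans (cong ℚ.-_ (e k)) (sym (rcoef--ᵣ q k)))

-ᵣ-inverseˡ : ∀ p → (-ᵣ p) +ᵣ p ≋ []
-ᵣ-inverseˡ p = mk≋ λ k →
  trans (rcoef-+ᵣ (-ᵣ p) p k)
    (trans (cong (ℚ._+ rcoef k p) (rcoef--ᵣ p k)) (ℚₚ.+-inverseˡ (rcoef k p)))

∷-cong : ∀ {a b p q} → a ≡ b → p ≋ q → (a ∷ p) ≋ (b ∷ q)
∷-cong a≡b (mk≋ e) = mk≋ λ { zero → a≡b ; (suc k) → e k }

0∷[]≋[] : (0ℚ ∷ []) ≋ []
0∷[]≋[] = mk≋ λ { zero → refl ; (suc k) → refl }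

≋-setoid : Setoid 0ℓ 0ℓ
≋-setoid = record
  { Carrier = RPoly ; _≈_ = _≋_
  ; isEquivalence = record { refl = ≋-refl ; sym = ≋-sym ; trans = ≋-trans } }

module ≋-Reasoning = SetoidReasoning ≋-setoid

·ᵣ-cong : ∀ a {p q} → p ≋ q → a ·ᵣ p ≋ a ·ᵣ q
·ᵣ-cong a {p} {q} (mk≋ e) = mk≋ λ k →
  trans (rcoef-·ᵣ a p k) (trans (cong (a ℚ.*_) (e k)) (sym (rcoef-·ᵣ a q k)))

·ᵣ-distribˡ : ∀ a p q → a ·ᵣ (p +ᵣ q) ≋ (a ·ᵣ p) +ᵣ (a ·ᵣ q)
·ᵣ-distribˡ a p q = mk≋ λ k → begin
  rcoef k (a ·ᵣ (p +ᵣ q))                       ≡⟨ rcoef-·ᵣ a (p +ᵣ q) k ⟩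
  a ℚ.* rcoef k (p +ᵣ q)                        ≡⟨ cong (a ℚ.*_) (rcoef-+ᵣ p q k) ⟩
  a ℚ.* (rcoef k p ℚ.+ rcoef k q)               ≡⟨ ℚₚ.*-distribˡ-+ a (rcoef k p) (rcoef k q) ⟩
  a ℚ.* rcoef k p ℚ.+ a ℚ.* rcoef k q           ≡⟨ cong₂ ℚ._+_ (rcoef-·ᵣ a p k) (rcoef-·ᵣ a q k) ⟨
  rcoef k (a ·ᵣ p) ℚ.+ rcoef k (a ·ᵣ q)         ≡⟨ rcoef-+ᵣ (a ·ᵣ p) (a ·ᵣ q) k ⟨
  rcoef k ((a ·ᵣ p) +ᵣ (a ·ᵣ q))                ∎
  where open ≡.≡-Reasoning

·ᵣ-assoc : ∀ a b p → (a ℚ.* b) ·ᵣ p ≋ a ·ᵣ (b ·ᵣ p)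
·ᵣ-assoc a b p = mk≋ λ k →
  trans (rcoef-·ᵣ (a ℚ.* b) p k) (trans (ℚₚ.*-assoc a b (rcoef k p))
    (sym (trans (rcoef-·ᵣ a (b ·ᵣ p) k) (cong (a ℚ.*_) (rcoef-·ᵣ b p k)))))

0·ᵣ : ∀ p → 0ℚ ·ᵣ p ≋ []
0·ᵣ p = mk≋ λ k → trans (rcoef-·ᵣ 0ℚ p k) (ℚₚ.*-zeroˡ (rcoef k p))

1·ᵣ : ∀ p → 1ℚ ·ᵣ p ≋ p
1·ᵣ p = mk≋ λ k → trans (rcoef-·ᵣ 1ℚ p k) (ℚₚ.*-identityˡ (rcoef k p))

+ᵣ-interchange : ∀ p q s t → (p +ᵣ q) +ᵣ (s +ᵣ t) ≋ (p +ᵣ s) +ᵣ (q +ᵣ t)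
+ᵣ-interchange p q s t = begin
  (p +ᵣ q) +ᵣ (s +ᵣ t)   ≈⟨ +ᵣ-assoc p q (s +ᵣ t) ⟩
  p +ᵣ (q +ᵣ (s +ᵣ t))   ≈⟨ +ᵣ-congˡ p (+ᵣ-assoc q s t) ⟨
  p +ᵣ ((q +ᵣ s) +ᵣ t)   ≈⟨ +ᵣ-congˡ p (+ᵣ-congʳ t (+ᵣ-comm q s)) ⟩
  p +ᵣ ((s +ᵣ q) +ᵣ t)   ≈⟨ +ᵣ-congˡ p (+ᵣ-assoc s q t) ⟩
  p +ᵣ (s +ᵣ (q +ᵣ t))   ≈⟨ +ᵣ-assoc p s (q +ᵣ t) ⟨
  (p +ᵣ s) +ᵣ (q +ᵣ t)   ∎
  where open ≋-Reasoning

*ᵣ-congˡ : ∀ p {q q′} → q ≋ q′ → p *ᵣ q ≋ p *ᵣ q′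
*ᵣ-congˡ []      e = ≋-refl
*ᵣ-congˡ (a ∷ p) e = +ᵣ-cong (·ᵣ-cong a e) (∷-cong refl (*ᵣ-congˡ p e))

*ᵣ-zeroʳ : ∀ p → p *ᵣ [] ≋ []
*ᵣ-zeroʳ []      = ≋-refl
*ᵣ-zeroʳ (a ∷ p) = ≋-trans (∷-cong refl (*ᵣ-zeroʳ p)) 0∷[]≋[]

-- `*ᵣ` recurses on its left factor only. This expansion in the right factor makes commutativity a
-- short induction, and lets `*ᵣ-integral` strip a zero constant term from the right.
*ᵣ-∷ : ∀ p b q → p *ᵣ (b ∷ q) ≋ (b ·ᵣ p) +ᵣ (0ℚ ∷ (p *ᵣ q))
*ᵣ-∷ []      b q = ≋-sym 0∷[]≋[]
*ᵣ-∷ (a ∷ p) b q = ∷-cong (cong (ℚ._+ 0ℚ) (ℚₚ.*-comm a b)) $ begin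
  (a ·ᵣ q) +ᵣ (p *ᵣ (b ∷ q))                   ≈⟨ +ᵣ-congˡ (a ·ᵣ q) (*ᵣ-∷ p b q) ⟩
  (a ·ᵣ q) +ᵣ ((b ·ᵣ p) +ᵣ (0ℚ ∷ (p *ᵣ q)))    ≈⟨ +ᵣ-assoc (a ·ᵣ q) (b ·ᵣ p) _ ⟨
  ((a ·ᵣ q) +ᵣ (b ·ᵣ p)) +ᵣ (0ℚ ∷ (p *ᵣ q))    ≈⟨ +ᵣ-congʳ (0ℚ ∷ (p *ᵣ q)) (+ᵣ-comm (a ·ᵣ q) (b ·ᵣ p)) ⟩
  ((b ·ᵣ p) +ᵣ (a ·ᵣ q)) +ᵣ (0ℚ ∷ (p *ᵣ q))    ≈⟨ +ᵣ-assoc (b ·ᵣ p) (a ·ᵣ q) _ ⟩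
  (b ·ᵣ p) +ᵣ ((a ·ᵣ q) +ᵣ (0ℚ ∷ (p *ᵣ q)))    ∎
  where open ≋-Reasoning

*ᵣ-comm : ∀ p q → p *ᵣ q ≋ q *ᵣ p
*ᵣ-comm []      q = ≋-sym (*ᵣ-zeroʳ q)
*ᵣ-comm (a ∷ p) q = ≋-trans (+ᵣ-congˡ (a ·ᵣ q) (∷-cong refl (*ᵣ-comm p q))) (≋-sym (*ᵣ-∷ q a p))

*ᵣ-cong : ∀ {p p′ q q′} → p ≋ p′ → q ≋ q′ → p *ᵣ q ≋ p′ *ᵣ q′
*ᵣ-cong {p} {p′} {q} {q′} e f = begin
  p *ᵣ q    ≈⟨ *ᵣ-congˡ p f ⟩
  p *ᵣ q′   ≈⟨ *ᵣ-comm p q′ ⟩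
  q′ *ᵣ p   ≈⟨ *ᵣ-congˡ q′ e ⟩
  q′ *ᵣ p′  ≈⟨ *ᵣ-comm q′ p′ ⟩
  p′ *ᵣ q′  ∎
  where open ≋-Reasoning

*ᵣ-congʳ : ∀ q {p p′} → p ≋ p′ → p *ᵣ q ≋ p′ *ᵣ q
*ᵣ-congʳ q e = *ᵣ-cong e (≋-refl {q})

0∷-+ᵣ : ∀ p q → (0ℚ ∷ (p +ᵣ q)) ≋ (0ℚ ∷ p) +ᵣ (0ℚ ∷ q)
0∷-+ᵣ p q = ∷-cong refl ≋-refl

*ᵣ-distribˡ : ∀ p q s → p *ᵣ (q +ᵣ s) ≋ (p *ᵣ q) +ᵣ (p *ᵣ s)
*ᵣ-distribˡ []      q s = ≋-refl
*ᵣ-distribˡ (a ∷ p) q s = begin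
  (a ·ᵣ (q +ᵣ s)) +ᵣ (0ℚ ∷ (p *ᵣ (q +ᵣ s)))
    ≈⟨ +ᵣ-cong (·ᵣ-distribˡ a q s) (≋-trans (∷-cong refl (*ᵣ-distribˡ p q s)) (0∷-+ᵣ (p *ᵣ q) (p *ᵣ s))) ⟩
  ((a ·ᵣ q) +ᵣ (a ·ᵣ s)) +ᵣ ((0ℚ ∷ (p *ᵣ q)) +ᵣ (0ℚ ∷ (p *ᵣ s)))
    ≈⟨ +ᵣ-interchange (a ·ᵣ q) (a ·ᵣ s) (0ℚ ∷ (p *ᵣ q)) (0ℚ ∷ (p *ᵣ s)) ⟩
  ((a ·ᵣ q) +ᵣ (0ℚ ∷ (p *ᵣ q))) +ᵣ ((a ·ᵣ s) +ᵣ (0ℚ ∷ (p *ᵣ s)))  ∎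
  where open ≋-Reasoning

*ᵣ-distribʳ : ∀ s p q → (p +ᵣ q) *ᵣ s ≋ (p *ᵣ s) +ᵣ (q *ᵣ s)
*ᵣ-distribʳ s p q = begin
  (p +ᵣ q) *ᵣ s         ≈⟨ *ᵣ-comm (p +ᵣ q) s ⟩
  s *ᵣ (p +ᵣ q)         ≈⟨ *ᵣ-distribˡ s p q ⟩
  (s *ᵣ p) +ᵣ (s *ᵣ q)  ≈⟨ +ᵣ-cong (*ᵣ-comm s p) (*ᵣ-comm s q) ⟩
  (p *ᵣ s) +ᵣ (q *ᵣ s)  ∎
  where open ≋-Reasoning

·ᵣ-*ᵣ : ∀ a p q → (a ·ᵣ p) *ᵣ q ≋ a ·ᵣ (p *ᵣ q)
·ᵣ-*ᵣ a []      q = ≋-refl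
·ᵣ-*ᵣ a (b ∷ p) q = begin
  ((a ℚ.* b) ·ᵣ q) +ᵣ (0ℚ ∷ ((a ·ᵣ p) *ᵣ q))
    ≈⟨ +ᵣ-cong (·ᵣ-assoc a b q) (∷-cong (sym (ℚₚ.*-zeroʳ a)) (·ᵣ-*ᵣ a p q)) ⟩
  (a ·ᵣ (b ·ᵣ q)) +ᵣ (a ·ᵣ (0ℚ ∷ (p *ᵣ q)))
    ≈⟨ ·ᵣ-distribˡ a (b ·ᵣ q) (0ℚ ∷ (p *ᵣ q)) ⟨
  a ·ᵣ ((b ·ᵣ q) +ᵣ (0ℚ ∷ (p *ᵣ q)))  ∎
  where open ≋-Reasoning

0∷-*ᵣ : ∀ p q → (0ℚ ∷ p) *ᵣ q ≋ (0ℚ ∷ (p *ᵣ q))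
0∷-*ᵣ p q = +ᵣ-congʳ (0ℚ ∷ (p *ᵣ q)) (0·ᵣ q)

*ᵣ-assoc : ∀ p q s → (p *ᵣ q) *ᵣ s ≋ p *ᵣ (q *ᵣ s)
*ᵣ-assoc []      q s = ≋-refl
*ᵣ-assoc (a ∷ p) q s = begin
  ((a ·ᵣ q) +ᵣ (0ℚ ∷ (p *ᵣ q))) *ᵣ s
    ≈⟨ *ᵣ-distribʳ s (a ·ᵣ q) (0ℚ ∷ (p *ᵣ q)) ⟩
  ((a ·ᵣ q) *ᵣ s) +ᵣ ((0ℚ ∷ (p *ᵣ q)) *ᵣ s)
    ≈⟨ +ᵣ-cong (·ᵣ-*ᵣ a q s) (≋-trans (0∷-*ᵣ (p *ᵣ q) s) (∷-cong refl (*ᵣ-assoc p q s))) ⟩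
  (a ·ᵣ (q *ᵣ s)) +ᵣ (0ℚ ∷ (p *ᵣ (q *ᵣ s)))  ∎
  where open ≋-Reasoning

1ᵣ : RPoly
1ᵣ = 1ℚ ∷ []

*ᵣ-identityˡ : ∀ p → 1ᵣ *ᵣ p ≋ p
*ᵣ-identityˡ p = ≋-trans (+ᵣ-cong (1·ᵣ p) 0∷[]≋[]) (+ᵣ-identityʳ p)

ℚ[r] : CommutativeRing 0ℓ 0ℓ
ℚ[r] = record
  { Carrier = RPoly ; _≈_ = _≋_ ; _+_ = _+ᵣ_ ; _*_ = _*ᵣ_ ; -_ = -ᵣ_ ; 0# = [] ; 1# = 1ᵣ
  ; isCommutativeRing = record
    { isRing = record
      { +-isAbelianGroup = record
        { isGroup = record
          { isMonoid = record
            { isSemigroup = record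
              { isMagma = record
                { isEquivalence = Setoid.isEquivalence ≋-setoid ; ∙-cong = +ᵣ-cong }
              ; assoc = +ᵣ-assoc }
            ; identity = (λ p → ≋-refl) , +ᵣ-identityʳ }
          ; inverse = -ᵣ-inverseˡ , λ p → ≋-trans (+ᵣ-comm p (-ᵣ p)) (-ᵣ-inverseˡ p)
          ; ⁻¹-cong = -ᵣ-cong }
        ; comm = +ᵣ-comm }
      ; *-cong = *ᵣ-cong
      ; *-assoc = *ᵣ-assoc
      ; *-identity = *ᵣ-identityˡ , λ p → ≋-trans (*ᵣ-comm p 1ᵣ) (*ᵣ-identityˡ p)
      ; distrib = *ᵣ-distribˡ , *ᵣ-distribʳ }
    ; *-comm = *ᵣ-comm } }

ℚ-integral : ∀ a b → b ≢ 0ℚ → a ℚ.* b ≡ 0ℚ → a ≡ 0ℚ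
ℚ-integral a b b≢0 ab≡0 = begin
  a                       ≡⟨ ℚₚ.*-identityʳ a ⟨
  a ℚ.* 1ℚ                ≡⟨ cong (a ℚ.*_) (ℚₚ.*-inverseʳ b) ⟨
  a ℚ.* (b ℚ.* ℚ.1/ b)    ≡⟨ ℚₚ.*-assoc a b (ℚ.1/ b) ⟨
  a ℚ.* b ℚ.* ℚ.1/ b      ≡⟨ cong (ℚ._* ℚ.1/ b) ab≡0 ⟩
  0ℚ ℚ.* ℚ.1/ b           ≡⟨ ℚₚ.*-zeroˡ (ℚ.1/ b) ⟩
  0ℚ                      ∎
  where
  open ≡.≡-Reasoning
  instance b-nonZero = ℚ.≢-nonZero b≢0

∷≋[] : ∀ {a p} → a ≡ 0ℚ → p ≋ [] → (a ∷ p) ≋ []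
∷≋[] a≡0 e = ≋-trans (∷-cong a≡0 e) 0∷[]≋[]

tail≋[] : ∀ {a p} → (a ∷ p) ≋ [] → p ≋ []
tail≋[] (mk≋ e) = mk≋ λ k → e (suc k)

-- Argument by lowest coefficients. If the constant term `b` of the right factor is nonzero, the
-- coefficients of `p` are killed one after the other by dividing by `b`. If it is zero, the right
-- factor and the product both lose a factor r.
*ᵣ-integral : ∀ p q → NonZeroᵣ q → p *ᵣ q ≋ [] → p ≋ []
*ᵣ-integral p []      (k , nz) e = ⊥-elim (nz refl)
*ᵣ-integral p (b ∷ q) nz       e with b ℚ.≟ 0ℚ
... | no b≢0 = go p e
  where
  go : ∀ p → p *ᵣ (b ∷ q) ≋ [] → p ≋ []
  go []      e = ≋-refl
  go (a ∷ p) e = ∷≋[] a≡0 (go p (tail≋[] (≋-trans (≋-sym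
      (+ᵣ-congʳ (0ℚ ∷ (p *ᵣ (b ∷ q))) (subst (λ x → x ·ᵣ (b ∷ q) ≋ []) (sym a≡0) (0·ᵣ (b ∷ q))))) e)))
    where
    a≡0 : a ≡ 0ℚ
    a≡0 = ℚ-integral a b b≢0 (trans (sym (ℚₚ.+-identityʳ (a ℚ.* b))) (coef≡ e 0))
... | yes b≡0 with nz
...   | zero  , b≢0 = ⊥-elim (b≢0 b≡0)
...   | suc k , q≢0 = *ᵣ-integral p q (k , q≢0) (tail≋[] (begin
    (0ℚ ∷ (p *ᵣ q))                 ≈⟨ +ᵣ-congʳ (0ℚ ∷ (p *ᵣ q)) (0·ᵣ p) ⟨
    (0ℚ ·ᵣ p) +ᵣ (0ℚ ∷ (p *ᵣ q))    ≈⟨ *ᵣ-∷ p 0ℚ q ⟨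
    p *ᵣ (0ℚ ∷ q)                   ≡⟨ cong (λ x → p *ᵣ (x ∷ q)) b≡0 ⟨
    p *ᵣ (b ∷ q)                    ≈⟨ e ⟩
    []                              ∎))
  where open ≋-Reasoning

zeroᵣ? : ∀ p → (p ≋ []) ⊎ NonZeroᵣ p
zeroᵣ? []      = inj₁ ≋-refl
zeroᵣ? (a ∷ p) with a ℚ.≟ 0ℚ | zeroᵣ? p
... | no a≢0  | _              = inj₂ (0 , a≢0)
... | yes a≡0 | inj₁ p≋[]      = inj₁ (∷≋[] a≡0 p≋[])
... | yes a≡0 | inj₂ (k , p≢0) = inj₂ (suc k , p≢0)

NonZeroᵣ⇒≄ : ∀ {p} → NonZeroᵣ p → ¬ (p ≋ [])
NonZeroᵣ⇒≄ (k , p≢0) (mk≋ e) = p≢0 (e k)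

-- The field ℚ(r)

-- The axioms for fractions n/d, m/e, k/l after cross-multiplication. The abstract semiring keeps
-- the arithmetic of coefficient lists out of the solver's sight.
module FractionIdentities {c ℓ} (R : CommutativeSemiring c ℓ) where
  open CommutativeSemiring R renaming (refl to ≈-refl) hiding (sym; trans) renaming (_≈_ to _≈R_)
  open SemiringSolver R

  sum-cross : ∀ n d m e k l → (n * e + m * d) * (k * l) ≈R (n * k) * (e * l) + (m * l) * (d * k)
  sum-cross = solve 6 (λ n d m e k l →
    (n :* e :+ m :* d) :* (k :* l) := (n :* k) :* (e :* l) :+ (m :* l) :* (d :* k)) ≈-refl

  sum-assoc : ∀ n d m e k l →
    ((n * e + m * d) * l + k * (d * e)) * (d * (e * l)) ≈R (n * (e * l) + (m * l + k * e) * d) * ((d * e) * l)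
  sum-assoc = solve 6 (λ n d m e k l →
    ((n :* e :+ m :* d) :* l :+ k :* (d :* e)) :* (d :* (e :* l)) :=
    (n :* (e :* l) :+ (m :* l :+ k :* e) :* d) :* ((d :* e) :* l)) ≈-refl

  sum-comm : ∀ n d m e → (n * e + m * d) * (e * d) ≈R (m * d + n * e) * (d * e)
  sum-comm = solve 4 (λ n d m e → (n :* e :+ m :* d) :* (e :* d) := (m :* d :+ n :* e) :* (d :* e)) ≈-refl

  *-interchange : ∀ n m k l → (n * m) * (k * l) ≈R (n * k) * (m * l)
  *-interchange = solve 4 (λ n m k l → (n :* m) :* (k :* l) := (n :* k) :* (m :* l)) ≈-refl

  *-swapʳ : ∀ n m k → (n * m) * k ≈R (n * k) * m
  *-swapʳ = solve 3 (λ n m k → (n :* m) :* k := (n :* k) :* m) ≈-refl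

  product-assoc : ∀ n m k d e l → ((n * m) * k) * (d * (e * l)) ≈R (n * (m * k)) * ((d * e) * l)
  product-assoc = solve 6 (λ n m k d e l →
    ((n :* m) :* k) :* (d :* (e :* l)) := (n :* (m :* k)) :* ((d :* e) :* l)) ≈-refl

  product-comm : ∀ n m d e → (n * m) * (e * d) ≈R (m * n) * (d * e)
  product-comm = solve 4 (λ n m d e → (n :* m) :* (e :* d) := (m :* n) :* (d :* e)) ≈-refl

  product-distrib : ∀ n d m e k l →
    (n * (m * l + k * e)) * ((d * e) * (d * l)) ≈R ((n * m) * (d * l) + (n * k) * (d * e)) * (d * (e * l))
  product-distrib = solve 6 (λ n d m e k l →
    (n :* (m :* l :+ k :* e)) :* ((d :* e) :* (d :* l)) :=
    ((n :* m) :* (d :* l) :+ (n :* k) :* (d :* e)) :* (d :* (e :* l))) ≈-refl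

open FractionIdentities (CommutativeRing.commutativeSemiring ℚ[r])

infix 4 _≃_

record _≃_ (a b : 𝔽) : Set where
  constructor mk≃
  field eq : a ≈ b
open _≃_

den′ : 𝔽 → RPoly
den′ a = prodᵣ (den a)

private
  module R = CommutativeRing ℚ[r]
  module Rₚ = RingProperties (CommutativeRing.ring ℚ[r])

-- The denominator of a sum or product is `prodᵣ` of a concatenation, which equals a product of
-- denominators only up to `≋`. Free choice of `da` and `db` brings each goal into the shape of
-- `FractionIdentities`.
≃-intro : ∀ {a b} da db → den′ a ≋ da → den′ b ≋ db → num a *ᵣ db ≋ num b *ᵣ da → a ≃ b
≃-intro {a} {b} da db e f g = mk≃ (_≋_.coef≡ (begin
  num a *ᵣ den′ b  ≈⟨ *ᵣ-congˡ (num a) f ⟩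
  num a *ᵣ db      ≈⟨ g ⟩
  num b *ᵣ da      ≈⟨ *ᵣ-congˡ (num b) e ⟨
  num b *ᵣ den′ a  ∎))
  where open ≋-Reasoning

≃-elim : ∀ {a b} → a ≃ b → num a *ᵣ den′ b ≋ num b *ᵣ den′ a
≃-elim (mk≃ e) = mk≋ e

*ᵣ-cancelʳ : ∀ p q s → NonZeroᵣ s → p *ᵣ s ≋ q *ᵣ s → p ≋ q
*ᵣ-cancelʳ p q s s≢0 e = Rₚ.-‿injective (begin
  -ᵣ p  ≈⟨ Rₚ.+-cancelʳ p (-ᵣ p) (-ᵣ q) (begin
             (-ᵣ p) +ᵣ p   ≈⟨ R.-‿inverseˡ p ⟩
             []            ≈⟨ *ᵣ-integral ((-ᵣ q) +ᵣ p) s s≢0 (begin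
               ((-ᵣ q) +ᵣ p) *ᵣ s             ≈⟨ *ᵣ-distribʳ s (-ᵣ q) p ⟩
               ((-ᵣ q) *ᵣ s) +ᵣ (p *ᵣ s)      ≈⟨ +ᵣ-congˡ ((-ᵣ q) *ᵣ s) e ⟩
               ((-ᵣ q) *ᵣ s) +ᵣ (q *ᵣ s)      ≈⟨ *ᵣ-distribʳ s (-ᵣ q) q ⟨
               ((-ᵣ q) +ᵣ q) *ᵣ s             ≈⟨ *ᵣ-congʳ s (R.-‿inverseˡ q) ⟩
               []                             ∎) ⟨
             (-ᵣ q) +ᵣ p   ∎) ⟩
  -ᵣ q  ∎)
  where open ≋-Reasoning

NonZeroᵣ-* : ∀ p q → NonZeroᵣ p → NonZeroᵣ q → NonZeroᵣ (p *ᵣ q)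
NonZeroᵣ-* p q p≢0 q≢0 with zeroᵣ? (p *ᵣ q)
... | inj₁ e  = ⊥-elim (NonZeroᵣ⇒≄ p≢0 (*ᵣ-integral p q q≢0 e))
... | inj₂ nz = nz

prodᵣ-nonZero : ∀ ds → NonZeroᵣ (prodᵣ ds)
prodᵣ-nonZero []             = 0 , 1≢0
prodᵣ-nonZero ((d , nz) ∷ ds) = NonZeroᵣ-* d (prodᵣ ds) nz (prodᵣ-nonZero ds)

prodᵣ-++ : ∀ ds es → prodᵣ (ds ++ es) ≋ prodᵣ ds *ᵣ prodᵣ es
prodᵣ-++ []       es = ≋-sym (*ᵣ-identityˡ (prodᵣ es))
prodᵣ-++ (d ∷ ds) es =
  ≋-trans (*ᵣ-congˡ (proj₁ d) (prodᵣ-++ ds es)) (≋-sym (*ᵣ-assoc (proj₁ d) (prodᵣ ds) (prodᵣ es)))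

≃-refl : ∀ {a} → a ≃ a
≃-refl = mk≃ λ _ → refl

≃-sym : ∀ {a b} → a ≃ b → b ≃ a
≃-sym (mk≃ e) = mk≃ (sym ∘ e)

-- The middle denominator has to be cancelled, so even transitivity depends on the integrality of
-- ℚ[r].
≃-trans : ∀ {a b c} → a ≃ b → b ≃ c → a ≃ c
≃-trans {a} {b} {c} e f = mk≃ (_≋_.coef≡ (*ᵣ-cancelʳ (num a *ᵣ den′ c) (num c *ᵣ den′ a) (den′ b) (prodᵣ-nonZero (den b)) (begin
  (num a *ᵣ den′ c) *ᵣ den′ b  ≈⟨ *-swapʳ (num a) (den′ c) (den′ b) ⟩
  (num a *ᵣ den′ b) *ᵣ den′ c  ≈⟨ *ᵣ-congʳ (den′ c) (≃-elim e) ⟩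
  (num b *ᵣ den′ a) *ᵣ den′ c  ≈⟨ *-swapʳ (num b) (den′ a) (den′ c) ⟩
  (num b *ᵣ den′ c) *ᵣ den′ a  ≈⟨ *ᵣ-congʳ (den′ a) (≃-elim f) ⟩
  (num c *ᵣ den′ b) *ᵣ den′ a  ≈⟨ *-swapʳ (num c) (den′ b) (den′ a) ⟩
  (num c *ᵣ den′ a) *ᵣ den′ b  ∎)))
  where open ≋-Reasoning

-- The operations of Defs unfold to bare fractions, which defeats
-- unification; these opaque copies do not.
infixl 6 _⊕_
infixl 7 _⊗_
infix  8 ⊖_

opaque
  _⊕_ _⊗_ : 𝔽 → 𝔽 → 𝔽
  _⊕_ = _+F_
  _⊗_ = _*F_

  ⊖_ : 𝔽 → 𝔽
  ⊖_ = -F_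

opaque
  unfolding _⊕_ _⊗_ ⊖_

  +F≡⊕ : ∀ a b → a +F b ≡ a ⊕ b
  +F≡⊕ a b = refl

  *F≡⊗ : ∀ a b → a *F b ≡ a ⊗ b
  *F≡⊗ a b = refl

  -F≡⊖ : ∀ a → -F a ≡ ⊖ a
  -F≡⊖ a = refl

  ⊕-cong : ∀ {a a′ b b′} → a ≃ a′ → b ≃ b′ → a ⊕ b ≃ a′ ⊕ b′
  ⊕-cong {a} {a′} {b} {b′} e f =
    ≃-intro (den′ a *ᵣ den′ b) (den′ a′ *ᵣ den′ b′) (prodᵣ-++ (den a) (den b)) (prodᵣ-++ (den a′) (den b′)) (begin
      ((num a *ᵣ den′ b) +ᵣ (num b *ᵣ den′ a)) *ᵣ (den′ a′ *ᵣ den′ b′)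
        ≈⟨ sum-cross (num a) (den′ a) (num b) (den′ b) (den′ a′) (den′ b′) ⟩
      ((num a *ᵣ den′ a′) *ᵣ (den′ b *ᵣ den′ b′)) +ᵣ ((num b *ᵣ den′ b′) *ᵣ (den′ a *ᵣ den′ a′))
        ≈⟨ +ᵣ-cong (*ᵣ-cong (≃-elim e) (*ᵣ-comm (den′ b) (den′ b′))) (*ᵣ-cong (≃-elim f) (*ᵣ-comm (den′ a) (den′ a′))) ⟩
      ((num a′ *ᵣ den′ a) *ᵣ (den′ b′ *ᵣ den′ b)) +ᵣ ((num b′ *ᵣ den′ b) *ᵣ (den′ a′ *ᵣ den′ a))
        ≈⟨ sum-cross (num a′) (den′ a′) (num b′) (den′ b′) (den′ a) (den′ b) ⟨
      ((num a′ *ᵣ den′ b′) +ᵣ (num b′ *ᵣ den′ a′)) *ᵣ (den′ a *ᵣ den′ b)  ∎)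
    where open ≋-Reasoning

  ⊕-comm : ∀ a b → a ⊕ b ≃ b ⊕ a
  ⊕-comm a b = ≃-intro (den′ a *ᵣ den′ b) (den′ b *ᵣ den′ a) (prodᵣ-++ (den a) (den b)) (prodᵣ-++ (den b) (den a))
    (sum-comm (num a) (den′ a) (num b) (den′ b))

  ⊕-assoc : ∀ a b c → (a ⊕ b) ⊕ c ≃ a ⊕ (b ⊕ c)
  ⊕-assoc a b c = ≃-intro ((den′ a *ᵣ den′ b) *ᵣ den′ c) (den′ a *ᵣ (den′ b *ᵣ den′ c))
    (≋-trans (prodᵣ-++ (den a ++ den b) (den c)) (*ᵣ-congʳ (den′ c) ab))
    (≋-trans (prodᵣ-++ (den a) (den b ++ den c)) (*ᵣ-congˡ (den′ a) bc))
    (≋-trans (*ᵣ-congʳ (den′ a *ᵣ (den′ b *ᵣ den′ c)) (+ᵣ-congˡ (num (a +F b) *ᵣ den′ c) (*ᵣ-congˡ (num c) ab)))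
      (≋-trans (sum-assoc (num a) (den′ a) (num b) (den′ b) (num c) (den′ c))
        (*ᵣ-congʳ ((den′ a *ᵣ den′ b) *ᵣ den′ c) (+ᵣ-congʳ (num (b +F c) *ᵣ den′ a) (*ᵣ-congˡ (num a) (≋-sym bc))))))
    where
    ab : den′ (a +F b) ≋ den′ a *ᵣ den′ b
    ab = prodᵣ-++ (den a) (den b)
    bc : den′ (b +F c) ≋ den′ b *ᵣ den′ c
    bc = prodᵣ-++ (den b) (den c)

  ⊕-identityˡ : ∀ a → 0F ⊕ a ≃ a
  ⊕-identityˡ a = ≃-intro (den′ a) (den′ a) ≋-refl ≋-refl
    (*ᵣ-congʳ (den′ a) (≋-trans (*ᵣ-comm (num a) 1ᵣ) (*ᵣ-identityˡ (num a))))

  ⊖-inverseˡ : ∀ a → (⊖ a) ⊕ a ≃ 0F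
  ⊖-inverseˡ a = ≃-intro (den′ a *ᵣ den′ a) 1ᵣ (prodᵣ-++ (den a) (den a)) ≋-refl
    (*ᵣ-congʳ 1ᵣ (≋-trans (≋-sym (*ᵣ-distribʳ (den′ a) (-ᵣ num a) (num a))) (*ᵣ-congʳ (den′ a) (-ᵣ-inverseˡ (num a)))))

  ⊖-cong : ∀ {a b} → a ≃ b → ⊖ a ≃ ⊖ b
  ⊖-cong {a} {b} e = ≃-intro (den′ a) (den′ b) ≋-refl ≋-refl (begin
    (-ᵣ num a) *ᵣ den′ b   ≈⟨ Rₚ.-‿distribˡ-* (num a) (den′ b) ⟨
    -ᵣ (num a *ᵣ den′ b)   ≈⟨ -ᵣ-cong (≃-elim e) ⟩
    -ᵣ (num b *ᵣ den′ a)   ≈⟨ Rₚ.-‿distribˡ-* (num b) (den′ a) ⟩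
    (-ᵣ num b) *ᵣ den′ a   ∎)
    where open ≋-Reasoning

  ⊗-cong : ∀ {a a′ b b′} → a ≃ a′ → b ≃ b′ → a ⊗ b ≃ a′ ⊗ b′
  ⊗-cong {a} {a′} {b} {b′} e f =
    ≃-intro (den′ a *ᵣ den′ b) (den′ a′ *ᵣ den′ b′) (prodᵣ-++ (den a) (den b)) (prodᵣ-++ (den a′) (den b′)) (begin
      (num a *ᵣ num b) *ᵣ (den′ a′ *ᵣ den′ b′)      ≈⟨ *-interchange (num a) (num b) (den′ a′) (den′ b′) ⟩
      (num a *ᵣ den′ a′) *ᵣ (num b *ᵣ den′ b′)      ≈⟨ *ᵣ-cong (≃-elim e) (≃-elim f) ⟩
      (num a′ *ᵣ den′ a) *ᵣ (num b′ *ᵣ den′ b)      ≈⟨ *-interchange (num a′) (num b′) (den′ a) (den′ b) ⟨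
      (num a′ *ᵣ num b′) *ᵣ (den′ a *ᵣ den′ b)      ∎)
    where open ≋-Reasoning

  ⊗-comm : ∀ a b → a ⊗ b ≃ b ⊗ a
  ⊗-comm a b = ≃-intro (den′ a *ᵣ den′ b) (den′ b *ᵣ den′ a) (prodᵣ-++ (den a) (den b)) (prodᵣ-++ (den b) (den a))
    (product-comm (num a) (num b) (den′ a) (den′ b))

  ⊗-assoc : ∀ a b c → (a ⊗ b) ⊗ c ≃ a ⊗ (b ⊗ c)
  ⊗-assoc a b c = ≃-intro ((den′ a *ᵣ den′ b) *ᵣ den′ c) (den′ a *ᵣ (den′ b *ᵣ den′ c))
    (≋-trans (prodᵣ-++ (den a ++ den b) (den c)) (*ᵣ-congʳ (den′ c) (prodᵣ-++ (den a) (den b))))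
    (≋-trans (prodᵣ-++ (den a) (den b ++ den c)) (*ᵣ-congˡ (den′ a) (prodᵣ-++ (den b) (den c))))
    (product-assoc (num a) (num b) (num c) (den′ a) (den′ b) (den′ c))

  ⊗-identityˡ : ∀ a → 1F ⊗ a ≃ a
  ⊗-identityˡ a = ≃-intro (den′ a) (den′ a) ≋-refl ≋-refl (*ᵣ-congʳ (den′ a) (*ᵣ-identityˡ (num a)))

  ⊗-distribˡ : ∀ a b c → a ⊗ (b ⊕ c) ≃ (a ⊗ b) ⊕ (a ⊗ c)
  ⊗-distribˡ a b c = ≃-intro (den′ a *ᵣ (den′ b *ᵣ den′ c)) ((den′ a *ᵣ den′ b) *ᵣ (den′ a *ᵣ den′ c))
    (≋-trans (prodᵣ-++ (den a) (den b ++ den c)) (*ᵣ-congˡ (den′ a) (prodᵣ-++ (den b) (den c))))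
    (≋-trans (prodᵣ-++ (den a ++ den b) (den a ++ den c)) (*ᵣ-cong (prodᵣ-++ (den a) (den b)) (prodᵣ-++ (den a) (den c))))
    (≋-trans (product-distrib (num a) (den′ a) (num b) (den′ b) (num c) (den′ c))
      (*ᵣ-congʳ (den′ a *ᵣ (den′ b *ᵣ den′ c))
        (+ᵣ-cong (*ᵣ-congˡ (num a *ᵣ num b) (≋-sym (prodᵣ-++ (den a) (den c))))
                 (*ᵣ-congˡ (num a *ᵣ num c) (≋-sym (prodᵣ-++ (den a) (den b)))))))

  1≄0 : ¬ (1F ≃ 0F)
  1≄0 (mk≃ e) = 1≢0 (e 0)

  -- Decidability comes from ℚ through `zeroᵣ?`. It is what makes division available: a numerator
  -- may become a denominator only together with a witness that it is nonzero.
  zeroF? : ∀ a → (a ≃ 0F) ⊎ (∃ λ b → a ⊗ b ≃ 1F)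
  zeroF? a with zeroᵣ? (num a)
  ... | inj₁ e  = inj₁ (≃-intro (den′ a) 1ᵣ ≋-refl ≋-refl (*ᵣ-congʳ 1ᵣ e))
  ... | inj₂ nz = inj₂ ((den′ a ⁄ ((num a , nz) ∷ [])) ,
      ≃-intro (den′ a *ᵣ (num a *ᵣ 1ᵣ)) 1ᵣ (prodᵣ-++ (den a) _) ≋-refl (begin
        (num a *ᵣ den′ a) *ᵣ 1ᵣ          ≈⟨ *-swapʳ (num a) (den′ a) 1ᵣ ⟩
        (num a *ᵣ 1ᵣ) *ᵣ den′ a          ≈⟨ *ᵣ-comm (num a *ᵣ 1ᵣ) (den′ a) ⟩
        den′ a *ᵣ (num a *ᵣ 1ᵣ)          ≈⟨ *ᵣ-identityˡ (den′ a *ᵣ (num a *ᵣ 1ᵣ)) ⟨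
        1ᵣ *ᵣ (den′ a *ᵣ (num a *ᵣ 1ᵣ))  ∎))
    where open ≋-Reasoning

ℚ⟨r⟩ : CommutativeRing 0ℓ 0ℓ
ℚ⟨r⟩ = record
  { Carrier = 𝔽 ; _≈_ = _≃_ ; _+_ = _⊕_ ; _*_ = _⊗_ ; -_ = ⊖_ ; 0# = 0F ; 1# = 1F
  ; isCommutativeRing = record
    { isRing = record
      { +-isAbelianGroup = record
        { isGroup = record
          { isMonoid = record
            { isSemigroup = record
              { isMagma = record
                { isEquivalence = record { refl = ≃-refl ; sym = ≃-sym ; trans = ≃-trans }
                ; ∙-cong = ⊕-cong }
              ; assoc = ⊕-assoc }
            ; identity = ⊕-identityˡ , λ a → ≃-trans (⊕-comm a 0F) (⊕-identityˡ a) }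
          ; inverse = ⊖-inverseˡ , λ a → ≃-trans (⊕-comm a (⊖ a)) (⊖-inverseˡ a)
          ; ⁻¹-cong = ⊖-cong }
        ; comm = ⊕-comm }
      ; *-cong = ⊗-cong
      ; *-assoc = ⊗-assoc
      ; *-identity = ⊗-identityˡ , λ a → ≃-trans (⊗-comm a 1F) (⊗-identityˡ a)
      ; distrib = ⊗-distribˡ , λ a b c → ≃-trans (⊗-comm (b ⊕ c) a)
          (≃-trans (⊗-distribˡ a b c) (⊕-cong (⊗-comm a b) (⊗-comm a c))) }
    ; *-comm = ⊗-comm } }

-- Linear functionals on polynomials

module K  = CommutativeRing ℚ⟨r⟩
module Kₚ = RingProperties (CommutativeRing.ring ℚ⟨r⟩)
module ≃-Reasoning = SetoidReasoning (CommutativeRing.setoid ℚ⟨r⟩)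
module S = SemiringSolver (CommutativeRing.commutativeSemiring ℚ⟨r⟩)

_≟ᶜ_ : ∀ {n} (κ θ : Comp n) → Dec (κ ≡ θ)
_≟ᶜ_ = Vecₚ.≡-dec ℕ._≟_

-- The linear functional sending x^κ to φ κ. Coefficients are the case φ = `δ θ`, values the case φ
-- = `monomial v`.
pair : ∀ {n} → (Comp n → 𝔽) → Poly n → 𝔽
pair φ []            = 0F
pair φ ((c , κ) ∷ p) = c ⊗ φ κ ⊕ pair φ p

pow : 𝔽 → ℕ → 𝔽
pow x zero    = 1F
pow x (suc k) = x ⊗ pow x k

monomial : ∀ {n} → Vec 𝔽 n → Comp n → 𝔽
monomial []      []      = 1F
monomial (x ∷ v) (k ∷ κ) = pow x k ⊗ monomial v κ

δ : ∀ {n} → Comp n → Comp n → 𝔽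
δ θ κ with κ ≟ᶜ θ
... | yes _ = 1F
... | no  _ = 0F

δ-≡ : ∀ {n} {θ κ : Comp n} → κ ≡ θ → δ θ κ ≡ 1F
δ-≡ {θ = θ} {κ} e with κ ≟ᶜ θ
... | yes _ = refl
... | no ¬e = ⊥-elim (¬e e)

δ-≢ : ∀ {n} {θ κ : Comp n} → κ ≢ θ → δ θ κ ≡ 0F
δ-≢ {θ = θ} {κ} ¬e with κ ≟ᶜ θ
... | yes e = ⊥-elim (¬e e)
... | no _  = refl

eval : ∀ {n} → Poly n → Vec 𝔽 n → 𝔽
eval p v = pair (monomial v) p

^F≡pow : ∀ x k → x ^F k ≡ pow x k
^F≡pow x zero    = refl
^F≡pow x (suc k) = trans (*F≡⊗ x (x ^F k)) (cong (x ⊗_) (^F≡pow x k))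

prodF≡monomial : ∀ {n} (v : Vec 𝔽 n) κ → prodF (Vec.toList (zipWith _^F_ v κ)) ≡ monomial v κ
prodF≡monomial []      []      = refl
prodF≡monomial (x ∷ v) (k ∷ κ) =
  trans (*F≡⊗ (x ^F k) _) (cong₂ _⊗_ (^F≡pow x k) (prodF≡monomial v κ))

evalP≡eval : ∀ {n} (p : Poly n) v → evalP p v ≡ eval p v
evalP≡eval []            v = refl
evalP≡eval ((c , κ) ∷ p) v =
  trans (+F≡⊕ (c *F prodF (Vec.toList (zipWith _^F_ v κ))) (evalP p v)) (cong₂ _⊕_
    (trans (*F≡⊗ c _) (cong (c ⊗_) (prodF≡monomial v κ)))
    (evalP≡eval p v))

1⊗⊕ : ∀ c x → c ⊕ x ≃ c ⊗ 1F ⊕ x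
1⊗⊕ c x = K.+-congʳ (K.sym (K.*-identityʳ c))

⊗0⊕ : ∀ c x → c ⊗ 0F ⊕ x ≃ x
⊗0⊕ c x = K.trans (K.+-congʳ (K.zeroʳ c)) (K.+-identityˡ x)

coeff≃pair : ∀ {n} (p : Poly n) θ → coeff p θ ≃ pair (δ θ) p
coeff≃pair []            θ = K.refl
coeff≃pair ((c , κ) ∷ p) θ with κ ≟ᶜ θ
... | no  _ = K.trans (coeff≃pair p θ) (K.sym (⊗0⊕ c (pair (δ θ) p)))
... | yes _ = K.trans (K.reflexive (+F≡⊕ c (coeff p θ)))
                (K.trans (K.+-congˡ (coeff≃pair p θ)) (1⊗⊕ c (pair (δ θ) p)))

pair-++ : ∀ {n} φ (p q : Poly n) → pair φ (p ++ q) ≃ pair φ p ⊕ pair φ q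
pair-++ φ []            q = K.sym (K.+-identityˡ _)
pair-++ φ ((c , κ) ∷ p) q = K.trans (K.+-congˡ (pair-++ φ p q)) (K.sym (K.+-assoc _ _ _))

pair-scale : ∀ {n} φ c (p : Poly n) → pair φ (scale c p) ≃ c ⊗ pair φ p
pair-scale φ c []            = K.sym (K.zeroʳ c)
pair-scale φ c ((a , κ) ∷ p) = begin
  (c *F a) ⊗ φ κ ⊕ pair φ (scale c p)  ≡⟨ cong (λ x → x ⊗ φ κ ⊕ pair φ (scale c p)) (*F≡⊗ c a) ⟩
  (c ⊗ a) ⊗ φ κ ⊕ pair φ (scale c p)   ≈⟨ K.+-cong (K.*-assoc c a (φ κ)) (pair-scale φ c p) ⟩
  c ⊗ (a ⊗ φ κ) ⊕ c ⊗ pair φ p         ≈⟨ K.distribˡ c _ _ ⟨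
  c ⊗ (a ⊗ φ κ ⊕ pair φ p)             ∎
  where open ≃-Reasoning

pair-cong : ∀ {n} {φ ψ : Comp n → 𝔽} (p : Poly n) → (∀ κ → φ κ ≃ ψ κ) → pair φ p ≃ pair ψ p
pair-cong []            e = K.refl
pair-cong ((c , κ) ∷ p) e = K.+-cong (K.*-congˡ (e κ)) (pair-cong p e)

pair-⊗ : ∀ {n} a (φ : Comp n → 𝔽) (p : Poly n) → pair (λ κ → a ⊗ φ κ) p ≃ a ⊗ pair φ p
pair-⊗ a φ []            = K.sym (K.zeroʳ a)
pair-⊗ a φ ((c , κ) ∷ p) = begin
  c ⊗ (a ⊗ φ κ) ⊕ pair (λ κ → a ⊗ φ κ) p   ≈⟨ K.+-congˡ (pair-⊗ a φ p) ⟩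
  c ⊗ (a ⊗ φ κ) ⊕ a ⊗ pair φ p             ≈⟨ S.solve 4 (λ c a f x → c S.:* (a S.:* f) S.:+ a S.:* x S.:= a S.:* (c S.:* f S.:+ x)) K.refl c a (φ κ) (pair φ p) ⟩
  a ⊗ (c ⊗ φ κ ⊕ pair φ p)                 ∎
  where open ≃-Reasoning

pair-⊕ : ∀ {n} (φ ψ : Comp n → 𝔽) (p : Poly n) → pair (λ κ → φ κ ⊕ ψ κ) p ≃ pair φ p ⊕ pair ψ p
pair-⊕ φ ψ []            = K.sym (K.+-identityˡ 0F)
pair-⊕ φ ψ ((c , κ) ∷ p) = begin
  c ⊗ (φ κ ⊕ ψ κ) ⊕ pair (λ κ → φ κ ⊕ ψ κ) p       ≈⟨ K.+-congˡ (pair-⊕ φ ψ p) ⟩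
  c ⊗ (φ κ ⊕ ψ κ) ⊕ (pair φ p ⊕ pair ψ p)          ≈⟨ S.solve 5 (λ c f g x y → c S.:* (f S.:+ g) S.:+ (x S.:+ y) S.:= (c S.:* f S.:+ x) S.:+ (c S.:* g S.:+ y)) K.refl c (φ κ) (ψ κ) (pair φ p) (pair ψ p) ⟩
  (c ⊗ φ κ ⊕ pair φ p) ⊕ (c ⊗ ψ κ ⊕ pair ψ p)      ∎
  where open ≃-Reasoning

-- For an operator defined term by term, ψ is the image of φ under the transposed operator. It
-- suffices to find it on a single term.
pair-concatMap : ∀ {n m} (φ : Comp m → 𝔽) (ψ : Comp n → 𝔽) (T : 𝔽 × Comp n → Poly m) →
  (∀ c κ → pair φ (T (c , κ)) ≃ c ⊗ ψ κ) → ∀ p → pair φ (List.concatMap T p) ≃ pair ψ p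
pair-concatMap φ ψ T e []            = K.refl
pair-concatMap φ ψ T e ((c , κ) ∷ p) =
  K.trans (pair-++ φ (T (c , κ)) (List.concatMap T p)) (K.+-cong (e c κ) (pair-concatMap φ ψ T e p))

-- All terms with exponent θ go at once, so that what they contribute to a functional is governed by
-- the single number `coeff p θ` even when θ is repeated.
remove : ∀ {n} → Comp n → Poly n → Poly n
remove θ []            = []
remove θ ((c , κ) ∷ p) with κ ≟ᶜ θ
... | yes _ = remove θ p
... | no  _ = (c , κ) ∷ remove θ p

pair-remove : ∀ {n} (φ : Comp n → 𝔽) θ p → pair φ p ≃ coeff p θ ⊗ φ θ ⊕ pair φ (remove θ p)
pair-remove φ θ []            = K.sym (K.trans (K.+-identityʳ _) (K.zeroˡ (φ θ)))
pair-remove φ θ ((c , κ) ∷ p) with κ ≟ᶜ θ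
... | yes refl = begin
  c ⊗ φ κ ⊕ pair φ p                                       ≈⟨ K.+-congˡ (pair-remove φ θ p) ⟩
  c ⊗ φ κ ⊕ (coeff p θ ⊗ φ κ ⊕ pair φ (remove κ p))        ≈⟨ S.solve 4 (λ c d f x → c S.:* f S.:+ (d S.:* f S.:+ x) S.:= (c S.:+ d) S.:* f S.:+ x) K.refl c (coeff p κ) (φ κ) (pair φ (remove κ p)) ⟩
  (c ⊕ coeff p θ) ⊗ φ κ ⊕ pair φ (remove κ p)              ≡⟨ cong (λ x → x ⊗ φ κ ⊕ pair φ (remove κ p)) (+F≡⊕ c (coeff p κ)) ⟨
  (c +F coeff p θ) ⊗ φ κ ⊕ pair φ (remove κ p)             ∎
  where open ≃-Reasoning
... | no _ = begin
  c ⊗ φ κ ⊕ pair φ p                                       ≈⟨ K.+-congˡ (pair-remove φ θ p) ⟩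
  c ⊗ φ κ ⊕ (coeff p θ ⊗ φ θ ⊕ pair φ (remove θ p))        ≈⟨ S.solve 3 (λ a b x → a S.:+ (b S.:+ x) S.:= b S.:+ (a S.:+ x)) K.refl (c ⊗ φ κ) (coeff p θ ⊗ φ θ) (pair φ (remove θ p)) ⟩
  coeff p θ ⊗ φ θ ⊕ (c ⊗ φ κ ⊕ pair φ (remove θ p))        ∎
  where open ≃-Reasoning

coeff-remove-self : ∀ {n} (θ : Comp n) p → coeff (remove θ p) θ ≡ 0F
coeff-remove-self θ []            = refl
coeff-remove-self θ ((c , κ) ∷ p) with κ ≟ᶜ θ
... | yes _ = coeff-remove-self θ p
... | no κ≢θ with κ ≟ᶜ θ
...   | yes κ≡θ = ⊥-elim (κ≢θ κ≡θ)
...   | no _    = coeff-remove-self θ p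

coeff-remove-other : ∀ {n} {θ κ : Comp n} p → κ ≢ θ → coeff (remove θ p) κ ≡ coeff p κ
coeff-remove-other []                    κ≢θ = refl
coeff-remove-other {θ = θ} {κ} ((c , μ) ∷ p) κ≢θ with μ ≟ᶜ θ
... | yes refl with μ ≟ᶜ κ
...   | yes μ≡κ = ⊥-elim (κ≢θ (sym μ≡κ))
...   | no  _   = coeff-remove-other p κ≢θ
coeff-remove-other {θ = θ} {κ} ((c , μ) ∷ p) κ≢θ | no _ with μ ≟ᶜ κ
...   | yes _ = cong (c +F_) (coeff-remove-other p κ≢θ)
...   | no  _ = coeff-remove-other p κ≢θ

length-remove : ∀ {n} (θ : Comp n) p → List.length (remove θ p) ≤ List.length p
length-remove θ []            = z≤n
length-remove θ ((c , κ) ∷ p) with κ ≟ᶜ θ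
... | yes _ = ℕₚ.m≤n⇒m≤1+n (length-remove θ p)
... | no  _ = s≤s (length-remove θ p)

length-remove-head : ∀ {n} c (θ : Comp n) p → List.length (remove θ ((c , θ) ∷ p)) ≤ List.length p
length-remove-head c θ p with θ ≟ᶜ θ
... | yes _  = length-remove θ p
... | no θ≢θ = ⊥-elim (θ≢θ refl)

-- Linear functionals only see coefficients, and only where they do not vanish.
pair-ext : ∀ {n} {φ ψ : Comp n → 𝔽} (p q : Poly n) →
  (∀ κ → coeff p κ ⊗ φ κ ≃ coeff q κ ⊗ ψ κ) → pair φ p ≃ pair ψ q
pair-ext {n} {φ} {ψ} p q = go (List.length p ℕ.+ List.length q) p q ℕₚ.≤-refl
  where
  step : ∀ θ p q → (∀ κ → coeff p κ ⊗ φ κ ≃ coeff q κ ⊗ ψ κ) →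
    ((∀ κ → coeff (remove θ p) κ ⊗ φ κ ≃ coeff (remove θ q) κ ⊗ ψ κ) → pair φ (remove θ p) ≃ pair ψ (remove θ q)) →
    pair φ p ≃ pair ψ q
  step θ p q e rec = begin
    pair φ p                                   ≈⟨ pair-remove φ θ p ⟩
    coeff p θ ⊗ φ θ ⊕ pair φ (remove θ p)      ≈⟨ K.+-cong (e θ) (rec e′) ⟩
    coeff q θ ⊗ ψ θ ⊕ pair ψ (remove θ q)      ≈⟨ pair-remove ψ θ q ⟨
    pair ψ q                                   ∎
    where
    open ≃-Reasoning
    e′ : ∀ κ → coeff (remove θ p) κ ⊗ φ κ ≃ coeff (remove θ q) κ ⊗ ψ κ
    e′ κ with κ ≟ᶜ θ
    ... | yes refl rewrite coeff-remove-self θ p | coeff-remove-self θ q =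
      K.trans (K.zeroˡ (φ θ)) (K.sym (K.zeroˡ (ψ θ)))
    ... | no κ≢θ rewrite coeff-remove-other p κ≢θ | coeff-remove-other q κ≢θ = e κ
  -- `remove θ p` is not a structural part of `p`. The recursion is on a bound `N` for the combined
  -- length, which drops because θ is always the exponent of a head term.
  go : ∀ N p q → List.length p ℕ.+ List.length q ≤ N →
    (∀ κ → coeff p κ ⊗ φ κ ≃ coeff q κ ⊗ ψ κ) → pair φ p ≃ pair ψ q
  go N       []            []            len       e = K.refl
  go (suc N) ((c , θ) ∷ p) q             (s≤s len) e = step θ ((c , θ) ∷ p) q e
    (go N (remove θ ((c , θ) ∷ p)) (remove θ q)
      (ℕₚ.≤-trans (ℕₚ.+-mono-≤ (length-remove-head c θ p) (length-remove θ q)) len))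
  go (suc N) []            ((c , θ) ∷ q) (s≤s len) e = step θ [] ((c , θ) ∷ q) e
    (go N [] (remove θ ((c , θ) ∷ q)) (ℕₚ.≤-trans (length-remove-head c θ q) len))

infix 4 _≃ₚ_
_≃ₚ_ : ∀ {n} → Poly n → Poly n → Set
p ≃ₚ q = ∀ κ → coeff p κ ≃ coeff q κ

pair-resp : ∀ {n} (φ : Comp n → 𝔽) (p q : Poly n) → p ≃ₚ q → pair φ p ≃ pair φ q
pair-resp φ p q e = pair-ext p q λ κ → K.*-congʳ (e κ)

coeff-++ : ∀ {n} (p q : Poly n) κ → coeff (p ++ q) κ ≃ coeff p κ ⊕ coeff q κ
coeff-++ p q κ = begin
  coeff (p ++ q) κ                 ≈⟨ coeff≃pair (p ++ q) κ ⟩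
  pair (δ κ) (p ++ q)              ≈⟨ pair-++ (δ κ) p q ⟩
  pair (δ κ) p ⊕ pair (δ κ) q      ≈⟨ K.+-cong (coeff≃pair p κ) (coeff≃pair q κ) ⟨
  coeff p κ ⊕ coeff q κ            ∎
  where open ≃-Reasoning

coeff-scale : ∀ {n} c (p : Poly n) κ → coeff (scale c p) κ ≃ c ⊗ coeff p κ
coeff-scale c p κ = begin
  coeff (scale c p) κ       ≈⟨ coeff≃pair (scale c p) κ ⟩
  pair (δ κ) (scale c p)    ≈⟨ pair-scale (δ κ) c p ⟩
  c ⊗ pair (δ κ) p          ≈⟨ K.*-congˡ (coeff≃pair p κ) ⟨
  c ⊗ coeff p κ             ∎
  where open ≃-Reasoning

coeff-mono : ∀ {n} (η κ : Comp n) → coeff (mono η) κ ≃ δ κ η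
coeff-mono η κ = K.trans (coeff≃pair (mono η) κ) (K.trans (K.+-identityʳ _) (K.*-identityˡ _))

pair-mono : ∀ {n} φ (η : Comp n) → pair φ (mono η) ≃ φ η
pair-mono φ η = K.trans (K.+-identityʳ _) (K.*-identityˡ (φ η))

-- Evaluation of the operators

⊗-zero-cancel : ∀ {a b} → ¬ (b ≃ 0F) → a ⊗ b ≃ 0F → a ≃ 0F
⊗-zero-cancel {a} {b} b≄0 e with zeroF? b
... | inj₁ b≃0        = ⊥-elim (b≄0 b≃0)
... | inj₂ (b⁻¹ , inv) = begin
  a                ≈⟨ K.*-identityʳ a ⟨
  a ⊗ 1F           ≈⟨ K.*-congˡ inv ⟨
  a ⊗ (b ⊗ b⁻¹)    ≈⟨ K.*-assoc a b b⁻¹ ⟨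
  (a ⊗ b) ⊗ b⁻¹    ≈⟨ K.*-congʳ e ⟩
  0F ⊗ b⁻¹         ≈⟨ K.zeroˡ b⁻¹ ⟩
  0F               ∎
  where open ≃-Reasoning

-- Stands in for division by x - y: it turns distinct coordinates into the vanishing of a divided
-- difference or of a quotient.
≄-⊗-zero : ∀ {x y d} → ¬ (x ≃ y) → x ⊗ d ≃ y ⊗ d → d ≃ 0F
≄-⊗-zero {x} {y} {d} x≄y e with zeroF? d
... | inj₁ d≃0         = d≃0
... | inj₂ (d⁻¹ , inv) = ⊥-elim (x≄y (begin
  x                ≈⟨ K.*-identityʳ x ⟨
  x ⊗ 1F           ≈⟨ K.*-congˡ inv ⟨
  x ⊗ (d ⊗ d⁻¹)    ≈⟨ K.*-assoc x d d⁻¹ ⟨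
  (x ⊗ d) ⊗ d⁻¹    ≈⟨ K.*-congʳ e ⟩
  (y ⊗ d) ⊗ d⁻¹    ≈⟨ K.*-assoc y d d⁻¹ ⟩
  y ⊗ (d ⊗ d⁻¹)    ≈⟨ K.*-congˡ inv ⟩
  y ⊗ 1F           ≈⟨ K.*-identityʳ y ⟩
  y                ∎))
  where open ≃-Reasoning

pow-cong : ∀ {x y} k → x ≃ y → pow x k ≃ pow y k
pow-cong zero    e = K.refl
pow-cong (suc k) e = K.*-cong e (pow-cong k e)

pow-+ : ∀ x a b → pow x (a ℕ.+ b) ≃ pow x a ⊗ pow x b
pow-+ x zero    b = K.sym (K.*-identityˡ _)
pow-+ x (suc a) b = K.trans (K.*-congˡ (pow-+ x a b)) (K.sym (K.*-assoc x _ _))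

⊗-interchange : ∀ a b c d → (a ⊗ b) ⊗ (c ⊗ d) ≃ (a ⊗ c) ⊗ (b ⊗ d)
⊗-interchange = S.solve 4 (λ a b c d → (a S.:* b) S.:* (c S.:* d) S.:= (a S.:* c) S.:* (b S.:* d)) K.refl

infixl 6 _+ᶜ_
_+ᶜ_ : ∀ {n} → Comp n → Comp n → Comp n
_+ᶜ_ = zipWith ℕ._+_

monomial-+ : ∀ {n} (v : Vec 𝔽 n) κ μ → monomial v (κ +ᶜ μ) ≃ monomial v κ ⊗ monomial v μ
monomial-+ []      []      []      = K.sym (K.*-identityˡ 1F)
monomial-+ (x ∷ v) (k ∷ κ) (l ∷ μ) =
  K.trans (K.*-cong (pow-+ x k l) (monomial-+ v κ μ)) (⊗-interchange (pow x k) (pow x l) _ _)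

pair-*ₚ-term : ∀ {n} (φ : Comp n → 𝔽) c κ q →
  pair φ (List.map (λ u → (c *F proj₁ u) , κ +ᶜ proj₂ u) q) ≃ c ⊗ pair (λ μ → φ (κ +ᶜ μ)) q
pair-*ₚ-term φ c κ []            = K.sym (K.zeroʳ c)
pair-*ₚ-term φ c κ ((a , μ) ∷ q) = begin
  (c *F a) ⊗ φ (κ +ᶜ μ) ⊕ pair φ q′                ≡⟨ cong (λ x → x ⊗ φ (κ +ᶜ μ) ⊕ pair φ q′) (*F≡⊗ c a) ⟩
  (c ⊗ a) ⊗ φ (κ +ᶜ μ) ⊕ pair φ q′                 ≈⟨ K.+-cong (K.*-assoc c a _) (pair-*ₚ-term φ c κ q) ⟩
  c ⊗ (a ⊗ φ (κ +ᶜ μ)) ⊕ c ⊗ pair (λ μ → φ (κ +ᶜ μ)) q  ≈⟨ K.distribˡ c _ _ ⟨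
  c ⊗ (a ⊗ φ (κ +ᶜ μ) ⊕ pair (λ μ → φ (κ +ᶜ μ)) q)      ∎
  where
  open ≃-Reasoning
  q′ = List.map (λ u → (c *F proj₁ u) , κ +ᶜ proj₂ u) q

pair-*ₚ : ∀ {n} (φ : Comp n → 𝔽) p q → pair φ (p *ₚ q) ≃ pair (λ κ → pair (λ μ → φ (κ +ᶜ μ)) q) p
pair-*ₚ φ p q = pair-concatMap φ (λ κ → pair (λ μ → φ (κ +ᶜ μ)) q) _ (λ c κ → pair-*ₚ-term φ c κ q) p

eval-*ₚ : ∀ {n} (p q : Poly n) v → eval (p *ₚ q) v ≃ eval p v ⊗ eval q v
eval-*ₚ p q v = begin
  eval (p *ₚ q) v                                          ≈⟨ pair-*ₚ (monomial v) p q ⟩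
  pair (λ κ → pair (λ μ → monomial v (κ +ᶜ μ)) q) p        ≈⟨ pair-cong p (λ κ → K.trans (pair-cong q (monomial-+ v κ)) (K.trans (pair-⊗ (monomial v κ) (monomial v) q) (K.*-comm _ _))) ⟩
  pair (λ κ → eval q v ⊗ monomial v κ) p                   ≈⟨ pair-⊗ (eval q v) (monomial v) p ⟩
  eval q v ⊗ eval p v                                      ≈⟨ K.*-comm _ _ ⟩
  eval p v ⊗ eval q v                                      ∎
  where open ≃-Reasoning

monomial-0 : ∀ {n} (v : Vec 𝔽 n) → monomial v (replicate n 0) ≃ 1F
monomial-0 []      = K.refl
monomial-0 (x ∷ v) = K.trans (K.*-identityˡ _) (monomial-0 v)

monomial-unit : ∀ {n} (v : Vec 𝔽 n) i → monomial v (replicate n 0 Vec.[ i ]≔ 1) ≃ lookup v i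
monomial-unit (x ∷ v) Fin.zero    = K.trans (K.*-cong (K.*-identityʳ x) (monomial-0 v)) (K.*-identityʳ x)
monomial-unit (x ∷ v) (Fin.suc i) = K.trans (K.*-identityˡ _) (monomial-unit v i)

eval-var : ∀ {n} (i : Fin n) v → eval (var i) v ≃ lookup v i
eval-var i v = K.trans (pair-mono (monomial v) _) (monomial-unit v i)

eval-constP : ∀ {n} c (v : Vec 𝔽 n) → eval (constP c) v ≃ c
eval-constP c v = K.trans (K.+-identityʳ _) (K.trans (K.*-congˡ (monomial-0 v)) (K.*-identityʳ c))

eval-^ₚ : ∀ {n} (p : Poly n) k v → eval (p ^ₚ k) v ≃ pow (eval p v) k
eval-^ₚ p zero    v = eval-constP 1F v
eval-^ₚ p (suc k) v = K.trans (eval-*ₚ p (p ^ₚ k) v) (K.*-congˡ (eval-^ₚ p k v))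

eval-var+const : ∀ {n} (i : Fin n) c v → eval (var i +ₚ constP c) v ≃ lookup v i ⊕ c
eval-var+const i c v = K.trans (pair-++ (monomial v) (var i) (constP c)) (K.+-cong (eval-var i v) (eval-constP c v))

-- Repeats the local function `term` of `Φ⁺` with the scalar stripped off, so that lemmas can name
-- it.
Φ⁺mono : ∀ {m} → Comp (suc m) → Poly (suc m)
Φ⁺mono {m} (a ∷ η) = var (fromℕ m) *ₚ (((var (fromℕ m) +ₚ constP 1F) ^ₚ a) *ₚ mono (η ∷ʳ 0))

pair-Φ⁺ : ∀ {m} (φ : Comp (suc m) → 𝔽) p → pair φ (Φ⁺ p) ≃ pair (λ κ → pair φ (Φ⁺mono κ)) p
pair-Φ⁺ φ []                  = K.refl
pair-Φ⁺ φ ((c , (a ∷ η)) ∷ p) =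
  K.trans (pair-++ φ (scale c (Φ⁺mono (a ∷ η))) (Φ⁺ p))
    (K.+-cong (pair-scale φ c (Φ⁺mono (a ∷ η))) (pair-Φ⁺ φ p))

lookup-∷ʳ-last : ∀ {A : Set} {m} (v : Vec A m) z → lookup (v ∷ʳ z) (fromℕ m) ≡ z
lookup-∷ʳ-last []      z = refl
lookup-∷ʳ-last (x ∷ v) z = lookup-∷ʳ-last v z

monomial-∷ʳ : ∀ {m} (v : Vec 𝔽 m) z κ k → monomial (v ∷ʳ z) (κ ∷ʳ k) ≃ pow z k ⊗ monomial v κ
monomial-∷ʳ []      z []      k = K.refl
monomial-∷ʳ (x ∷ v) z (l ∷ κ) k = K.trans (K.*-congˡ (monomial-∷ʳ v z κ k))
  (S.solve 3 (λ a b c → a S.:* (b S.:* c) S.:= b S.:* (a S.:* c)) K.refl _ _ _)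

eval-Φ⁺mono : ∀ {m} (v : Vec 𝔽 m) z κ → eval (Φ⁺mono κ) (v ∷ʳ z) ≃ z ⊗ monomial ((z ⊕ 1F) ∷ v) κ
eval-Φ⁺mono {m} v z (a ∷ η) = begin
  eval (xₙ *ₚ (((xₙ +ₚ constP 1F) ^ₚ a) *ₚ mono (η ∷ʳ 0))) w
    ≈⟨ K.trans (eval-*ₚ xₙ (((xₙ +ₚ constP 1F) ^ₚ a) *ₚ mono (η ∷ʳ 0)) w) (K.*-cong wₙ (eval-*ₚ ((xₙ +ₚ constP 1F) ^ₚ a) (mono (η ∷ʳ 0)) w)) ⟩
  z ⊗ (eval ((xₙ +ₚ constP 1F) ^ₚ a) w ⊗ eval (mono (η ∷ʳ 0)) w)
    ≈⟨ K.*-congˡ (K.*-cong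
         (K.trans (eval-^ₚ (xₙ +ₚ constP 1F) a w)
           (pow-cong a (K.trans (eval-var+const (fromℕ m) 1F w) (K.+-congʳ (K.reflexive (lookup-∷ʳ-last v z))))))
         (K.trans (pair-mono (monomial w) (η ∷ʳ 0)) (K.trans (monomial-∷ʳ v z η 0) (K.*-identityˡ _)))) ⟩
  z ⊗ (pow (z ⊕ 1F) a ⊗ monomial v η)  ∎
  where
  open ≃-Reasoning
  w : Vec 𝔽 (suc m)
  w = v ∷ʳ z
  xₙ : Poly (suc m)
  xₙ = var (fromℕ m)
  wₙ : eval xₙ w ≃ z
  wₙ = K.trans (eval-var (fromℕ m) w) (K.reflexive (lookup-∷ʳ-last v z))

eval-Φ⁺ : ∀ {m} (p : Poly (suc m)) v z → eval (Φ⁺ p) (v ∷ʳ z) ≃ z ⊗ eval p ((z ⊕ 1F) ∷ v)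
eval-Φ⁺ p v z = K.trans (pair-Φ⁺ (monomial (v ∷ʳ z)) p)
  (K.trans (pair-cong p (eval-Φ⁺mono v z)) (pair-⊗ z _ p))

swapV : ∀ {A : Set} {m} → Fin m → Vec A (suc m) → Vec A (suc m)
swapV i v = (v Vec.[ inject₁ i ]≔ lookup v (Fin.suc i)) Vec.[ Fin.suc i ]≔ lookup v (inject₁ i)

otherFactors : ∀ {m} → Fin m → Vec 𝔽 (suc m) → Comp (suc m) → 𝔽
otherFactors Fin.zero    (x ∷ y ∷ v) (a ∷ b ∷ κ) = monomial v κ
otherFactors (Fin.suc i) (x ∷ v)     (a ∷ κ)     = pow x a ⊗ otherFactors i v κ

⊗-pull : ∀ a b c → a ⊗ (b ⊗ c) ≃ b ⊗ (a ⊗ c)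
⊗-pull = S.solve 3 (λ a b c → a S.:* (b S.:* c) S.:= b S.:* (a S.:* c)) K.refl

monomial-setAB : ∀ {m} (i : Fin m) v κ a b →
  monomial v (setAB i κ a b) ≃ (pow (lookup v (inject₁ i)) a ⊗ pow (lookup v (Fin.suc i)) b) ⊗ otherFactors i v κ
monomial-setAB Fin.zero    (x ∷ y ∷ v) (k ∷ l ∷ κ) a b = K.sym (K.*-assoc _ _ _)
monomial-setAB (Fin.suc i) (x ∷ v)     (k ∷ κ)     a b =
  K.trans (K.*-congˡ (monomial-setAB i v κ a b)) (⊗-pull _ _ _)

setAB-self : ∀ {m} (i : Fin m) κ → setAB i κ (lookup κ (inject₁ i)) (lookup κ (Fin.suc i)) ≡ κ
setAB-self Fin.zero    (k ∷ l ∷ κ) = refl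
setAB-self (Fin.suc i) (k ∷ κ)     = cong (k ∷_) (setAB-self i κ)

monomial-split : ∀ {m} (i : Fin m) v κ → monomial v κ ≃
  (pow (lookup v (inject₁ i)) (lookup κ (inject₁ i)) ⊗ pow (lookup v (Fin.suc i)) (lookup κ (Fin.suc i))) ⊗ otherFactors i v κ
monomial-split i v κ = K.trans (K.reflexive (cong (monomial v) (sym (setAB-self i κ)))) (monomial-setAB i v κ _ _)

monomial-swap : ∀ {m} (i : Fin m) v κ → monomial v (swapC i κ) ≃ monomial (swapV i v) κ
monomial-swap Fin.zero    (x ∷ y ∷ v) (a ∷ b ∷ κ) = ⊗-pull _ _ _
monomial-swap (Fin.suc i) (x ∷ v)     (a ∷ κ)     = K.*-congˡ (monomial-swap i v κ)

pair-sP : ∀ {m} (i : Fin m) φ p → pair φ (sP i p) ≡ pair (φ ∘ swapC i) p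
pair-sP i φ []            = refl
pair-sP i φ ((c , κ) ∷ p) = cong (c ⊗ φ (swapC i κ) ⊕_) (pair-sP i φ p)

eval-sP : ∀ {m} (i : Fin m) p v → eval (sP i p) v ≃ eval p (swapV i v)
eval-sP i p v = K.trans (K.reflexive (pair-sP i (monomial v) p)) (pair-cong p (monomial-swap i v))

-- Divided differences and geometric sums

sumTo : (ℕ → 𝔽) → ℕ → 𝔽
sumTo f zero    = 0F
sumTo f (suc n) = f 0 ⊕ sumTo (f ∘ suc) n

sumTo-cong : ∀ {f g} n → (∀ k → k < n → f k ≃ g k) → sumTo f n ≃ sumTo g n
sumTo-cong zero    e = K.refl
sumTo-cong (suc n) e = K.+-cong (e 0 (s≤s z≤n)) (sumTo-cong n λ k k<n → e (suc k) (s≤s k<n))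

sumTo-⊗ : ∀ x f n → sumTo (λ k → x ⊗ f k) n ≃ x ⊗ sumTo f n
sumTo-⊗ x f zero    = K.sym (K.zeroʳ x)
sumTo-⊗ x f (suc n) = K.trans (K.+-congˡ (sumTo-⊗ x (f ∘ suc) n)) (K.sym (K.distribˡ x _ _))

sumTo-0 : ∀ n → sumTo (λ _ → 0F) n ≃ 0F
sumTo-0 zero    = K.refl
sumTo-0 (suc n) = K.trans (K.+-identityˡ _) (sumTo-0 n)

pair-applyUpTo : ∀ {n} (φ : Comp n → 𝔽) c (h : ℕ → Comp n) (f : ℕ → ℕ) t →
  pair φ (List.map (λ k → c , h k) (List.applyUpTo f t)) ≃ c ⊗ sumTo (λ k → φ (h (f k))) t
pair-applyUpTo φ c h f zero    = K.sym (K.zeroʳ c)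
pair-applyUpTo φ c h f (suc t) =
  K.trans (K.+-congˡ (pair-applyUpTo φ c h (f ∘ suc) t)) (K.sym (K.distribˡ c _ _))

-- The complete homogeneous polynomial of degree t in two variables.
geometric : 𝔽 → 𝔽 → ℕ → 𝔽
geometric x y t = sumTo (λ k → pow x k ⊗ pow y (t ∸ k)) (suc t)

geometric-suc : ∀ x y t → geometric x y (suc t) ≃ pow y (suc t) ⊕ x ⊗ geometric x y t
geometric-suc x y t = K.+-cong (K.*-identityˡ _)
  (K.trans (sumTo-cong (suc t) λ k _ → K.*-assoc x (pow x k) (pow y (t ∸ k))) (sumTo-⊗ x (λ k → pow x k ⊗ pow y (t ∸ k)) (suc t)))

-- (x − y) Σ xᵏ yᵗ⁻ᵏ = xᵗ⁺¹ − yᵗ⁺¹, free of subtraction.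
geometric-telescope : ∀ x y t → x ⊗ geometric x y t ⊕ pow y (suc t) ≃ y ⊗ geometric x y t ⊕ pow x (suc t)
geometric-telescope x y zero = begin
  x ⊗ (1F ⊗ 1F ⊕ 0F) ⊕ y ⊗ 1F  ≈⟨ K.+-comm _ _ ⟩
  y ⊗ 1F ⊕ x ⊗ (1F ⊗ 1F ⊕ 0F)  ≈⟨ K.+-cong (K.*-congˡ (K.sym one)) (K.*-congˡ one) ⟩
  y ⊗ (1F ⊗ 1F ⊕ 0F) ⊕ x ⊗ 1F  ∎
  where
  open ≃-Reasoning
  one : 1F ⊗ 1F ⊕ 0F ≃ 1F
  one = K.trans (K.+-identityʳ _) (K.*-identityˡ 1F)
geometric-telescope x y (suc t) = begin
  x ⊗ geometric x y (suc t) ⊕ y ⊗ y′                   ≈⟨ K.+-congʳ (K.*-congˡ (geometric-suc x y t)) ⟩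
  x ⊗ (y′ ⊕ x ⊗ g) ⊕ y ⊗ y′                            ≈⟨ K.+-congʳ (K.*-congˡ (K.+-comm y′ _)) ⟩
  x ⊗ (x ⊗ g ⊕ y′) ⊕ y ⊗ y′                            ≈⟨ K.+-congʳ (K.*-congˡ (geometric-telescope x y t)) ⟩
  x ⊗ (y ⊗ g ⊕ x′) ⊕ y ⊗ y′                            ≈⟨ S.solve 5 (λ x y g x′ y′ → x S.:* (y S.:* g S.:+ x′) S.:+ y S.:* y′ S.:= y S.:* (y′ S.:+ x S.:* g) S.:+ x S.:* x′) K.refl x y g x′ y′ ⟩
  y ⊗ (y′ ⊕ x ⊗ g) ⊕ x ⊗ x′                            ≈⟨ K.+-congʳ (K.*-congˡ (geometric-suc x y t)) ⟨
  y ⊗ geometric x y (suc t) ⊕ x ⊗ x′                   ∎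
  where
  open ≃-Reasoning
  g = geometric x y t
  x′ = pow x (suc t)
  y′ = pow y (suc t)

-- Follows `∂aux` case by case. With the `Ordering` as an argument, proofs match on it directly, and
-- the compared exponents a and b are no longer tied to κ.
∂val : ∀ {m} → Fin m → (Comp (suc m) → 𝔽) → Comp (suc m) → ∀ {a b} → ℕ.Ordering a b → 𝔽
∂val i φ κ (ℕ.less a t)    = sumTo (λ k → φ (setAB i κ (a ℕ.+ k) ((a ℕ.+ t) ∸ k))) (suc t)
∂val i φ κ (ℕ.equal _)     = 0F
∂val i φ κ (ℕ.greater b t) = ⊖ sumTo (λ k → φ (setAB i κ (b ℕ.+ k) ((b ℕ.+ t) ∸ k))) (suc t)

∂* : ∀ {m} → Fin m → (Comp (suc m) → 𝔽) → Comp (suc m) → 𝔽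
∂* i φ κ = ∂val i φ κ (ℕ.compare (lookup κ (inject₁ i)) (lookup κ (Fin.suc i)))

pair-∂aux : ∀ {m} (i : Fin m) φ c κ {a b} (o : ℕ.Ordering a b) → pair φ (∂aux i c κ a b o) ≃ c ⊗ ∂val i φ κ o
pair-∂aux i φ c κ (ℕ.less a t)    = pair-applyUpTo φ c (λ k → setAB i κ (a ℕ.+ k) ((a ℕ.+ t) ∸ k)) (λ k → k) (suc t)
pair-∂aux i φ c κ (ℕ.equal _)     = K.sym (K.zeroʳ c)
pair-∂aux i φ c κ (ℕ.greater b t) = begin
  pair φ (∂aux i c κ _ _ (ℕ.greater b t))   ≈⟨ pair-applyUpTo φ (-F c) (λ k → setAB i κ (b ℕ.+ k) ((b ℕ.+ t) ∸ k)) (λ k → k) (suc t) ⟩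
  (-F c) ⊗ s                                ≡⟨ cong (_⊗ s) (-F≡⊖ c) ⟩
  ⊖ c ⊗ s                                   ≈⟨ Kₚ.-‿distribˡ-* c s ⟨
  ⊖ (c ⊗ s)                                 ≈⟨ Kₚ.-‿distribʳ-* c s ⟩
  c ⊗ ⊖ s                                   ∎
  where
  open ≃-Reasoning
  s = sumTo (λ k → φ (setAB i κ (b ℕ.+ k) ((b ℕ.+ t) ∸ k))) (suc t)

pair-∂P : ∀ {m} (i : Fin m) φ p → pair φ (∂P i p) ≃ pair (∂* i φ) p
pair-∂P i φ = pair-concatMap φ (∂* i φ) (∂term i) λ c κ → pair-∂aux i φ c κ (ℕ.compare (lookup κ (inject₁ i)) (lookup κ (Fin.suc i)))

sumTo-monomials : ∀ {m} (i : Fin m) v κ a t → let x = lookup v (inject₁ i); y = lookup v (Fin.suc i) in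
  sumTo (λ k → monomial v (setAB i κ (a ℕ.+ k) ((a ℕ.+ t) ∸ k))) (suc t)
    ≃ ((pow x a ⊗ pow y a) ⊗ otherFactors i v κ) ⊗ geometric x y t
sumTo-monomials i v κ a t = K.trans (sumTo-cong (suc t) term) (sumTo-⊗ ((pow x a ⊗ pow y a) ⊗ o) (λ k → pow x k ⊗ pow y (t ∸ k)) (suc t))
  where
  open ≃-Reasoning
  x = lookup v (inject₁ i)
  y = lookup v (Fin.suc i)
  o = otherFactors i v κ
  term : ∀ k → k < suc t → monomial v (setAB i κ (a ℕ.+ k) ((a ℕ.+ t) ∸ k))
                            ≃ ((pow x a ⊗ pow y a) ⊗ o) ⊗ (pow x k ⊗ pow y (t ∸ k))
  term k (s≤s k≤t) = begin
    monomial v (setAB i κ (a ℕ.+ k) ((a ℕ.+ t) ∸ k))                  ≈⟨ monomial-setAB i v κ _ _ ⟩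
    (pow x (a ℕ.+ k) ⊗ pow y ((a ℕ.+ t) ∸ k)) ⊗ o                     ≡⟨ cong (λ j → (pow x (a ℕ.+ k) ⊗ pow y j) ⊗ o) (ℕₚ.+-∸-assoc a k≤t) ⟩
    (pow x (a ℕ.+ k) ⊗ pow y (a ℕ.+ (t ∸ k))) ⊗ o                     ≈⟨ K.*-congʳ (K.*-cong (pow-+ x a k) (pow-+ y a (t ∸ k))) ⟩
    ((pow x a ⊗ pow x k) ⊗ (pow y a ⊗ pow y (t ∸ k))) ⊗ o             ≈⟨ S.solve 5 (λ p q r s o → ((p S.:* q) S.:* (r S.:* s)) S.:* o S.:= ((p S.:* r) S.:* o) S.:* (q S.:* s)) K.refl (pow x a) (pow x k) (pow y a) (pow y (t ∸ k)) o ⟩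
    ((pow x a ⊗ pow y a) ⊗ o) ⊗ (pow x k ⊗ pow y (t ∸ k))             ∎

-- `geometric-telescope` multiplied by the common factor x^a y^a and by the powers `o` of the other
-- variables.
telescope-less : ∀ x y a t o → let s = ((pow x a ⊗ pow y a) ⊗ o) ⊗ geometric x y t in
  x ⊗ s ⊕ (pow x a ⊗ pow y (suc (a ℕ.+ t))) ⊗ o ≃ y ⊗ s ⊕ (pow x (suc (a ℕ.+ t)) ⊗ pow y a) ⊗ o
telescope-less x y a t o = begin
  x ⊗ (c ⊗ g) ⊕ (p ⊗ pow y (suc (a ℕ.+ t))) ⊗ o       ≈⟨ K.+-congˡ (K.*-congʳ (K.*-congˡ (K.trans (K.reflexive (cong (pow y) (sym (ℕₚ.+-suc a t)))) (pow-+ y a (suc t))))) ⟩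
  x ⊗ (c ⊗ g) ⊕ (p ⊗ (q ⊗ pow y (suc t))) ⊗ o         ≈⟨ S.solve 6 (λ x p q o g z → x S.:* (((p S.:* q) S.:* o) S.:* g) S.:+ (p S.:* (q S.:* z)) S.:* o S.:= ((p S.:* q) S.:* o) S.:* (x S.:* g S.:+ z)) K.refl x p q o g (pow y (suc t)) ⟩
  c ⊗ (x ⊗ g ⊕ pow y (suc t))                         ≈⟨ K.*-congˡ (geometric-telescope x y t) ⟩
  c ⊗ (y ⊗ g ⊕ pow x (suc t))                         ≈⟨ S.solve 6 (λ y p q o g z → y S.:* (((p S.:* q) S.:* o) S.:* g) S.:+ ((p S.:* z) S.:* q) S.:* o S.:= ((p S.:* q) S.:* o) S.:* (y S.:* g S.:+ z)) K.refl y p q o g (pow x (suc t)) ⟨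
  y ⊗ (c ⊗ g) ⊕ ((p ⊗ pow x (suc t)) ⊗ q) ⊗ o         ≈⟨ K.+-congˡ (K.*-congʳ (K.*-congʳ (K.trans (K.reflexive (cong (pow x) (sym (ℕₚ.+-suc a t)))) (pow-+ x a (suc t))))) ⟨
  y ⊗ (c ⊗ g) ⊕ (pow x (suc (a ℕ.+ t)) ⊗ q) ⊗ o       ∎
  where
  open ≃-Reasoning
  g = geometric x y t
  p = pow x a
  q = pow y a
  c = (p ⊗ q) ⊗ o

-- Exchanging the two exponents changes the sign of ∂_i. This carries the identity for `less` over
-- to `greater`.
negate-exchange : ∀ x y s a b → x ⊗ s ⊕ a ≃ y ⊗ s ⊕ b → x ⊗ ⊖ s ⊕ b ≃ y ⊗ ⊖ s ⊕ a
negate-exchange x y s a b e = begin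
  x ⊗ ⊖ s ⊕ b                              ≈⟨ K.+-identityʳ _ ⟨
  x ⊗ ⊖ s ⊕ b ⊕ 0F                         ≈⟨ K.+-congˡ (cancel y) ⟨
  x ⊗ ⊖ s ⊕ b ⊕ (y ⊗ s ⊕ y ⊗ ⊖ s)          ≈⟨ S.solve 4 (λ p b q r → p S.:+ b S.:+ (q S.:+ r) S.:= (q S.:+ b) S.:+ (p S.:+ r)) K.refl _ b _ _ ⟩
  (y ⊗ s ⊕ b) ⊕ (x ⊗ ⊖ s ⊕ y ⊗ ⊖ s)        ≈⟨ K.+-congʳ e ⟨
  (x ⊗ s ⊕ a) ⊕ (x ⊗ ⊖ s ⊕ y ⊗ ⊖ s)        ≈⟨ S.solve 4 (λ p a q r → (p S.:+ a) S.:+ (q S.:+ r) S.:= r S.:+ a S.:+ (p S.:+ q)) K.refl _ a _ _ ⟩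
  y ⊗ ⊖ s ⊕ a ⊕ (x ⊗ s ⊕ x ⊗ ⊖ s)          ≈⟨ K.+-congˡ (cancel x) ⟩
  y ⊗ ⊖ s ⊕ a ⊕ 0F                         ≈⟨ K.+-identityʳ _ ⟩
  y ⊗ ⊖ s ⊕ a                              ∎
  where
  open ≃-Reasoning
  cancel : ∀ z → z ⊗ s ⊕ z ⊗ ⊖ s ≃ 0F
  cancel z = K.trans (K.sym (K.distribˡ z s (⊖ s))) (K.trans (K.*-congˡ (K.-‿inverseʳ s)) (K.zeroʳ z))

∂val-monomial : ∀ {m} (i : Fin m) v κ {a b} (o : ℕ.Ordering a b) → let x = lookup v (inject₁ i); y = lookup v (Fin.suc i) in
  x ⊗ ∂val i (monomial v) κ o ⊕ (pow x a ⊗ pow y b) ⊗ otherFactors i v κ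
    ≃ y ⊗ ∂val i (monomial v) κ o ⊕ (pow x b ⊗ pow y a) ⊗ otherFactors i v κ
∂val-monomial i v κ (ℕ.less a t) = K.trans (K.+-congʳ (K.*-congˡ (sumTo-monomials i v κ a t)))
  (K.trans (telescope-less _ _ a t _) (K.+-congʳ (K.*-congˡ (K.sym (sumTo-monomials i v κ a t)))))
∂val-monomial i v κ (ℕ.equal a) = K.+-congʳ (K.trans (K.zeroʳ _) (K.sym (K.zeroʳ _)))
∂val-monomial i v κ (ℕ.greater b t) = negate-exchange _ _ _ _ _
  (K.trans (K.+-congʳ (K.*-congˡ (sumTo-monomials i v κ b t)))
  (K.trans (telescope-less _ _ b t _) (K.+-congʳ (K.*-congˡ (K.sym (sumTo-monomials i v κ b t))))))

-- (x_i − x_{i+1}) ∂_i p = s_i p − p, free of subtraction.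
eval-∂P : ∀ {m} (i : Fin m) p v →
  lookup v (inject₁ i) ⊗ eval (∂P i p) v ⊕ eval p v ≃ lookup v (Fin.suc i) ⊗ eval (∂P i p) v ⊕ eval p (swapV i v)
eval-∂P i p v = begin
  x ⊗ eval (∂P i p) v ⊕ eval p v                                ≈⟨ K.+-congʳ (K.*-congˡ (pair-∂P i (monomial v) p)) ⟩
  x ⊗ pair (∂* i (monomial v)) p ⊕ eval p v                     ≈⟨ combine x (monomial v) ⟨
  pair (λ κ → x ⊗ ∂* i (monomial v) κ ⊕ monomial v κ) p         ≈⟨ pair-cong p term ⟩
  pair (λ κ → y ⊗ ∂* i (monomial v) κ ⊕ monomial (swapV i v) κ) p   ≈⟨ combine y (monomial (swapV i v)) ⟩
  y ⊗ pair (∂* i (monomial v)) p ⊕ eval p (swapV i v)           ≈⟨ K.+-congʳ (K.*-congˡ (pair-∂P i (monomial v) p)) ⟨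
  y ⊗ eval (∂P i p) v ⊕ eval p (swapV i v)                      ∎
  where
  open ≃-Reasoning
  x = lookup v (inject₁ i)
  y = lookup v (Fin.suc i)
  combine : ∀ z ψ → pair (λ κ → z ⊗ ∂* i (monomial v) κ ⊕ ψ κ) p ≃ z ⊗ pair (∂* i (monomial v)) p ⊕ pair ψ p
  combine z ψ = K.trans (pair-⊕ _ ψ p) (K.+-congʳ (pair-⊗ z _ p))
  term : ∀ κ → x ⊗ ∂* i (monomial v) κ ⊕ monomial v κ ≃ y ⊗ ∂* i (monomial v) κ ⊕ monomial (swapV i v) κ
  term κ = K.trans (K.+-congˡ (monomial-split i v κ))
    (K.trans (∂val-monomial i v κ (ℕ.compare (lookup κ (inject₁ i)) (lookup κ (Fin.suc i))))
      (K.+-congˡ (K.trans (K.sym (monomial-setAB i v κ _ _)) (monomial-swap i v κ))))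

-- Interpolation points

zipWith-swapV : ∀ {A B C : Set} (f : A → B → C) {m} (i : Fin m) u v →
  zipWith f (swapV i u) (swapV i v) ≡ swapV i (zipWith f u v)
zipWith-swapV f Fin.zero    (x ∷ y ∷ u) (a ∷ b ∷ v) = refl
zipWith-swapV f (Fin.suc i) (x ∷ u)     (a ∷ v)     = cong (f x a ∷_) (zipWith-swapV f i u v)

zipWith-∷ʳ : ∀ {A B C : Set} (f : A → B → C) {m} (u : Vec A m) (v : Vec B m) x y →
  zipWith f (u ∷ʳ x) (v ∷ʳ y) ≡ zipWith f u v ∷ʳ f x y
zipWith-∷ʳ f []      []      x y = refl
zipWith-∷ʳ f (a ∷ u) (b ∷ v) x y = cong (f a b ∷_) (zipWith-∷ʳ f u v x y)

-- le and lt are the 0/1 indicators of ≤ and <.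
le lt : ℕ → ℕ → ℕ
le zero    b       = 1
le (suc a) zero    = 0
le (suc a) (suc b) = le a b
lt a b = le (suc a) b

lt+le : ∀ a b → lt a b ℕ.+ le b a ≡ 1
lt+le zero    zero    = refl
lt+le zero    (suc b) = refl
lt+le (suc a) zero    = refl
lt+le (suc a) (suc b) = lt+le a b

le-refl : ∀ a → le a a ≡ 1
le-refl zero    = refl
le-refl (suc a) = le-refl a

lt-irrefl : ∀ a → lt a a ≡ 0
lt-irrefl zero    = refl
lt-irrefl (suc a) = lt-irrefl a

le≡lt : ∀ {a b} → a ≢ b → le a b ≡ lt a b
le≡lt {zero}  {zero}  a≢b = ⊥-elim (a≢b refl)
le≡lt {zero}  {suc b} a≢b = refl
le≡lt {suc a} {zero}  a≢b = refl
le≡lt {suc a} {suc b} a≢b = le≡lt (a≢b ∘ cong suc)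

countLe : ∀ {n} → ℕ → Comp n → ℕ
countLe a []      = 0
countLe a (b ∷ γ) = le b a ℕ.+ countLe a γ

-- Entry p counts the k with γ_k < γ_p, or γ_k = γ_p and k > p; it equals
-- n − 1 − rank0 γ p, the coefficient of r in bar γ.
coranks : ∀ {n} → Comp n → Vec ℕ n
coranks []      = []
coranks (a ∷ γ) = countLe a γ ∷ zipWith (λ b c → lt a b ℕ.+ c) γ (coranks γ)

+-pull : ∀ a b c → a ℕ.+ (b ℕ.+ c) ≡ b ℕ.+ (a ℕ.+ c)
+-pull a b c = trans (sym (ℕₚ.+-assoc a b c)) (trans (cong (ℕ._+ c) (ℕₚ.+-comm a b)) (ℕₚ.+-assoc b a c))

+-interchange : ∀ a b c d → (a ℕ.+ b) ℕ.+ (c ℕ.+ d) ≡ (a ℕ.+ c) ℕ.+ (b ℕ.+ d)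
+-interchange a b c d = trans (ℕₚ.+-assoc a b (c ℕ.+ d)) (trans (cong (a ℕ.+_) (+-pull b c d)) (sym (ℕₚ.+-assoc a c (b ℕ.+ d))))

countLe-swap : ∀ {m} (i : Fin m) a γ → countLe a (swapC i γ) ≡ countLe a γ
countLe-swap Fin.zero    a (b ∷ c ∷ γ) = +-pull (le c a) (le b a) _
countLe-swap (Fin.suc i) a (b ∷ γ)     = cong (le b a ℕ.+_) (countLe-swap i a γ)

zipWith-pull : ∀ {n} a b (γ c : Vec ℕ n) →
  zipWith (λ x k → lt a x ℕ.+ k) γ (zipWith (λ x k → lt b x ℕ.+ k) γ c)
    ≡ zipWith (λ x k → lt b x ℕ.+ k) γ (zipWith (λ x k → lt a x ℕ.+ k) γ c)
zipWith-pull a b []      []      = refl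
zipWith-pull a b (x ∷ γ) (k ∷ c) = cong₂ _∷_ (+-pull (lt a x) (lt b x) k) (zipWith-pull a b γ c)

-- Only the comparison of the two neighbours with each other depends on their order. It is `le` in
-- one order and `lt` in the other, and these agree on distinct entries.
coranks-swap : ∀ {m} (i : Fin m) γ → lookup γ (inject₁ i) ≢ lookup γ (Fin.suc i) →
  coranks (swapC i γ) ≡ swapV i (coranks γ)
coranks-swap Fin.zero    (a ∷ b ∷ γ) a≢b =
  cong₂ _∷_ (cong (ℕ._+ countLe b γ) (le≡lt a≢b))
    (cong₂ _∷_ (cong (ℕ._+ countLe a γ) (sym (le≡lt (a≢b ∘ sym)))) (zipWith-pull b a γ (coranks γ)))
coranks-swap (Fin.suc i) (a ∷ γ)     γᵢ≢ =
  cong₂ _∷_ (countLe-swap i a γ)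
    (trans (cong (zipWith _ (swapC i γ)) (coranks-swap i γ γᵢ≢)) (zipWith-swapV _ i γ (coranks γ)))

-- Of two equal neighbours the earlier counts the later and not conversely; all other comparisons
-- are the same for both. This is the source of the difference r between the two coordinates.
coranks-tie : ∀ {m} (i : Fin m) γ → lookup γ (inject₁ i) ≡ lookup γ (Fin.suc i) →
  lookup (coranks γ) (inject₁ i) ≡ suc (lookup (coranks γ) (Fin.suc i))
coranks-tie Fin.zero    (a ∷ b ∷ γ) refl =
  trans (cong (ℕ._+ countLe a γ) (le-refl a)) (cong (λ k → suc (k ℕ.+ countLe a γ)) (sym (lt-irrefl a)))
coranks-tie (Fin.suc i) (a ∷ γ)     eq
  rewrite Vecₚ.lookup-zipWith (λ b c → lt a b ℕ.+ c) (inject₁ i) γ (coranks γ)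
        | Vecₚ.lookup-zipWith (λ b c → lt a b ℕ.+ c) (Fin.suc i) γ (coranks γ)
        | coranks-tie i γ eq | eq = ℕₚ.+-suc _ _

countLe-∷ʳ : ∀ {n} a (γ : Comp n) b → countLe a (γ ∷ʳ b) ≡ le b a ℕ.+ countLe a γ
countLe-∷ʳ a []      b = refl
countLe-∷ʳ a (c ∷ γ) b = trans (cong (le c a ℕ.+_) (countLe-∷ʳ a γ b)) (+-pull (le c a) (le b a) _)

-- Defined through the predecessor, so that a last entry `suc a` receives by computation the corank
-- `countLe a γ` of a first entry `a`.
countLt : ∀ {n} → ℕ → Comp n → ℕ
countLt zero    γ = 0
countLt (suc a) γ = countLe a γ

countLt-∷ : ∀ {n} a b (γ : Comp n) → countLt a (b ∷ γ) ≡ lt b a ℕ.+ countLt a γ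
countLt-∷ zero    b γ = refl
countLt-∷ (suc a) b γ = refl

zipWith-le-pull : ∀ {n} a b (γ c : Vec ℕ n) →
  zipWith (λ x k → lt a x ℕ.+ k) γ (zipWith (λ x k → le b x ℕ.+ k) γ c)
    ≡ zipWith (λ x k → le b x ℕ.+ k) γ (zipWith (λ x k → lt a x ℕ.+ k) γ c)
zipWith-le-pull a b []      []      = refl
zipWith-le-pull a b (x ∷ γ) (k ∷ c) = cong₂ _∷_ (+-pull (lt a x) (le b x) k) (zipWith-le-pull a b γ c)

-- A last entry loses every tie: an earlier x counts it when b ≤ x, and it counts only strictly
-- smaller entries. For b = `suc a` the test `le (suc a) x` is `lt a x`, the rule for a first entry
-- `a`; hence Φ merely rotates the coranks.
coranks-∷ʳ : ∀ {n} (γ : Comp n) b →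
  coranks (γ ∷ʳ b) ≡ zipWith (λ x k → le b x ℕ.+ k) γ (coranks γ) ∷ʳ countLt b γ
coranks-∷ʳ []      zero    = refl
coranks-∷ʳ []      (suc b) = refl
coranks-∷ʳ (a ∷ γ) b = cong₂ _∷_ (countLe-∷ʳ a γ b) (begin
  zipWith f (γ ∷ʳ b) (coranks (γ ∷ʳ b))                           ≡⟨ cong (zipWith f (γ ∷ʳ b)) (coranks-∷ʳ γ b) ⟩
  zipWith f (γ ∷ʳ b) (zipWith g γ (coranks γ) ∷ʳ countLt b γ)     ≡⟨ zipWith-∷ʳ f γ _ b _ ⟩
  zipWith f γ (zipWith g γ (coranks γ)) ∷ʳ (lt a b ℕ.+ countLt b γ)
    ≡⟨ cong₂ _∷ʳ_ (zipWith-le-pull a b γ (coranks γ)) (sym (countLt-∷ b a γ)) ⟩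
  zipWith g γ (zipWith f γ (coranks γ)) ∷ʳ countLt b (a ∷ γ)      ∎)
  where
  open ≡.≡-Reasoning
  f g : ℕ → ℕ → ℕ
  f x k = lt a x ℕ.+ k
  g x k = le b x ℕ.+ k

-- Coranks as complements of ranks

indicator : ∀ {P : Set} → Dec P → ℕ
indicator d = if does d then 1 else 0

sumFin : ∀ {n} → (Fin n → ℕ) → ℕ
sumFin {zero}  f = 0
sumFin {suc n} f = f Fin.zero ℕ.+ sumFin (f ∘ Fin.suc)

-- The counts in `rank0` are lengths of filtered lists of positions. As sums over `Fin` they split
-- off the first position, just as `coranks` does.
length-filter-tabulate : ∀ {m n} {P : Fin n → Set} (P? : ∀ k → Dec (P k)) (f : Fin m → Fin n) →
  List.length (List.filter P? (List.tabulate f)) ≡ sumFin (λ k → indicator (P? (f k)))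
length-filter-tabulate {zero}  P? f = refl
length-filter-tabulate {suc m} P? f with P? (f Fin.zero)
... | yes _ = cong suc (length-filter-tabulate P? (f ∘ Fin.suc))
... | no _  = length-filter-tabulate P? (f ∘ Fin.suc)

greater earlierTie : ∀ {n} → Comp n → Fin n → Fin n → ℕ
greater    γ p k = indicator (lookup γ p ℕ.<? lookup γ k)
earlierTie γ p k = indicator ((k Fin.<? p) ×-dec (lookup γ k ℕ.≟ lookup γ p))

rank0≡sumFin : ∀ {n} (γ : Comp n) p → rank0 γ p ≡ sumFin (greater γ p) ℕ.+ sumFin (earlierTie γ p)
rank0≡sumFin γ p = cong₂ ℕ._+_
  (length-filter-tabulate (λ k → lookup γ p ℕ.<? lookup γ k) (λ k → k))
  (length-filter-tabulate (λ k → (k Fin.<? p) ×-dec (lookup γ k ℕ.≟ lookup γ p)) (λ k → k))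

indicator-< : ∀ a b → indicator (a ℕ.<? b) ≡ lt a b
indicator-< a       zero    = refl
indicator-< zero    (suc b) = refl
indicator-< (suc a) (suc b) = indicator-< a b

indicator-<+≡ : ∀ a b → indicator (b ℕ.<? a) ℕ.+ indicator (a ℕ.≟ b) ≡ le b a
indicator-<+≡ zero    zero    = refl
indicator-<+≡ zero    (suc b) = refl
indicator-<+≡ (suc a) zero    = refl
indicator-<+≡ (suc a) (suc b) = indicator-<+≡ a b

sumFin-0 : ∀ n → sumFin {n} (λ _ → 0) ≡ 0
sumFin-0 zero    = refl
sumFin-0 (suc n) = sumFin-0 n

sumFin-greater : ∀ {n} a (γ : Comp n) → sumFin (λ k → indicator (a ℕ.<? lookup γ k)) ℕ.+ countLe a γ ≡ n
sumFin-greater a []      = refl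
sumFin-greater a (b ∷ γ) = begin
  (indicator (a ℕ.<? b) ℕ.+ g) ℕ.+ (le b a ℕ.+ countLe a γ)    ≡⟨ cong (λ x → (x ℕ.+ g) ℕ.+ (le b a ℕ.+ countLe a γ)) (indicator-< a b) ⟩
  (lt a b ℕ.+ g) ℕ.+ (le b a ℕ.+ countLe a γ)                  ≡⟨ +-interchange (lt a b) g (le b a) _ ⟩
  (lt a b ℕ.+ le b a) ℕ.+ (g ℕ.+ countLe a γ)                  ≡⟨ cong₂ ℕ._+_ (lt+le a b) (sumFin-greater a γ) ⟩
  suc _                                                        ∎
  where
  open ≡.≡-Reasoning
  g = sumFin (λ k → indicator (a ℕ.<? lookup γ k))

-- Every position other than p holds a greater entry, is an earlier tie, or is counted by the
-- corank; the `suc` accounts for p itself. The additive form keeps truncated subtraction out of the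
-- induction.
rank+corank : ∀ {n} (γ : Comp n) p →
  suc ((sumFin (greater γ p) ℕ.+ sumFin (earlierTie γ p)) ℕ.+ lookup (coranks γ) p) ≡ n
rank+corank {suc n} (a ∷ γ) Fin.zero = cong suc (begin
  ((indicator (a ℕ.<? a) ℕ.+ g) ℕ.+ sumFin {n} (λ _ → 0)) ℕ.+ countLe a γ
    ≡⟨ cong₂ (λ x y → ((x ℕ.+ g) ℕ.+ y) ℕ.+ countLe a γ) (trans (indicator-< a a) (lt-irrefl a)) (sumFin-0 n) ⟩
  (g ℕ.+ 0) ℕ.+ countLe a γ   ≡⟨ cong (ℕ._+ countLe a γ) (ℕₚ.+-identityʳ g) ⟩
  g ℕ.+ countLe a γ           ≡⟨ sumFin-greater a γ ⟩
  n                           ∎)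
  where
  open ≡.≡-Reasoning
  g = sumFin (λ k → indicator (a ℕ.<? lookup γ k))
rank+corank {suc n} (a ∷ γ) (Fin.suc p) = cong suc (begin
  ((d ℕ.+ g) ℕ.+ (e ℕ.+ t)) ℕ.+ lookup (coranks (a ∷ γ)) (Fin.suc p)
    ≡⟨ cong₂ ℕ._+_ (+-interchange d g e t) (Vecₚ.lookup-zipWith (λ b c → lt a b ℕ.+ c) p γ (coranks γ)) ⟩
  ((d ℕ.+ e) ℕ.+ (g ℕ.+ t)) ℕ.+ (lt a γₚ ℕ.+ c)   ≡⟨ cong (λ x → (x ℕ.+ (g ℕ.+ t)) ℕ.+ (lt a γₚ ℕ.+ c)) (indicator-<+≡ a γₚ) ⟩
  (le γₚ a ℕ.+ (g ℕ.+ t)) ℕ.+ (lt a γₚ ℕ.+ c)     ≡⟨ +-interchange (le γₚ a) (g ℕ.+ t) (lt a γₚ) c ⟩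
  (le γₚ a ℕ.+ lt a γₚ) ℕ.+ ((g ℕ.+ t) ℕ.+ c)     ≡⟨ cong (ℕ._+ ((g ℕ.+ t) ℕ.+ c)) (trans (ℕₚ.+-comm (le γₚ a) (lt a γₚ)) (lt+le a γₚ)) ⟩
  suc ((g ℕ.+ t) ℕ.+ c)                           ≡⟨ rank+corank γ p ⟩
  n                                               ∎)
  where
  open ≡.≡-Reasoning
  γₚ d e g t c : ℕ
  γₚ = lookup γ p
  d  = indicator (γₚ ℕ.<? a)
  e  = indicator (a ℕ.≟ γₚ)
  g  = sumFin (greater γ p)
  t  = sumFin (earlierTie γ p)
  c  = lookup (coranks γ) p

corank≡ : ∀ {n} (γ : Comp n) p → (n ∸ 1) ∸ rank0 γ p ≡ lookup (coranks γ) p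
corank≡ {n} γ p rewrite rank0≡sumFin γ p =
  trans (cong (λ k → (k ∸ 1) ∸ s) (sym (rank+corank γ p))) (ℕₚ.m+n∸m≡n s _)
  where s = sumFin (greater γ p) ℕ.+ sumFin (earlierTie γ p)

-- Coordinates as elements of ℚ(r)

ℚᵘ-suc : ∀ a → ℚᵘ.mkℚᵘ (+ suc a) 0 ℚᵘ.≃ ℚᵘ.mkℚᵘ (+ 1) 0 ℚᵘ.+ ℚᵘ.mkℚᵘ (+ a) 0
ℚᵘ-suc a = ℚᵘ.*≡* (cong (λ x → (+ 1 ℤ.+ x) ℤ.* + 1) (sym (ℤₚ.*-identityʳ (+ a))))

-- The quotient `+ a ℚ./ 1` is normalised by a gcd that is stuck on a variable, hence the detour
-- through unnormalised rationals.
ℚ-suc : ∀ a → + suc a ℚ./ 1 ≡ 1ℚ ℚ.+ (+ a ℚ./ 1)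
ℚ-suc a = ℚₚ.toℚᵘ-injective (begin
  ℚ.toℚᵘ (ℚ.fromℚᵘ (ℚᵘ.mkℚᵘ (+ suc a) 0))                 ≈⟨ ℚₚ.toℚᵘ-fromℚᵘ _ ⟩
  ℚᵘ.mkℚᵘ (+ suc a) 0                                     ≈⟨ ℚᵘ-suc a ⟩
  ℚᵘ.mkℚᵘ (+ 1) 0 ℚᵘ.+ ℚᵘ.mkℚᵘ (+ a) 0                    ≈⟨ ℚᵘₚ.+-congʳ (ℚᵘ.mkℚᵘ (+ 1) 0) (ℚₚ.toℚᵘ-fromℚᵘ (ℚᵘ.mkℚᵘ (+ a) 0)) ⟨
  ℚ.toℚᵘ 1ℚ ℚᵘ.+ ℚ.toℚᵘ (+ a ℚ./ 1)                       ≈⟨ ℚₚ.toℚᵘ-homo-+ 1ℚ (+ a ℚ./ 1) ⟨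
  ℚ.toℚᵘ (1ℚ ℚ.+ (+ a ℚ./ 1))                             ∎)
  where open SetoidReasoning ℚᵘₚ.≃-setoid

ℚ-injective : ∀ a b → + a ℚ./ 1 ≡ + b ℚ./ 1 → a ≡ b
ℚ-injective a b e with ℚₚ.fromℚᵘ-injective {ℚᵘ.mkℚᵘ (+ a) 0} {ℚᵘ.mkℚᵘ (+ b) 0} e
... | ℚᵘ.*≡* eq = ℤₚ.+-injective (trans (sym (ℤₚ.*-identityʳ (+ a))) (trans eq (ℤₚ.*-identityʳ (+ b))))

rcoef-0-* : ∀ p q → rcoef 0 (p *ᵣ q) ≡ rcoef 0 p ℚ.* rcoef 0 q
rcoef-0-* []      q       = sym (ℚₚ.*-zeroˡ (rcoef 0 q))
rcoef-0-* (a ∷ p) []      = sym (ℚₚ.*-zeroʳ a)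
rcoef-0-* (a ∷ p) (b ∷ q) = ℚₚ.+-identityʳ (a ℚ.* b)

opaque
  unfolding _⊕_ _⊗_ ⊖_

  ℕ→𝔽-suc : ∀ a → ℕ→𝔽 (suc a) ≃ 1F ⊕ ℕ→𝔽 a
  ℕ→𝔽-suc a = ≃-intro 1ᵣ 1ᵣ ≋-refl ≋-refl (*ᵣ-congʳ 1ᵣ (∷-cong (begin
    + suc a ℚ./ 1                                          ≡⟨ ℚ-suc a ⟩
    1ℚ ℚ.+ (+ a ℚ./ 1)                                     ≡⟨ cong (1ℚ ℚ.+_) (trans (ℚₚ.+-identityʳ ((+ a ℚ./ 1) ℚ.* 1ℚ)) (ℚₚ.*-identityʳ (+ a ℚ./ 1))) ⟨
    1ℚ ℚ.+ ((+ a ℚ./ 1) ℚ.* 1ℚ ℚ.+ 0ℚ)                     ∎) (≋-refl {[]})))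
    where open ≡.≡-Reasoning

  -- Setting r = 0 in a + k r leaves a. The factor `1ᵣ` is the denominator that cross-multiplication
  -- in `≈` puts there.
  constantTerm : ∀ a k → rcoef 0 (num (ℕ→𝔽 a ⊕ rF ⊗ ℕ→𝔽 k) *ᵣ 1ᵣ) ≡ + a ℚ./ 1
  constantTerm a k = begin
    rcoef 0 (num x *ᵣ 1ᵣ)                    ≡⟨ rcoef-0-* (num x) 1ᵣ ⟩
    rcoef 0 (num x) ℚ.* 1ℚ                   ≡⟨ ℚₚ.*-identityʳ _ ⟩
    rcoef 0 (num x)                          ≡⟨ rcoef-+ᵣ (num (ℕ→𝔽 a) *ᵣ 1ᵣ) (num y *ᵣ 1ᵣ) 0 ⟩
    rcoef 0 (num (ℕ→𝔽 a) *ᵣ 1ᵣ) ℚ.+ rcoef 0 (num y *ᵣ 1ᵣ)   ≡⟨ cong₂ ℚ._+_ (rcoef-0-* (num (ℕ→𝔽 a)) 1ᵣ) (rcoef-0-* (num y) 1ᵣ) ⟩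
    (+ a ℚ./ 1) ℚ.* 1ℚ ℚ.+ rcoef 0 (num y) ℚ.* 1ℚ           ≡⟨ cong₂ ℚ._+_ (ℚₚ.*-identityʳ (+ a ℚ./ 1)) (ℚₚ.*-identityʳ (rcoef 0 (num y))) ⟩
    (+ a ℚ./ 1) ℚ.+ rcoef 0 (num y)                         ≡⟨ cong ((+ a ℚ./ 1) ℚ.+_) (trans (rcoef-0-* (num rF) (num (ℕ→𝔽 k))) (ℚₚ.*-zeroˡ (+ k ℚ./ 1))) ⟩
    (+ a ℚ./ 1) ℚ.+ 0ℚ                                      ≡⟨ ℚₚ.+-identityʳ _ ⟩
    + a ℚ./ 1                                               ∎
    where
    open ≡.≡-Reasoning
    x y : 𝔽
    x = ℕ→𝔽 a ⊕ rF ⊗ ℕ→𝔽 k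
    y = rF ⊗ ℕ→𝔽 k

  constantTerm-injective : ∀ a b k l → ℕ→𝔽 a ⊕ rF ⊗ ℕ→𝔽 k ≃ ℕ→𝔽 b ⊕ rF ⊗ ℕ→𝔽 l → a ≡ b
  constantTerm-injective a b k l (mk≃ e) =
    ℚ-injective a b (trans (sym (constantTerm a k)) (trans (e 0) (constantTerm b l)))

neg-shift : ∀ {x y} z → x ≃ z ⊕ y → ⊖ y ≃ ⊖ x ⊕ z
neg-shift {x} {y} z e = begin
  ⊖ y                  ≈⟨ K.+-identityˡ _ ⟨
  0F ⊕ ⊖ y             ≈⟨ K.+-congʳ (K.-‿inverseˡ x) ⟨
  (⊖ x ⊕ x) ⊕ ⊖ y      ≈⟨ K.+-congʳ (K.+-congˡ e) ⟩
  (⊖ x ⊕ (z ⊕ y)) ⊕ ⊖ y  ≈⟨ S.solve 4 (λ a b c d → (a S.:+ (b S.:+ c)) S.:+ d S.:= (a S.:+ b) S.:+ (c S.:+ d)) K.refl (⊖ x) z y (⊖ y) ⟩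
  (⊖ x ⊕ z) ⊕ (y ⊕ ⊖ y)  ≈⟨ K.+-congˡ (K.-‿inverseʳ y) ⟩
  (⊖ x ⊕ z) ⊕ 0F       ≈⟨ K.+-identityʳ _ ⟩
  ⊖ x ⊕ z              ∎
  where open ≃-Reasoning

opaque
  coord : ℕ → ℕ → 𝔽
  coord a k = ⊖ (ℕ→𝔽 a ⊕ rF ⊗ ℕ→𝔽 k)

  coord-def : ∀ a k → coord a k ≡ ⊖ (ℕ→𝔽 a ⊕ rF ⊗ ℕ→𝔽 k)
  coord-def a k = refl

  -- Since r is an indeterminate, different integer parts give different coordinates whatever the
  -- multiples of r.
  coord-injective : ∀ {a b} k l → coord a k ≃ coord b l → a ≡ b
  coord-injective {a} {b} k l e = constantTerm-injective a b k l (Kₚ.-‿injective e)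

  coord-suc : ∀ a k → coord a k ≃ coord (suc a) k ⊕ 1F
  coord-suc a k = neg-shift 1F (K.trans (K.+-congʳ (ℕ→𝔽-suc a)) (K.+-assoc 1F (ℕ→𝔽 a) (rF ⊗ ℕ→𝔽 k)))

  coord-tie : ∀ a k → coord a k ≃ coord a (suc k) ⊕ rF
  coord-tie a k = neg-shift rF (begin
    ℕ→𝔽 a ⊕ rF ⊗ ℕ→𝔽 (suc k)           ≈⟨ K.+-congˡ (K.*-congˡ (ℕ→𝔽-suc k)) ⟩
    ℕ→𝔽 a ⊕ rF ⊗ (1F ⊕ ℕ→𝔽 k)          ≈⟨ K.+-congˡ (K.trans (K.distribˡ rF 1F (ℕ→𝔽 k)) (K.+-congʳ (K.*-identityʳ rF))) ⟩
    ℕ→𝔽 a ⊕ (rF ⊕ rF ⊗ ℕ→𝔽 k)          ≈⟨ S.solve 3 (λ a b c → a S.:+ (b S.:+ c) S.:= b S.:+ (a S.:+ c)) K.refl (ℕ→𝔽 a) rF (rF ⊗ ℕ→𝔽 k) ⟩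
    rF ⊕ (ℕ→𝔽 a ⊕ rF ⊗ ℕ→𝔽 k)          ∎)
    where open ≃-Reasoning

-- point 0 γ = −γ̄; the shift s absorbs the change of n − 1 when a last zero is dropped.
point : ∀ {n} → ℕ → Comp n → Vec 𝔽 n
point s γ = zipWith (λ a c → coord a (s ℕ.+ c)) γ (coranks γ)

point-swap : ∀ {m} s (i : Fin m) γ → lookup γ (inject₁ i) ≢ lookup γ (Fin.suc i) →
  point s (swapC i γ) ≡ swapV i (point s γ)
point-swap s i γ γᵢ≢ = trans (cong (zipWith _ (swapC i γ)) (coranks-swap i γ γᵢ≢)) (zipWith-swapV _ i γ (coranks γ))

lookup-point : ∀ {n} s (γ : Comp n) i → lookup (point s γ) i ≡ coord (lookup γ i) (s ℕ.+ lookup (coranks γ) i)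
lookup-point s γ i = Vecₚ.lookup-zipWith (λ a c → coord a (s ℕ.+ c)) i γ (coranks γ)

point-tie : ∀ {m} s (i : Fin m) γ → lookup γ (inject₁ i) ≡ lookup γ (Fin.suc i) →
  lookup (point s γ) (Fin.suc i) ≃ lookup (point s γ) (inject₁ i) ⊕ rF
point-tie s i γ eq
  rewrite lookup-point s γ (Fin.suc i) | lookup-point s γ (inject₁ i) | coranks-tie i γ eq | eq
        | ℕₚ.+-suc s (lookup (coranks γ) (Fin.suc i)) =
  coord-tie (lookup γ (Fin.suc i)) (s ℕ.+ lookup (coranks γ) (Fin.suc i))

zipWith-zipWith : ∀ {A B C D : Set} (f : A → C → D) (g : A → B → C) {n} (u : Vec A n) v →
  zipWith f u (zipWith g u v) ≡ zipWith (λ x y → f x (g x y)) u v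
zipWith-zipWith f g []      []      = refl
zipWith-zipWith f g (x ∷ u) (y ∷ v) = cong (_ ∷_) (zipWith-zipWith f g u v)

zipWith-cong : ∀ {A B C : Set} {f g : A → B → C} → (∀ x y → f x y ≡ g x y) → ∀ {n} (u : Vec A n) v →
  zipWith f u v ≡ zipWith g u v
zipWith-cong e []      []      = refl
zipWith-cong e (x ∷ u) (y ∷ v) = cong₂ _∷_ (e x y) (zipWith-cong e u v)

-- The coordinates common to two points: those of `a ∷ γ` after the first, and those of `γ ∷ʳ suc a`
-- before the last.
pointTail : ∀ {n} → ℕ → ℕ → Comp n → Vec 𝔽 n
pointTail s a γ = zipWith (λ b c → coord b (s ℕ.+ c)) γ (zipWith (λ b c → lt a b ℕ.+ c) γ (coranks γ))

point-Φ : ∀ {m} s a (γ : Comp m) → point s (γ ∷ʳ suc a) ≡ pointTail s a γ ∷ʳ coord (suc a) (s ℕ.+ countLe a γ)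
point-Φ s a γ = trans (cong (zipWith _ (γ ∷ʳ suc a)) (coranks-∷ʳ γ (suc a))) (zipWith-∷ʳ _ γ _ (suc a) (countLe a γ))

-- A final 0 is counted by every earlier entry, so it raises all the other coranks by one, and
-- itself counts nothing.
point-∷ʳ0 : ∀ {m} s (γ : Comp m) → point s (γ ∷ʳ 0) ≡ point (suc s) γ ∷ʳ coord 0 (s ℕ.+ 0)
point-∷ʳ0 s γ = trans (cong (zipWith _ (γ ∷ʳ 0)) (coranks-∷ʳ γ 0))
  (trans (zipWith-∷ʳ _ γ _ 0 0)
    (cong (_∷ʳ coord 0 (s ℕ.+ 0)) (trans (zipWith-zipWith _ _ γ (coranks γ))
      (zipWith-cong (λ a c → cong (coord a) (ℕₚ.+-suc s c)) γ (coranks γ)))))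

-- The bridge from `bar`, built on filtered counts, to the recursive `coranks` on which all facts
-- about points are proved.
map-⊖-bar : ∀ {n} (γ : Comp n) → Vec.map ⊖_ (bar γ) ≡ point 0 γ
map-⊖-bar {n} γ = begin
  Vec.map ⊖_ (bar γ)                                  ≡⟨ Vecₚ.tabulate-∘ ⊖_ _ ⟨
  tabulate (λ p → ⊖ (ℕ→𝔽 (lookup γ p) +F rF *F ℕ→𝔽 ((n ∸ 1) ∸ rank0 γ p)))   ≡⟨ Vecₚ.tabulate-cong entry ⟩
  tabulate (lookup (point 0 γ))                       ≡⟨ Vecₚ.tabulate∘lookup (point 0 γ) ⟩
  point 0 γ                                           ∎
  where
  open ≡.≡-Reasoning
  entry : ∀ p → ⊖ (ℕ→𝔽 (lookup γ p) +F rF *F ℕ→𝔽 ((n ∸ 1) ∸ rank0 γ p)) ≡ lookup (point 0 γ) p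
  entry p = begin
    ⊖ (ℕ→𝔽 (lookup γ p) +F rF *F ℕ→𝔽 ((n ∸ 1) ∸ rank0 γ p))   ≡⟨ cong (λ k → ⊖ (ℕ→𝔽 (lookup γ p) +F rF *F ℕ→𝔽 k)) (corank≡ γ p) ⟩
    ⊖ (ℕ→𝔽 (lookup γ p) +F rF *F ℕ→𝔽 c)                        ≡⟨ cong ⊖_ (+F≡⊕ (ℕ→𝔽 (lookup γ p)) (rF *F ℕ→𝔽 c)) ⟩
    ⊖ (ℕ→𝔽 (lookup γ p) ⊕ rF *F ℕ→𝔽 c)                         ≡⟨ cong (λ x → ⊖ (ℕ→𝔽 (lookup γ p) ⊕ x)) (*F≡⊗ rF (ℕ→𝔽 c)) ⟩
    ⊖ (ℕ→𝔽 (lookup γ p) ⊕ rF ⊗ ℕ→𝔽 c)                          ≡⟨ coord-def (lookup γ p) c ⟨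
    coord (lookup γ p) c                                       ≡⟨ lookup-point 0 γ p ⟨
    lookup (point 0 γ) p                                       ∎
    where c = lookup (coranks γ) p

-- Leading terms and vanishing

sum-+ᶜ : ∀ {n} (κ μ : Comp n) → ∣ κ +ᶜ μ ∣ ≡ ∣ κ ∣ ℕ.+ ∣ μ ∣
sum-+ᶜ []      []      = refl
sum-+ᶜ (a ∷ κ) (b ∷ μ) = trans (cong (a ℕ.+ b ℕ.+_) (sum-+ᶜ κ μ)) (+-interchange a b ∣ κ ∣ ∣ μ ∣)

sum-∷ʳ : ∀ {n} (κ : Comp n) a → ∣ κ ∷ʳ a ∣ ≡ a ℕ.+ ∣ κ ∣
sum-∷ʳ []      a = refl
sum-∷ʳ (b ∷ κ) a = trans (cong (b ℕ.+_) (sum-∷ʳ κ a)) (+-pull b a ∣ κ ∣)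

sum-setAB : ∀ {m} (i : Fin m) κ a b →
  ∣ setAB i κ a b ∣ ℕ.+ (lookup κ (inject₁ i) ℕ.+ lookup κ (Fin.suc i)) ≡ (a ℕ.+ b) ℕ.+ ∣ κ ∣
sum-setAB Fin.zero    (k ∷ l ∷ κ) a b = begin
  (a ℕ.+ (b ℕ.+ ∣ κ ∣)) ℕ.+ (k ℕ.+ l)   ≡⟨ cong₂ ℕ._+_ (sym (ℕₚ.+-assoc a b ∣ κ ∣)) refl ⟩
  ((a ℕ.+ b) ℕ.+ ∣ κ ∣) ℕ.+ (k ℕ.+ l)   ≡⟨ ℕₚ.+-assoc (a ℕ.+ b) ∣ κ ∣ (k ℕ.+ l) ⟩
  (a ℕ.+ b) ℕ.+ (∣ κ ∣ ℕ.+ (k ℕ.+ l))   ≡⟨ cong ((a ℕ.+ b) ℕ.+_) (trans (ℕₚ.+-comm ∣ κ ∣ (k ℕ.+ l)) (ℕₚ.+-assoc k l ∣ κ ∣)) ⟩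
  (a ℕ.+ b) ℕ.+ (k ℕ.+ (l ℕ.+ ∣ κ ∣))   ∎
  where open ≡.≡-Reasoning
sum-setAB (Fin.suc i) (k ∷ κ)     a b =
  trans (ℕₚ.+-assoc k _ _) (trans (cong (k ℕ.+_) (sum-setAB i κ a b)) (+-pull k (a ℕ.+ b) ∣ κ ∣))

sum-swapC : ∀ {m} (i : Fin m) κ → ∣ swapC i κ ∣ ≡ ∣ κ ∣
sum-swapC Fin.zero    (k ∷ l ∷ κ) = +-pull l k ∣ κ ∣
sum-swapC (Fin.suc i) (k ∷ κ)     = cong (k ℕ.+_) (sum-swapC i κ)

0ᶜ : ∀ {n} → Comp n
0ᶜ = replicate _ 0

unit : ∀ {n} → Fin n → Comp n
unit i = 0ᶜ Vec.[ i ]≔ 1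

sum-0ᶜ : ∀ n → ∣ 0ᶜ {n} ∣ ≡ 0
sum-0ᶜ zero    = refl
sum-0ᶜ (suc n) = sum-0ᶜ n

sum-unit : ∀ {n} (i : Fin n) → ∣ unit i ∣ ≡ 1
sum-unit {suc n} Fin.zero    = cong suc (sum-0ᶜ n)
sum-unit {suc n} (Fin.suc i) = sum-unit i

+ᶜ-identityˡ : ∀ {n} (κ : Comp n) → 0ᶜ +ᶜ κ ≡ κ
+ᶜ-identityˡ []      = refl
+ᶜ-identityˡ (a ∷ κ) = cong (a ∷_) (+ᶜ-identityˡ κ)

unit-last : ∀ {m} (κ : Comp m) a → unit (fromℕ m) +ᶜ (κ ∷ʳ a) ≡ κ ∷ʳ suc a
unit-last []      a = refl
unit-last (b ∷ κ) a = cong (b ∷_) (unit-last κ a)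

infixl 7 _×ᶜ_
_×ᶜ_ : ∀ {n} → ℕ → Comp n → Comp n
zero  ×ᶜ η = 0ᶜ
suc k ×ᶜ η = η +ᶜ k ×ᶜ η

×ᶜ-unit-last : ∀ {m} (κ : Comp m) a → a ×ᶜ unit (fromℕ m) +ᶜ (κ ∷ʳ 0) ≡ κ ∷ʳ a
×ᶜ-unit-last κ zero    = +ᶜ-identityˡ (κ ∷ʳ 0)
×ᶜ-unit-last {m} κ (suc a) = trans (Vecₚ.zipWith-assoc ℕₚ.+-assoc (unit (fromℕ m)) (a ×ᶜ unit (fromℕ m)) (κ ∷ʳ 0))
  (trans (cong (unit (fromℕ m) +ᶜ_) (×ᶜ-unit-last κ a)) (unit-last κ a))

×ᶜ-unit-first : ∀ {m} (κ : Comp m) a → a ×ᶜ unit Fin.zero +ᶜ (0 ∷ κ) ≡ a ∷ κ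
×ᶜ-unit-first κ zero    = +ᶜ-identityˡ (0 ∷ κ)
×ᶜ-unit-first κ (suc a) = trans (Vecₚ.zipWith-assoc ℕₚ.+-assoc (unit Fin.zero) (a ×ᶜ unit Fin.zero) (0 ∷ κ))
  (trans (cong (unit Fin.zero +ᶜ_) (×ᶜ-unit-first κ a)) (cong (suc a ∷_) (+ᶜ-identityˡ κ)))

δ-degree : ∀ {n} {θ κ : Comp n} → ∣ κ ∣ < ∣ θ ∣ → δ θ κ ≃ 0F
δ-degree κ<θ = K.reflexive (δ-≢ λ κ≡θ → ℕₚ.<-irrefl (cong ∣_∣ κ≡θ) κ<θ)

-- Leading terms of products, of `Φ⁺` and of `σ⁺`

record Top {n} (η : Comp n) (P : Poly n) : Set where
  constructor mkTop
  field topCoeff : ∀ θ → ∣ η ∣ ≤ ∣ θ ∣ → coeff P θ ≃ δ θ η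
open Top

-- A functional blind to degrees below that of η sees only the leading monomial. Leading terms of
-- operators are read off by applying this to the pulled-back coefficient functional.
pair-Top : ∀ {n} (φ : Comp n → 𝔽) {η P} → Top η P → (∀ κ → ∣ κ ∣ < ∣ η ∣ → φ κ ≃ 0F) → pair φ P ≃ φ η
pair-Top φ {η} {P} (mkTop top) low = K.trans (pair-ext P (mono η) term) (pair-mono φ η)
  where
  term : ∀ κ → coeff P κ ⊗ φ κ ≃ coeff (mono η) κ ⊗ φ κ
  term κ with ∣ η ∣ ℕ.≤? ∣ κ ∣
  ... | yes η≤κ = K.*-congʳ (K.trans (top κ η≤κ) (K.sym (coeff-mono η κ)))
  ... | no  η≰κ = K.trans (vanish (coeff P κ)) (K.sym (vanish (coeff (mono η) κ)))
    where
    vanish : ∀ c → c ⊗ φ κ ≃ 0F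
    vanish c = K.trans (K.*-congˡ (low κ (ℕₚ.≰⇒> η≰κ))) (K.zeroʳ c)

Top-mono : ∀ {n} (η : Comp n) → Top η (mono η)
Top-mono η = mkTop λ θ _ → coeff-mono η θ

-- `pair-Top` is applied to each factor in turn: to Q with the exponent from P held fixed, then to
-- P.
Top-* : ∀ {n} {η κ : Comp n} {P Q} → Top η P → Top κ Q → Top (η +ᶜ κ) (P *ₚ Q)
Top-* {η = η} {κ} {P} {Q} topP topQ = mkTop λ θ ηκ≤θ →
  let
    φ : Comp _ → 𝔽
    φ μ = pair (λ ν → δ θ (μ +ᶜ ν)) Q
    lower : ∀ μ ν → ∣ μ ∣ ℕ.+ ∣ ν ∣ < ∣ η ∣ ℕ.+ ∣ κ ∣ → ∣ μ +ᶜ ν ∣ < ∣ θ ∣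
    lower μ ν lt = subst (_< ∣ θ ∣) (sym (sum-+ᶜ μ ν)) (ℕₚ.<-≤-trans lt (subst (_≤ ∣ θ ∣) (sum-+ᶜ η κ) ηκ≤θ))
    φ≃ : ∀ μ → ∣ μ ∣ ≤ ∣ η ∣ → φ μ ≃ δ θ (μ +ᶜ κ)
    φ≃ μ μ≤η = pair-Top (λ ν → δ θ (μ +ᶜ ν)) topQ (λ ν ν<κ → δ-degree (lower μ ν (ℕₚ.+-mono-≤-< μ≤η ν<κ)))
  in begin
    coeff (P *ₚ Q) θ         ≈⟨ coeff≃pair (P *ₚ Q) θ ⟩
    pair (δ θ) (P *ₚ Q)      ≈⟨ pair-*ₚ (δ θ) P Q ⟩
    pair φ P                 ≈⟨ pair-Top φ topP (λ μ μ<η → K.trans (φ≃ μ (ℕₚ.<⇒≤ μ<η)) (δ-degree (lower μ κ (ℕₚ.+-monoˡ-< ∣ κ ∣ μ<η)))) ⟩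
    φ η                      ≈⟨ φ≃ η ℕₚ.≤-refl ⟩
    δ θ (η +ᶜ κ)             ∎
  where open ≃-Reasoning

Top-^ : ∀ {n} {η : Comp n} {P} k → Top η P → Top (k ×ᶜ η) (P ^ₚ k)
Top-^ zero    top = Top-mono 0ᶜ
Top-^ (suc k) top = Top-* top (Top-^ k top)

coeff-constP : ∀ {n} c (θ : Comp n) → 0 < ∣ θ ∣ → coeff (constP c) θ ≃ 0F
coeff-constP {n} c θ 0<θ = K.trans (coeff≃pair (constP c) θ)
  (K.trans (K.+-identityʳ _) (K.trans (K.*-congˡ (δ-degree (subst (_< ∣ θ ∣) (sym (sum-0ᶜ n)) 0<θ))) (K.zeroʳ c)))

Top-var+const : ∀ {n} (i : Fin n) c → Top (unit i) (var i +ₚ constP c)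
Top-var+const i c = mkTop λ θ 1≤θ → K.trans (coeff-++ (var i) (constP c) θ)
  (K.trans (K.+-cong (coeff-mono (unit i) θ) (coeff-constP c θ (subst (_≤ ∣ θ ∣) (sum-unit i) 1≤θ))) (K.+-identityʳ _))

Top-Φ⁺mono : ∀ {m} (κ : Comp (suc m)) → Top (ΦC κ) (Φ⁺mono κ)
Top-Φ⁺mono {m} (a ∷ η) = subst (λ ζ → Top ζ (Φ⁺mono (a ∷ η)))
  (trans (cong (e +ᶜ_) (×ᶜ-unit-last η a)) (unit-last η a))
  (Top-* (Top-mono e) (Top-* (Top-^ a (Top-var+const (fromℕ m) 1F)) (Top-mono (η ∷ʳ 0))))
  where
  e : Comp (suc m)
  e = unit (fromℕ m)

sum-ΦC : ∀ {m} (κ : Comp (suc m)) → ∣ ΦC κ ∣ ≡ suc ∣ κ ∣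
sum-ΦC (a ∷ η) = sum-∷ʳ η (suc a)

Top-Φ⁺ : ∀ {m} {η : Comp (suc m)} {G} → Top η G → Top (ΦC η) (Φ⁺ G)
Top-Φ⁺ {η = η} {G} top = mkTop λ θ Φη≤θ → begin
  coeff (Φ⁺ G) θ                            ≈⟨ coeff≃pair (Φ⁺ G) θ ⟩
  pair (δ θ) (Φ⁺ G)                         ≈⟨ pair-Φ⁺ (δ θ) G ⟩
  pair (λ κ → pair (δ θ) (Φ⁺mono κ)) G      ≈⟨ pair-Top (λ κ → pair (δ θ) (Φ⁺mono κ)) top (low θ Φη≤θ) ⟩
  pair (δ θ) (Φ⁺mono η)                     ≈⟨ term θ η Φη≤θ ⟩
  δ θ (ΦC η)                                ∎
  where
  open ≃-Reasoning
  term : ∀ θ κ → ∣ ΦC κ ∣ ≤ ∣ θ ∣ → pair (δ θ) (Φ⁺mono κ) ≃ δ θ (ΦC κ)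
  term θ κ Φκ≤θ = K.trans (K.sym (coeff≃pair (Φ⁺mono κ) θ)) (topCoeff (Top-Φ⁺mono κ) θ Φκ≤θ)
  low : ∀ θ → ∣ ΦC η ∣ ≤ ∣ θ ∣ → ∀ κ → ∣ κ ∣ < ∣ η ∣ → pair (δ θ) (Φ⁺mono κ) ≃ 0F
  low θ Φη≤θ κ κ<η = K.trans (term θ κ (ℕₚ.<⇒≤ Φκ<θ)) (δ-degree Φκ<θ)
    where
    Φκ<θ : ∣ ΦC κ ∣ < ∣ θ ∣
    Φκ<θ = ℕₚ.<-≤-trans (subst₂ _<_ (sym (sum-ΦC κ)) (sym (sum-ΦC η)) (s≤s κ<η)) Φη≤θ

-- ∂_i lowers the degree by one: the new exponents add up to 2a + t, the old ones to 2a + t + 1.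
-- Hence the summand r ∂_i of `σ⁺` leaves the leading term alone.
sum-setAB-window : ∀ {m} (i : Fin m) κ {a t k} → k ≤ t →
  (lookup κ (inject₁ i) ℕ.+ lookup κ (Fin.suc i)) ≡ a ℕ.+ suc (a ℕ.+ t) →
  suc ∣ setAB i κ (a ℕ.+ k) ((a ℕ.+ t) ∸ k) ∣ ≡ ∣ κ ∣
sum-setAB-window i κ {a} {t} {k} k≤t eq = ℕₚ.+-cancelʳ-≡ (a ℕ.+ (a ℕ.+ t)) _ _ (begin
  suc s ℕ.+ (a ℕ.+ (a ℕ.+ t))                   ≡⟨ ℕₚ.+-suc s _ ⟨
  s ℕ.+ suc (a ℕ.+ (a ℕ.+ t))                   ≡⟨ cong (s ℕ.+_) (trans eq (ℕₚ.+-suc a _)) ⟨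
  s ℕ.+ (lookup κ (inject₁ i) ℕ.+ lookup κ (Fin.suc i))   ≡⟨ sum-setAB i κ _ _ ⟩
  ((a ℕ.+ k) ℕ.+ ((a ℕ.+ t) ∸ k)) ℕ.+ ∣ κ ∣     ≡⟨ cong (ℕ._+ ∣ κ ∣) (trans (ℕₚ.+-assoc a k _) (cong (a ℕ.+_) (ℕₚ.m+[n∸m]≡n (ℕₚ.≤-trans k≤t (ℕₚ.m≤n+m t a))))) ⟩
  (a ℕ.+ (a ℕ.+ t)) ℕ.+ ∣ κ ∣                   ≡⟨ ℕₚ.+-comm _ ∣ κ ∣ ⟩
  ∣ κ ∣ ℕ.+ (a ℕ.+ (a ℕ.+ t))                   ∎)
  where
  open ≡.≡-Reasoning
  s = ∣ setAB i κ (a ℕ.+ k) ((a ℕ.+ t) ∸ k) ∣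

sumTo-δ : ∀ {m} (i : Fin m) θ κ a t → ∣ κ ∣ ≤ ∣ θ ∣ →
  (lookup κ (inject₁ i) ℕ.+ lookup κ (Fin.suc i)) ≡ a ℕ.+ suc (a ℕ.+ t) →
  sumTo (λ k → δ θ (setAB i κ (a ℕ.+ k) ((a ℕ.+ t) ∸ k))) (suc t) ≃ 0F
sumTo-δ i θ κ a t κ≤θ eq = K.trans (sumTo-cong (suc t) term) (sumTo-0 (suc t))
  where
  term : ∀ k → k < suc t → δ θ (setAB i κ (a ℕ.+ k) ((a ℕ.+ t) ∸ k)) ≃ 0F
  term k (s≤s k≤t) = δ-degree (subst (_≤ ∣ θ ∣) (sym (sum-setAB-window i κ k≤t eq)) κ≤θ)

∂val-δ : ∀ {m} (i : Fin m) θ κ {a b} (o : ℕ.Ordering a b) → ∣ κ ∣ ≤ ∣ θ ∣ →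
  (lookup κ (inject₁ i) ℕ.+ lookup κ (Fin.suc i)) ≡ a ℕ.+ b → ∂val i (δ θ) κ o ≃ 0F
∂val-δ i θ κ (ℕ.less a t)    κ≤θ eq = sumTo-δ i θ κ a t κ≤θ eq
∂val-δ i θ κ (ℕ.equal _)     κ≤θ eq = K.refl
∂val-δ i θ κ (ℕ.greater b t) κ≤θ eq =
  K.trans (K.-‿cong (sumTo-δ i θ κ b t κ≤θ (trans eq (ℕₚ.+-comm (suc (b ℕ.+ t)) b)))) Kₚ.-0#≈0#

σ* : ∀ {m} → Fin m → (Comp (suc m) → 𝔽) → Comp (suc m) → 𝔽
σ* i φ κ = φ (swapC i κ) ⊕ rF ⊗ ∂* i φ κ

pair-σ⁺ : ∀ {m} (i : Fin m) φ p → pair φ (σ⁺ i p) ≃ pair (σ* i φ) p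
pair-σ⁺ i φ p = begin
  pair φ (sP i p ++ scale rF (∂P i p))                  ≈⟨ pair-++ φ (sP i p) (scale rF (∂P i p)) ⟩
  pair φ (sP i p) ⊕ pair φ (scale rF (∂P i p))          ≈⟨ K.+-cong (K.reflexive (pair-sP i φ p)) (K.trans (pair-scale φ rF (∂P i p)) (K.*-congˡ (pair-∂P i φ p))) ⟩
  pair (φ ∘ swapC i) p ⊕ rF ⊗ pair (∂* i φ) p           ≈⟨ K.+-congˡ (pair-⊗ rF (∂* i φ) p) ⟨
  pair (φ ∘ swapC i) p ⊕ pair (λ κ → rF ⊗ ∂* i φ κ) p   ≈⟨ pair-⊕ (φ ∘ swapC i) (λ κ → rF ⊗ ∂* i φ κ) p ⟨
  pair (σ* i φ) p                                       ∎
  where open ≃-Reasoning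

Top-σ⁺ : ∀ {m} (i : Fin m) {η : Comp (suc m)} {G} → Top η G → Top (swapC i η) (σ⁺ i G)
Top-σ⁺ i {η} {G} top = mkTop λ θ sη≤θ → let η≤θ = subst (_≤ ∣ θ ∣) (sum-swapC i η) sη≤θ in begin
  coeff (σ⁺ i G) θ                  ≈⟨ coeff≃pair (σ⁺ i G) θ ⟩
  pair (δ θ) (σ⁺ i G)               ≈⟨ pair-σ⁺ i (δ θ) G ⟩
  pair (σ* i (δ θ)) G               ≈⟨ pair-Top (σ* i (δ θ)) top (low θ η≤θ) ⟩
  σ* i (δ θ) η                      ≈⟨ term θ η η≤θ ⟩
  δ θ (swapC i η)                   ∎
  where
  open ≃-Reasoning
  term : ∀ θ κ → ∣ κ ∣ ≤ ∣ θ ∣ → σ* i (δ θ) κ ≃ δ θ (swapC i κ)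
  term θ κ κ≤θ = K.trans (K.+-congˡ (K.trans (K.*-congˡ
    (∂val-δ i θ κ (ℕ.compare (lookup κ (inject₁ i)) (lookup κ (Fin.suc i))) κ≤θ refl)) (K.zeroʳ rF))) (K.+-identityʳ _)
  low : ∀ θ → ∣ η ∣ ≤ ∣ θ ∣ → ∀ κ → ∣ κ ∣ < ∣ η ∣ → σ* i (δ θ) κ ≃ 0F
  low θ η≤θ κ κ<η = K.trans (term θ κ (ℕₚ.<⇒≤ κ<θ)) (δ-degree (subst (_< ∣ θ ∣) (sym (sum-swapC i κ)) κ<θ))
    where
    κ<θ : ∣ κ ∣ < ∣ θ ∣
    κ<θ = ℕₚ.<-≤-trans κ<η η≤θ

record Vanishes {n} (s d : ℕ) (P : Poly n) : Set where
  constructor mkVanishes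
  field vanishAt : ∀ γ → ∣ γ ∣ < d → eval P (point s γ) ≃ 0F
open Vanishes

record Star {n} (η : Comp n) (G : Poly n) : Set where
  field
    top       : Top η G
    vanishing : Vanishes 0 ∣ η ∣ G

data SnocView {A : Set} {m} : Vec A (suc m) → Set where
  snoc : (v : Vec A m) (x : A) → SnocView (v ∷ʳ x)

snocView : ∀ {A : Set} {m} (v : Vec A (suc m)) → SnocView v
snocView {m = zero}  (x ∷ [])        = snoc [] x
snocView {m = suc m} (x ∷ v) with snocView v
... | snoc u y = snoc (x ∷ u) y

eval-congˡ : ∀ {m} (p : Poly (suc m)) {x y} (v : Vec 𝔽 m) → x ≃ y → eval p (x ∷ v) ≃ eval p (y ∷ v)
eval-congˡ p v e = pair-cong p λ { (k ∷ κ) → K.*-congʳ (pow-cong k e) }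

coord-0-0 : coord 0 0 ≃ 0F
coord-0-0 = begin
  coord 0 0                       ≡⟨ coord-def 0 0 ⟩
  ⊖ (ℕ→𝔽 0 ⊕ rF ⊗ ℕ→𝔽 0)          ≈⟨ K.-‿cong (K.+-cong ℕ→𝔽-0 (K.*-congˡ ℕ→𝔽-0)) ⟩
  ⊖ (0F ⊕ rF ⊗ 0F)                ≈⟨ K.-‿cong (K.trans (K.+-identityˡ _) (K.zeroʳ rF)) ⟩
  ⊖ 0F                            ≈⟨ Kₚ.-0#≈0# ⟩
  0F                              ∎
  where
  open ≃-Reasoning
  ℕ→𝔽-0 : ℕ→𝔽 0 ≃ 0F
  ℕ→𝔽-0 = ≃-intro 1ᵣ 1ᵣ ≋-refl ≋-refl (*ᵣ-congʳ 1ᵣ 0∷[]≋[])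

Vanishes-Φ⁺ : ∀ {m d} {G : Poly (suc m)} → Vanishes 0 d G → Vanishes 0 (suc d) (Φ⁺ G)
Vanishes-Φ⁺ {d = d} {G} van = mkVanishes λ γ γ<d → main γ γ<d (snocView γ)
  where
  open ≃-Reasoning
  main : ∀ γ → ∣ γ ∣ < suc d → SnocView γ → eval (Φ⁺ G) (point 0 γ) ≃ 0F
  main _ γ<d (snoc v zero) = begin
    eval (Φ⁺ G) (point 0 (v ∷ʳ 0))                   ≡⟨ cong (eval (Φ⁺ G)) (point-∷ʳ0 0 v) ⟩
    eval (Φ⁺ G) (point 1 v ∷ʳ coord 0 0)             ≈⟨ eval-Φ⁺ G (point 1 v) (coord 0 0) ⟩
    coord 0 0 ⊗ eval G ((coord 0 0 ⊕ 1F) ∷ point 1 v)   ≈⟨ K.*-congʳ coord-0-0 ⟩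
    0F ⊗ eval G ((coord 0 0 ⊕ 1F) ∷ point 1 v)       ≈⟨ K.zeroˡ (eval G ((coord 0 0 ⊕ 1F) ∷ point 1 v)) ⟩
    0F                                               ∎
  -- This composition is Φ of `a ∷ v`, whose size is one less; this is why the bound rises from d to
  -- `suc d`.
  main _ γ<d (snoc v (suc a)) = begin
    eval (Φ⁺ G) (point 0 (v ∷ʳ suc a))           ≡⟨ cong (eval (Φ⁺ G)) (point-Φ 0 a v) ⟩
    eval (Φ⁺ G) (pointTail 0 a v ∷ʳ z)           ≈⟨ eval-Φ⁺ G (pointTail 0 a v) z ⟩
    z ⊗ eval G ((z ⊕ 1F) ∷ pointTail 0 a v)      ≈⟨ K.*-congˡ (eval-congˡ G (pointTail 0 a v) (K.sym (coord-suc a (countLe a v)))) ⟩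
    z ⊗ eval G (point 0 (a ∷ v))                 ≈⟨ K.*-congˡ (vanishAt van (a ∷ v) (ℕₚ.≤-pred (subst (_< suc d) (sum-∷ʳ v (suc a)) γ<d))) ⟩
    z ⊗ 0F                                       ≈⟨ K.zeroʳ z ⟩
    0F                                           ∎
    where z = coord (suc a) (countLe a v)

eval-σ⁺ : ∀ {m} (i : Fin m) p v → eval (σ⁺ i p) v ≃ eval p (swapV i v) ⊕ rF ⊗ eval (∂P i p) v
eval-σ⁺ i p v = K.trans (pair-++ (monomial v) (sP i p) (scale rF (∂P i p)))
  (K.+-cong (eval-sP i p v) (pair-scale (monomial v) rF (∂P i p)))

Vanishes-σ⁺ : ∀ {m d} (i : Fin m) {G : Poly (suc m)} → Vanishes 0 d G → Vanishes 0 d (σ⁺ i G)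
Vanishes-σ⁺ {m} {d} i {G} van = mkVanishes main
  where
  main : ∀ γ → ∣ γ ∣ < d → eval (σ⁺ i G) (point 0 γ) ≃ 0F
  main γ γ<d with lookup γ (inject₁ i) ℕ.≟ lookup γ (Fin.suc i)
  ... | yes tie = K.trans (eval-σ⁺ i G v) (Kₚ.+-cancelˡ (x ⊗ D) (eval G (swapV i v) ⊕ rF ⊗ D) 0F (begin
    x ⊗ D ⊕ (eval G (swapV i v) ⊕ rF ⊗ D)     ≈⟨ S.solve 4 (λ x r d e → x S.:* d S.:+ (e S.:+ r S.:* d) S.:= (x S.:+ r) S.:* d S.:+ e) K.refl x rF D (eval G (swapV i v)) ⟩
    (x ⊕ rF) ⊗ D ⊕ eval G (swapV i v)         ≈⟨ K.+-congʳ (K.*-congʳ (point-tie 0 i γ tie)) ⟨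
    lookup v (Fin.suc i) ⊗ D ⊕ eval G (swapV i v)   ≈⟨ eval-∂P i G v ⟨
    x ⊗ D ⊕ eval G v                          ≈⟨ K.+-congˡ (vanishAt van γ γ<d) ⟩
    x ⊗ D ⊕ 0F                                ∎))
    where
    open ≃-Reasoning
    v : Vec 𝔽 (suc m)
    v = point 0 γ
    D = eval (∂P i G) v
    x = lookup v (inject₁ i)
  -- For distinct entries the swapped point is the point of `swapC i γ`, of the same size. So G
  -- vanishes at both, and as x and y differ, ∂_i G vanishes too: each part of `σ⁺` is zero
  -- separately.
  ... | no γᵢ≢ = begin
    eval (σ⁺ i G) v                           ≈⟨ eval-σ⁺ i G v ⟩
    eval G (swapV i v) ⊕ rF ⊗ D               ≈⟨ K.+-cong Gs≃0 (K.*-congˡ D≃0) ⟩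
    0F ⊕ rF ⊗ 0F                              ≈⟨ K.trans (K.+-identityˡ _) (K.zeroʳ rF) ⟩
    0F                                        ∎
    where
    open ≃-Reasoning
    v : Vec 𝔽 (suc m)
    v = point 0 γ
    D = eval (∂P i G) v
    x = lookup v (inject₁ i)
    y = lookup v (Fin.suc i)
    Gs≃0 : eval G (swapV i v) ≃ 0F
    Gs≃0 = K.trans (K.reflexive (cong (eval G) (sym (point-swap 0 i γ γᵢ≢))))
      (vanishAt van (swapC i γ) (subst (_< d) (sym (sum-swapC i γ)) γ<d))
    x≄y : ¬ (x ≃ y)
    x≄y e = γᵢ≢ (coord-injective (lookup (coranks γ) (inject₁ i)) (lookup (coranks γ) (Fin.suc i)) (K.trans (K.reflexive (sym (lookup-point 0 γ (inject₁ i))))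
      (K.trans e (K.reflexive (lookup-point 0 γ (Fin.suc i))))))
    D≃0 : D ≃ 0F
    D≃0 = ≄-⊗-zero x≄y (begin
      x ⊗ D                          ≈⟨ K.+-identityʳ _ ⟨
      x ⊗ D ⊕ 0F                     ≈⟨ K.+-congˡ (vanishAt van γ γ<d) ⟨
      x ⊗ D ⊕ eval G v               ≈⟨ eval-∂P i G v ⟩
      y ⊗ D ⊕ eval G (swapV i v)     ≈⟨ K.+-congˡ Gs≃0 ⟩
      y ⊗ D ⊕ 0F                     ≈⟨ K.+-identityʳ _ ⟩
      y ⊗ D                          ∎)

Star-Φ⁺ : ∀ {m} {η : Comp (suc m)} {G} → Star η G → Star (ΦC η) (Φ⁺ G)
Star-Φ⁺ {η = η} {G} st = record
  { top       = Top-Φ⁺ (Star.top st)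
  ; vanishing = subst (λ d → Vanishes 0 d (Φ⁺ G)) (sym (sum-ΦC η)) (Vanishes-Φ⁺ (Star.vanishing st)) }

Star-σ⁺ : ∀ {m} (i : Fin m) {η : Comp (suc m)} {G} → Star η G → Star (swapC i η) (σ⁺ i G)
Star-σ⁺ i {η} {G} st = record
  { top       = Top-σ⁺ i (Star.top st)
  ; vanishing = subst (λ d → Vanishes 0 d (σ⁺ i G)) (sym (sum-swapC i η)) (Vanishes-σ⁺ i (Star.vanishing st)) }

-- Uniqueness of interpolation

record DegreeBelow {n} (d : ℕ) (P : Poly n) : Set where
  constructor mkDegreeBelow
  field coeffAbove : ∀ θ → d ≤ ∣ θ ∣ → coeff P θ ≃ 0F
open DegreeBelow

pair-agree : ∀ {n} {φ ψ : Comp n → 𝔽} p → (∀ κ → coeff p κ ≃ 0F ⊎ φ κ ≃ ψ κ) → pair φ p ≃ pair ψ p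
pair-agree {φ = φ} {ψ} p e = pair-ext p p term
  where
  term : ∀ κ → coeff p κ ⊗ φ κ ≃ coeff p κ ⊗ ψ κ
  term κ with e κ
  ... | inj₂ φ≃ψ = K.*-congˡ φ≃ψ
  ... | inj₁ c≃0 = K.trans (K.*-congʳ c≃0) (K.trans (K.zeroˡ (φ κ)) (K.sym (K.trans (K.*-congʳ c≃0) (K.zeroˡ (ψ κ)))))

pair-0 : ∀ {n} (p : Poly n) → pair (λ _ → 0F) p ≃ 0F
pair-0 []            = K.refl
pair-0 ((c , κ) ∷ p) = K.trans (⊗0⊕ c _) (pair-0 p)

pair-vanish : ∀ {n} {φ : Comp n → 𝔽} p → (∀ κ → coeff p κ ≃ 0F ⊎ φ κ ≃ 0F) → pair φ p ≃ 0F
pair-vanish p e = K.trans (pair-agree p e) (pair-0 p)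

DegreeBelow-split : ∀ {n d} {p : Poly n} → DegreeBelow (suc d) p → ∀ κ → coeff p κ ≃ 0F ⊎ ∣ κ ∣ ≤ d
DegreeBelow-split {d = d} deg κ with suc d ℕ.≤? ∣ κ ∣
... | yes d<κ = inj₁ (coeffAbove deg κ d<κ)
... | no  d≮κ = inj₂ (ℕₚ.≮⇒≥ d≮κ)

-- Division by x_n − c: p(v, z) = substLast c p (v) + (z − c) · quotient c p (z + 1, v),
-- the quotient being stored in the rotated variables undone by Φ.
substLast : ∀ {m} → 𝔽 → Poly (suc m) → Poly m
substLast c []            = []
substLast c ((a , κ) ∷ p) = (a ⊗ pow c (last κ) , init κ) ∷ substLast c p

-- Represents x^κ (z^b - c^b)/(z - c) through the recursion q_{b+1} = z^b x^κ + c q_b. Here z is the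
-- first variable minus 1, because that slot receives z + 1.
quotientMono : ∀ {m} → 𝔽 → ℕ → Comp m → Poly (suc m)
quotientMono c zero    κ = []
quotientMono c (suc b) κ = (((var Fin.zero +ₚ constP (⊖ 1F)) ^ₚ b) *ₚ mono (0 ∷ κ)) +ₚ scale c (quotientMono c b κ)

quotient : ∀ {m} → 𝔽 → Poly (suc m) → Poly (suc m)
quotient c = List.concatMap λ t → scale (proj₁ t) (quotientMono c (last (proj₂ t)) (init (proj₂ t)))

pair-substLast : ∀ {m} (φ : Comp m → 𝔽) c p → pair φ (substLast c p) ≃ pair (λ κ → pow c (last κ) ⊗ φ (init κ)) p
pair-substLast φ c []            = K.refl
pair-substLast φ c ((a , κ) ∷ p) = K.+-cong (K.*-assoc a _ _) (pair-substLast φ c p)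

pair-quotient : ∀ {m} (φ : Comp (suc m) → 𝔽) c p →
  pair φ (quotient c p) ≃ pair (λ κ → pair φ (quotientMono c (last κ) (init κ))) p
pair-quotient φ c = pair-concatMap φ (λ κ → pair φ (quotientMono c (last κ) (init κ)))
  (λ t → scale (proj₁ t) (quotientMono c (last (proj₂ t)) (init (proj₂ t))))
  (λ a κ → pair-scale φ a (quotientMono c (last κ) (init κ)))

monomial-init-last : ∀ {m} (v : Vec 𝔽 m) z κ → monomial (v ∷ʳ z) κ ≃ pow z (last κ) ⊗ monomial v (init κ)
monomial-init-last v z κ with snocView κ
... | snoc u b rewrite Vecₚ.last-∷ʳ b u | Vecₚ.init-∷ʳ b u = monomial-∷ʳ v z u b

eval-substLast : ∀ {m} c (p : Poly (suc m)) v → eval (substLast c p) v ≃ eval p (v ∷ʳ c)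
eval-substLast c p v = K.trans (pair-substLast (monomial v) c p) (pair-cong p λ κ → K.sym (monomial-init-last v c κ))

eval-quotientMono : ∀ {m} c z (v : Vec 𝔽 m) b κ → let q = eval (quotientMono c b κ) ((z ⊕ 1F) ∷ v) in
  pow z b ⊗ monomial v κ ⊕ c ⊗ q ≃ pow c b ⊗ monomial v κ ⊕ z ⊗ q
eval-quotientMono c z v zero    κ = K.+-congˡ (K.trans (K.zeroʳ c) (K.sym (K.zeroʳ z)))
eval-quotientMono c z v (suc b) κ = begin
  (z ⊗ zᵇ) ⊗ μ ⊕ c ⊗ q′                         ≈⟨ K.+-congˡ (K.*-congˡ q′≃) ⟩
  (z ⊗ zᵇ) ⊗ μ ⊕ c ⊗ (zᵇ ⊗ μ ⊕ c ⊗ q)           ≈⟨ K.+-congˡ (K.*-congˡ (eval-quotientMono c z v b κ)) ⟩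
  (z ⊗ zᵇ) ⊗ μ ⊕ c ⊗ (cᵇ ⊗ μ ⊕ z ⊗ q)           ≈⟨ S.solve 6 (λ z zᵇ c cᵇ μ q → (z S.:* zᵇ) S.:* μ S.:+ c S.:* (cᵇ S.:* μ S.:+ z S.:* q) S.:= (c S.:* cᵇ) S.:* μ S.:+ z S.:* (zᵇ S.:* μ S.:+ c S.:* q)) K.refl z zᵇ c cᵇ μ q ⟩
  (c ⊗ cᵇ) ⊗ μ ⊕ z ⊗ (zᵇ ⊗ μ ⊕ c ⊗ q)           ≈⟨ K.+-congˡ (K.*-congˡ q′≃) ⟨
  (c ⊗ cᵇ) ⊗ μ ⊕ z ⊗ q′                         ∎
  where
  open ≃-Reasoning
  w : Vec 𝔽 _
  w = (z ⊕ 1F) ∷ v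
  x-1 : Poly _
  x-1 = var Fin.zero +ₚ constP (⊖ 1F)
  zᵇ = pow z b
  cᵇ = pow c b
  μ  = monomial v κ
  q  = eval (quotientMono c b κ) w
  q′ = eval (quotientMono c (suc b) κ) w
  x-1≃z : eval x-1 w ≃ z
  x-1≃z = K.trans (eval-var+const Fin.zero (⊖ 1F) w)
    (K.trans (K.+-assoc z 1F (⊖ 1F)) (K.trans (K.+-congˡ (K.-‿inverseʳ 1F)) (K.+-identityʳ z)))
  q′≃ : q′ ≃ zᵇ ⊗ μ ⊕ c ⊗ q
  q′≃ = K.trans (pair-++ (monomial w) ((x-1 ^ₚ b) *ₚ mono (0 ∷ κ)) (scale c (quotientMono c b κ)))
    (K.+-cong
      (K.trans (eval-*ₚ (x-1 ^ₚ b) (mono (0 ∷ κ)) w) (K.*-cong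
        (K.trans (eval-^ₚ x-1 b w) (pow-cong b x-1≃z))
        (K.trans (pair-mono (monomial w) (0 ∷ κ)) (K.*-identityˡ μ))))
      (pair-scale (monomial w) c (quotientMono c b κ)))

-- When `v ∷ʳ z` is the point of Φγ, the vector `(z ⊕ 1F) ∷ v` is the point of γ up to `≃`. Rotated
-- storage thus makes the quotient vanish on ordinary interpolation points, as the induction
-- requires.
eval-division : ∀ {m} c (p : Poly (suc m)) v z → let q = eval (quotient c p) ((z ⊕ 1F) ∷ v) in
  eval p (v ∷ʳ z) ⊕ c ⊗ q ≃ eval (substLast c p) v ⊕ z ⊗ q
eval-division {m} c p v z = begin
  eval p (v ∷ʳ z) ⊕ c ⊗ eval (quotient c p) w              ≈⟨ K.+-congˡ (K.*-congˡ (pair-quotient (monomial w) c p)) ⟩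
  eval p (v ∷ʳ z) ⊕ c ⊗ pair Q p                           ≈⟨ combine c (monomial (v ∷ʳ z)) ⟨
  pair (λ κ → monomial (v ∷ʳ z) κ ⊕ c ⊗ Q κ) p             ≈⟨ pair-cong p (λ κ → K.trans (K.+-congʳ (monomial-init-last v z κ)) (eval-quotientMono c z v (last κ) (init κ))) ⟩
  pair (λ κ → pow c (last κ) ⊗ monomial v (init κ) ⊕ z ⊗ Q κ) p   ≈⟨ combine z (λ κ → pow c (last κ) ⊗ monomial v (init κ)) ⟩
  pair (λ κ → pow c (last κ) ⊗ monomial v (init κ)) p ⊕ z ⊗ pair Q p
    ≈⟨ K.+-cong (pair-substLast (monomial v) c p) (K.*-congˡ (pair-quotient (monomial w) c p)) ⟨
  eval (substLast c p) v ⊕ z ⊗ eval (quotient c p) w       ∎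
  where
  open ≃-Reasoning
  w : Vec 𝔽 (suc m)
  w = (z ⊕ 1F) ∷ v
  Q : Comp (suc m) → 𝔽
  Q κ = eval (quotientMono c (last κ) (init κ)) w
  combine : ∀ x ψ → pair (λ κ → ψ κ ⊕ x ⊗ Q κ) p ≃ pair ψ p ⊕ x ⊗ pair Q p
  combine x ψ = K.trans (pair-⊕ ψ (λ κ → x ⊗ Q κ) p) (K.+-congˡ (pair-⊗ x Q p))

-- Mutual with the leading term: the degree for `suc b` is read off the leading term, whose proof in
-- turn discards c q_b by its degree.
quotientMono-degree : ∀ {m} c b (κ : Comp m) → DegreeBelow (b ℕ.+ ∣ κ ∣) (quotientMono c b κ)
Top-quotientMono : ∀ {m} c b (κ : Comp m) → Top (b ∷ κ) (quotientMono c (suc b) κ)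

quotientMono-degree c zero    κ = mkDegreeBelow λ θ _ → K.refl
quotientMono-degree c (suc b) κ = mkDegreeBelow λ θ bκ<θ →
  K.trans (topCoeff (Top-quotientMono c b κ) θ (ℕₚ.<⇒≤ bκ<θ)) (δ-degree bκ<θ)

Top-quotientMono {m} c b κ = mkTop λ θ bκ≤θ → begin
  coeff (X +ₚ scale c Y) θ              ≈⟨ coeff-++ X (scale c Y) θ ⟩
  coeff X θ ⊕ coeff (scale c Y) θ       ≈⟨ K.+-cong (topCoeff TopX θ bκ≤θ) (K.trans (coeff-scale c Y θ) (K.trans (K.*-congˡ (coeffAbove (quotientMono-degree c b κ) θ bκ≤θ)) (K.zeroʳ c))) ⟩
  δ θ (b ∷ κ) ⊕ 0F                      ≈⟨ K.+-identityʳ _ ⟩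
  δ θ (b ∷ κ)                           ∎
  where
  open ≃-Reasoning
  X Y : Poly (suc m)
  X = ((var Fin.zero +ₚ constP (⊖ 1F)) ^ₚ b) *ₚ mono (0 ∷ κ)
  Y = quotientMono c b κ
  TopX : Top (b ∷ κ) X
  TopX = subst (λ ζ → Top ζ X) (×ᶜ-unit-first κ b) (Top-* (Top-^ b (Top-var+const Fin.zero (⊖ 1F))) (Top-mono (0 ∷ κ)))

δ-iff : ∀ {n m} {θ κ : Comp n} {θ′ κ′ : Comp m} → (κ ≡ θ → κ′ ≡ θ′) → (κ′ ≡ θ′ → κ ≡ θ) → δ θ κ ≡ δ θ′ κ′
δ-iff {θ = θ} {κ} {θ′} {κ′} f g with κ ≟ᶜ θ
... | yes e = sym (δ-≡ (f e))
... | no ¬e = sym (δ-≢ (¬e ∘ g))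

sum-init-last : ∀ {m} (κ : Comp (suc m)) → last κ ℕ.+ ∣ init κ ∣ ≡ ∣ κ ∣
sum-init-last κ with snocView κ
... | snoc u b rewrite Vecₚ.last-∷ʳ b u | Vecₚ.init-∷ʳ b u = sym (sum-∷ʳ u b)

substLast-degree : ∀ {m d} c {p : Poly (suc m)} → DegreeBelow (suc d) p → DegreeBelow (suc d) (substLast c p)
substLast-degree {m} {d} c {p} deg = mkDegreeBelow λ θ d<θ →
  K.trans (coeff≃pair (substLast c p) θ) (K.trans (pair-substLast (δ θ) c p) (pair-vanish p (term θ d<θ)))
  where
  term : ∀ (θ : Comp m) → d < ∣ θ ∣ → ∀ κ → coeff p κ ≃ 0F ⊎ pow c (last κ) ⊗ δ θ (init κ) ≃ 0F
  term θ d<θ κ with DegreeBelow-split deg κ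
  ... | inj₁ z   = inj₁ z
  ... | inj₂ κ≤d = inj₂ (K.trans (K.*-congˡ (δ-degree (ℕₚ.≤-<-trans
      (subst (∣ init κ ∣ ≤_) (sum-init-last κ) (ℕₚ.m≤n+m _ (last κ))) (ℕₚ.≤-<-trans κ≤d d<θ)))) (K.zeroʳ _))

quotient-degree : ∀ {m d} c {p : Poly (suc m)} → DegreeBelow (suc d) p → DegreeBelow d (quotient c p)
quotient-degree {m} {d} c {p} deg = mkDegreeBelow λ θ d≤θ →
  K.trans (coeff≃pair (quotient c p) θ) (K.trans (pair-quotient (δ θ) c p) (pair-vanish p (term θ d≤θ)))
  where
  term : ∀ (θ : Comp (suc m)) → d ≤ ∣ θ ∣ → ∀ κ →
    coeff p κ ≃ 0F ⊎ pair (δ θ) (quotientMono c (last κ) (init κ)) ≃ 0F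
  term θ d≤θ κ with DegreeBelow-split deg κ
  ... | inj₁ z   = inj₁ z
  ... | inj₂ κ≤d = inj₂ (K.trans (K.sym (coeff≃pair (quotientMono c (last κ) (init κ)) θ))
      (coeffAbove (quotientMono-degree c (last κ) (init κ)) θ
        (subst (_≤ ∣ θ ∣) (sym (sum-init-last κ)) (ℕₚ.≤-trans κ≤d d≤θ))))

-- In top degree the substitution x_n = c keeps only the terms free of x_n, since all others fall to
-- a lower degree.
coeff-∷ʳ0 : ∀ {m} c {p : Poly (suc m)} (v : Comp m) → DegreeBelow (suc ∣ v ∣) p →
  coeff p (v ∷ʳ 0) ≃ coeff (substLast c p) v
coeff-∷ʳ0 c {p} v deg = begin
  coeff p (v ∷ʳ 0)                                   ≈⟨ coeff≃pair p (v ∷ʳ 0) ⟩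
  pair (δ (v ∷ʳ 0)) p                                ≈⟨ pair-agree p (λ κ → term κ (snocView κ)) ⟩
  pair (λ κ → pow c (last κ) ⊗ δ v (init κ)) p       ≈⟨ pair-substLast (δ v) c p ⟨
  pair (δ v) (substLast c p)                         ≈⟨ coeff≃pair (substLast c p) v ⟨
  coeff (substLast c p) v                            ∎
  where
  open ≃-Reasoning
  term : ∀ κ → SnocView κ → coeff p κ ≃ 0F ⊎ δ (v ∷ʳ 0) κ ≃ pow c (last κ) ⊗ δ v (init κ)
  term _ (snoc u b) with DegreeBelow-split deg (u ∷ʳ b) | u ≟ᶜ v
  ... | inj₁ z   | _ = inj₁ z
  ... | inj₂ κ≤v | no u≢v rewrite Vecₚ.last-∷ʳ b u | Vecₚ.init-∷ʳ b u = inj₂ (begin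
    δ (v ∷ʳ 0) (u ∷ʳ b)   ≡⟨ δ-≢ (u≢v ∘ Vecₚ.∷ʳ-injectiveˡ u v) ⟩
    0F                    ≈⟨ K.zeroʳ (pow c b) ⟨
    pow c b ⊗ 0F          ≡⟨ cong (pow c b ⊗_) (δ-≢ u≢v) ⟨
    pow c b ⊗ δ v u       ∎)
  ... | inj₂ κ≤v | yes refl rewrite Vecₚ.last-∷ʳ b u | Vecₚ.init-∷ʳ b u
    with b≡0 ← ℕₚ.n≤0⇒n≡0 (ℕₚ.+-cancelʳ-≤ ∣ u ∣ b 0 (subst (_≤ ∣ u ∣) (sum-∷ʳ u b) κ≤v)) = inj₂ (begin
    δ (u ∷ʳ 0) (u ∷ʳ b)   ≡⟨ δ-≡ (cong (u ∷ʳ_) b≡0) ⟩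
    1F                    ≈⟨ K.*-identityˡ 1F ⟨
    1F ⊗ 1F               ≡⟨ cong₂ (λ k x → pow c k ⊗ x) b≡0 (δ-≡ {θ = u} refl) ⟨
    pow c b ⊗ δ u u       ∎)

-- In top degree, division by x_n - c just lowers the exponent of x_n by one and rotates it to the
-- front. Together with `coeff-∷ʳ0` this reaches every exponent of top degree.
coeff-∷ʳsuc : ∀ {m} c {p : Poly (suc m)} (v : Comp m) a → DegreeBelow (suc (suc (a ℕ.+ ∣ v ∣))) p →
  coeff p (v ∷ʳ suc a) ≃ coeff (quotient c p) (a ∷ v)
coeff-∷ʳsuc c {p} v a deg = begin
  coeff p (v ∷ʳ suc a)                               ≈⟨ coeff≃pair p (v ∷ʳ suc a) ⟩
  pair (δ (v ∷ʳ suc a)) p                            ≈⟨ pair-agree p (λ κ → term κ (snocView κ)) ⟩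
  pair (λ κ → pair (δ (a ∷ v)) (quotientMono c (last κ) (init κ))) p   ≈⟨ pair-quotient (δ (a ∷ v)) c p ⟨
  pair (δ (a ∷ v)) (quotient c p)                    ≈⟨ coeff≃pair (quotient c p) (a ∷ v) ⟨
  coeff (quotient c p) (a ∷ v)                       ∎
  where
  open ≃-Reasoning
  term : ∀ κ → SnocView κ →
    coeff p κ ≃ 0F ⊎ δ (v ∷ʳ suc a) κ ≃ pair (δ (a ∷ v)) (quotientMono c (last κ) (init κ))
  term _ (snoc u zero) rewrite Vecₚ.last-∷ʳ 0 u =
    inj₂ (K.reflexive (δ-≢ λ e → ℕₚ.0≢1+n (Vecₚ.∷ʳ-injectiveʳ u v e)))
  term _ (snoc u (suc b)) with DegreeBelow-split deg (u ∷ʳ suc b)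
  ... | inj₁ z = inj₁ z
  ... | inj₂ κ≤ rewrite Vecₚ.last-∷ʳ (suc b) u | Vecₚ.init-∷ʳ (suc b) u = inj₂ (begin
    δ (v ∷ʳ suc a) (u ∷ʳ suc b)                        ≡⟨ δ-iff to from ⟩
    δ (a ∷ v) (b ∷ u)                                  ≈⟨ topCoeff (Top-quotientMono c b u) (a ∷ v) (ℕₚ.≤-pred (subst (_≤ suc (a ℕ.+ ∣ v ∣)) (sum-∷ʳ u (suc b)) κ≤)) ⟨
    coeff (quotientMono c (suc b) u) (a ∷ v)           ≈⟨ coeff≃pair (quotientMono c (suc b) u) (a ∷ v) ⟩
    pair (δ (a ∷ v)) (quotientMono c (suc b) u)        ∎)
    where
    to : u ∷ʳ suc b ≡ v ∷ʳ suc a → b ∷ u ≡ a ∷ v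
    to e = cong₂ _∷_ (ℕₚ.suc-injective (Vecₚ.∷ʳ-injectiveʳ u v e)) (Vecₚ.∷ʳ-injectiveˡ u v e)
    from : b ∷ u ≡ a ∷ v → u ∷ʳ suc b ≡ v ∷ʳ suc a
    from refl = refl

-- Interpolation is unique.  On x_n = c, the last coordinate of every point
-- (γ , 0), one variable drops out; the quotient by x_n − c vanishes at the
-- remaining points Φ γ, so it has the same property in degree one less.
≃0-of-Vanishes : ∀ n s d (p : Poly n) → DegreeBelow d p → Vanishes s d p → ∀ κ → coeff p κ ≃ 0F
≃0-of-Vanishes n       s zero    p deg van κ  = coeffAbove deg κ z≤n
≃0-of-Vanishes zero    s (suc d) p deg van [] = begin
  coeff p []          ≈⟨ coeff≃pair p [] ⟩
  pair (δ []) p       ≈⟨ pair-cong p (λ { [] → K.refl }) ⟩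
  eval p []           ≈⟨ vanishAt van [] (s≤s z≤n) ⟩
  0F                  ∎
  where open ≃-Reasoning
-- It is enough that the coefficients in degree d vanish: `p` then has degree below d, and the
-- hypothesis for d applies to it. They are read off the restriction and the quotient, both zero by
-- induction.
≃0-of-Vanishes (suc n) s (suc d) p deg van = ≃0-of-Vanishes (suc n) s d p
  (mkDegreeBelow λ κ d≤κ → low κ d≤κ (snocView κ))
  (mkVanishes λ γ γ<d → vanishAt van γ (ℕₚ.m≤n⇒m≤1+n γ<d))
  where
  open ≃-Reasoning
  c : 𝔽
  c = coord 0 (s ℕ.+ 0)
  rest≃0 : ∀ κ → coeff (substLast c p) κ ≃ 0F
  rest≃0 = ≃0-of-Vanishes n (suc s) (suc d) (substLast c p) (substLast-degree c deg) (mkVanishes λ γ γ≤d → begin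
    eval (substLast c p) (point (suc s) γ)   ≈⟨ eval-substLast c p (point (suc s) γ) ⟩
    eval p (point (suc s) γ ∷ʳ c)            ≡⟨ cong (eval p) (point-∷ʳ0 s γ) ⟨
    eval p (point s (γ ∷ʳ 0))                ≈⟨ vanishAt van (γ ∷ʳ 0) (subst (_< suc d) (sym (sum-∷ʳ γ 0)) γ≤d) ⟩
    0F                                       ∎)
  quotient-vanishes : ∀ γ → ∣ γ ∣ < d → eval (quotient c p) (point s γ) ≃ 0F
  quotient-vanishes (a ∷ γ) aγ<d = begin
    eval (quotient c p) (point s (a ∷ γ))          ≈⟨ eval-congˡ (quotient c p) v (coord-suc a k) ⟩
    -- At the point of Φ(a ∷ γ) both `p` and the restriction vanish, so division leaves c q = z q.
    -- Here c and z differ since their integer parts come from 0 and `suc a`.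
    eval (quotient c p) ((z ⊕ 1F) ∷ v)             ≈⟨ ≄-⊗-zero c≄z (begin
      c ⊗ q                                 ≈⟨ K.+-identityˡ _ ⟨
      0F ⊕ c ⊗ q                            ≈⟨ K.+-congʳ p≃0 ⟨
      eval p (v ∷ʳ z) ⊕ c ⊗ q               ≈⟨ eval-division c p v z ⟩
      eval (substLast c p) v ⊕ z ⊗ q        ≈⟨ K.+-congʳ (pair-resp (monomial v) (substLast c p) [] rest≃0) ⟩
      0F ⊕ z ⊗ q                            ≈⟨ K.+-identityˡ _ ⟩
      z ⊗ q                                 ∎) ⟩
    0F                                             ∎
    where
    k : ℕ
    k = s ℕ.+ countLe a γ
    z q : 𝔽
    v : Vec 𝔽 n
    z = coord (suc a) k
    v = pointTail s a γ
    q = eval (quotient c p) ((z ⊕ 1F) ∷ v)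
    c≄z : ¬ (c ≃ z)
    c≄z e = ℕₚ.0≢1+n (coord-injective (s ℕ.+ 0) k e)
    p≃0 : eval p (v ∷ʳ z) ≃ 0F
    p≃0 = K.trans (K.reflexive (cong (eval p) (sym (point-Φ s a γ))))
      (vanishAt van (γ ∷ʳ suc a) (subst (_< suc d) (sym (sum-∷ʳ γ (suc a))) (s≤s aγ<d)))
  quotient≃0 : ∀ κ → coeff (quotient c p) κ ≃ 0F
  quotient≃0 = ≃0-of-Vanishes (suc n) s d (quotient c p) (quotient-degree c deg) (mkVanishes quotient-vanishes)
  below : ∀ {e} → d ≤ e → DegreeBelow (suc e) p
  below d≤e = mkDegreeBelow λ θ e<θ → coeffAbove deg θ (ℕₚ.≤-trans (s≤s d≤e) e<θ)
  low : ∀ κ → d ≤ ∣ κ ∣ → SnocView κ → coeff p κ ≃ 0F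
  low _ d≤κ (snoc v zero)    = K.trans (coeff-∷ʳ0 c v (below (subst (d ≤_) (sum-∷ʳ v 0) d≤κ))) (rest≃0 v)
  low _ d≤κ (snoc v (suc a)) = K.trans (coeff-∷ʳsuc c v a (below (subst (d ≤_) (sum-∷ʳ v (suc a)) d≤κ))) (quotient≃0 (a ∷ v))

-- The operator Ξ

minusOne² : ⊖ 1F ⊗ ⊖ 1F ≃ 1F
minusOne² = K.trans (Kₚ.-1*x≈-x (⊖ 1F)) (Kₚ.-‿involutive 1F)

sgn≡pow : ∀ k → sgn k ≡ pow (⊖ 1F) k
sgn≡pow k = trans (^F≡pow (-F 1F) k) (cong (λ x → pow x k) (-F≡⊖ 1F))

sgn² : ∀ k → sgn k ⊗ sgn k ≃ 1F
sgn² k rewrite sgn≡pow k = go k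
  where
  go : ∀ k → pow (⊖ 1F) k ⊗ pow (⊖ 1F) k ≃ 1F
  go zero    = K.*-identityˡ 1F
  go (suc k) = K.trans (⊗-interchange (⊖ 1F) _ (⊖ 1F) _) (K.trans (K.*-cong minusOne² (go k)) (K.*-identityˡ 1F))

sgn-+ : ∀ a b → sgn (a ℕ.+ b) ≃ sgn a ⊗ sgn b
sgn-+ a b rewrite sgn≡pow (a ℕ.+ b) | sgn≡pow a | sgn≡pow b = pow-+ (⊖ 1F) a b

pow-⊖ : ∀ x k → pow (⊖ x) k ≃ sgn k ⊗ pow x k
pow-⊖ x k rewrite sgn≡pow k = go k
  where
  go : ∀ k → pow (⊖ x) k ≃ pow (⊖ 1F) k ⊗ pow x k
  go zero    = K.sym (K.*-identityˡ 1F)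
  go (suc k) = K.trans (K.*-cong (K.sym (Kₚ.-1*x≈-x x)) (go k)) (⊗-interchange (⊖ 1F) x _ _)

monomial-⊖ : ∀ {n} (v : Vec 𝔽 n) κ → monomial (Vec.map ⊖_ v) κ ≃ sgn ∣ κ ∣ ⊗ monomial v κ
monomial-⊖ []      []      = K.sym (K.*-identityˡ 1F)
monomial-⊖ (x ∷ v) (k ∷ κ) = K.trans (K.*-cong (pow-⊖ x k) (monomial-⊖ v κ))
  (K.trans (⊗-interchange (sgn k) _ _ _) (K.*-congʳ (K.sym (sgn-+ k ∣ κ ∣))))

pair-negArg : ∀ {n} (φ : Comp n → 𝔽) p → pair φ (negArg p) ≃ pair (λ κ → sgn ∣ κ ∣ ⊗ φ κ) p
pair-negArg φ []            = K.refl
pair-negArg φ ((c , κ) ∷ p) = K.+-cong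
  (K.trans (K.*-congʳ (K.trans (K.reflexive (*F≡⊗ (sgn ∣ κ ∣) c)) (K.*-comm (sgn ∣ κ ∣) c))) (K.*-assoc c (sgn ∣ κ ∣) (φ κ)))
  (pair-negArg φ p)

eval-negArg : ∀ {n} (p : Poly n) v → eval (negArg p) (Vec.map ⊖_ v) ≃ eval p v
eval-negArg p v = K.trans (pair-negArg (monomial (Vec.map ⊖_ v)) p) (pair-cong p λ κ → begin
  sgn ∣ κ ∣ ⊗ monomial (Vec.map ⊖_ v) κ          ≈⟨ K.*-congˡ (monomial-⊖ v κ) ⟩
  sgn ∣ κ ∣ ⊗ (sgn ∣ κ ∣ ⊗ monomial v κ)         ≈⟨ K.*-assoc (sgn ∣ κ ∣) (sgn ∣ κ ∣) (monomial v κ) ⟨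
  (sgn ∣ κ ∣ ⊗ sgn ∣ κ ∣) ⊗ monomial v κ         ≈⟨ K.*-congʳ (sgn² ∣ κ ∣) ⟩
  1F ⊗ monomial v κ                              ≈⟨ K.*-identityˡ (monomial v κ) ⟩
  monomial v κ                                   ∎)
  where open ≃-Reasoning

coeff-negArg : ∀ {n} (p : Poly n) θ → coeff (negArg p) θ ≃ sgn ∣ θ ∣ ⊗ coeff p θ
coeff-negArg p θ = begin
  coeff (negArg p) θ                       ≈⟨ coeff≃pair (negArg p) θ ⟩
  pair (δ θ) (negArg p)                    ≈⟨ pair-negArg (δ θ) p ⟩
  pair (λ κ → sgn ∣ κ ∣ ⊗ δ θ κ) p         ≈⟨ pair-cong p term ⟩
  pair (λ κ → sgn ∣ θ ∣ ⊗ δ θ κ) p         ≈⟨ pair-⊗ (sgn ∣ θ ∣) (δ θ) p ⟩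
  sgn ∣ θ ∣ ⊗ pair (δ θ) p                 ≈⟨ K.*-congˡ (coeff≃pair p θ) ⟨
  sgn ∣ θ ∣ ⊗ coeff p θ                    ∎
  where
  open ≃-Reasoning
  term : ∀ κ → sgn ∣ κ ∣ ⊗ δ θ κ ≃ sgn ∣ θ ∣ ⊗ δ θ κ
  term κ with κ ≟ᶜ θ
  ... | yes refl = K.refl
  ... | no _     = K.trans (K.zeroʳ (sgn ∣ κ ∣)) (K.sym (K.zeroʳ (sgn ∣ θ ∣)))

-- Homogeneous components

coeff-∷-≡ : ∀ {n} c (θ : Comp n) {p q : Poly n} → coeff p θ ≡ coeff q θ → coeff ((c , θ) ∷ p) θ ≡ coeff ((c , θ) ∷ q) θ
coeff-∷-≡ c θ e with θ ≟ᶜ θ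
... | yes _ = cong (c +F_) e
... | no _  = e

coeff-∷-≢ : ∀ {n} c (θ κ : Comp n) (p : Poly n) → θ ≢ κ → coeff ((c , θ) ∷ p) κ ≡ coeff p κ
coeff-∷-≢ c θ κ p θ≢κ with θ ≟ᶜ κ
... | yes e = ⊥-elim (θ≢κ e)
... | no _  = refl

homog-accept : ∀ {n} d c (θ : Comp n) (p : Poly n) → ∣ θ ∣ ≡ d → homog d ((c , θ) ∷ p) ≡ (c , θ) ∷ homog d p
homog-accept d c θ p eq = Listₚ.filter-accept (λ t → ∣ proj₂ t ∣ ℕ.≟ d) {x = c , θ} {p} eq

homog-reject : ∀ {n} d c (θ : Comp n) (p : Poly n) → ∣ θ ∣ ≢ d → homog d ((c , θ) ∷ p) ≡ homog d p
homog-reject d c θ p neq = Listₚ.filter-reject (λ t → ∣ proj₂ t ∣ ℕ.≟ d) {x = c , θ} {p} neq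

coeff-homog-≡ : ∀ {n} d (p : Poly n) κ → ∣ κ ∣ ≡ d → coeff (homog d p) κ ≡ coeff p κ
coeff-homog-≡ d []            κ κ≡d = refl
coeff-homog-≡ d ((c , θ) ∷ p) κ κ≡d = by-cases (θ ≟ᶜ κ) (∣ θ ∣ ℕ.≟ d)
  where
  IH : coeff (homog d p) κ ≡ coeff p κ
  IH = coeff-homog-≡ d p κ κ≡d
  by-cases : Dec (θ ≡ κ) → Dec (∣ θ ∣ ≡ d) → coeff (homog d ((c , θ) ∷ p)) κ ≡ coeff ((c , θ) ∷ p) κ
  by-cases (yes refl) (no θ≢d)  = ⊥-elim (θ≢d κ≡d)
  by-cases (yes refl) (yes θ≡d) = trans (cong (λ q → coeff q κ) (homog-accept d c θ p θ≡d)) (coeff-∷-≡ c θ IH)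
  by-cases (no θ≢κ)   (yes θ≡d) = trans (cong (λ q → coeff q κ) (homog-accept d c θ p θ≡d))
    (trans (coeff-∷-≢ c θ κ (homog d p) θ≢κ) (trans IH (sym (coeff-∷-≢ c θ κ p θ≢κ))))
  by-cases (no θ≢κ)   (no θ≢d)  = trans (cong (λ q → coeff q κ) (homog-reject d c θ p θ≢d))
    (trans IH (sym (coeff-∷-≢ c θ κ p θ≢κ)))

coeff-homog-≢ : ∀ {n} d (p : Poly n) κ → ∣ κ ∣ ≢ d → coeff (homog d p) κ ≡ 0F
coeff-homog-≢ d []            κ κ≢d = refl
coeff-homog-≢ d ((c , θ) ∷ p) κ κ≢d = by-cases (∣ θ ∣ ℕ.≟ d)
  where
  by-cases : Dec (∣ θ ∣ ≡ d) → coeff (homog d ((c , θ) ∷ p)) κ ≡ 0F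
  by-cases (no θ≢d)  = trans (cong (λ q → coeff q κ) (homog-reject d c θ p θ≢d)) (coeff-homog-≢ d p κ κ≢d)
  by-cases (yes θ≡d) = trans (cong (λ q → coeff q κ) (homog-accept d c θ p θ≡d))
    (trans (coeff-∷-≢ c θ κ (homog d p) (λ θ≡κ → κ≢d (trans (cong ∣_∣ (sym θ≡κ)) θ≡d))) (coeff-homog-≢ d p κ κ≢d))

homog-add : ∀ {n} d c (p q : Poly n) → homog d (scale c p ++ q) ≃ₚ scale c (homog d p) ++ homog d q
homog-add d c p q κ = K.trans (by-degree (∣ κ ∣ ℕ.≟ d))
  (K.sym (K.trans (coeff-++ (scale c (homog d p)) (homog d q) κ) (K.+-congʳ (coeff-scale c (homog d p) κ))))
  where
  by-degree : Dec (∣ κ ∣ ≡ d) → coeff (homog d (scale c p ++ q)) κ ≃ c ⊗ coeff (homog d p) κ ⊕ coeff (homog d q) κ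
  by-degree (yes eq) rewrite coeff-homog-≡ d (scale c p ++ q) κ eq | coeff-homog-≡ d p κ eq | coeff-homog-≡ d q κ eq =
    K.trans (coeff-++ (scale c p) q κ) (K.+-congʳ (coeff-scale c p κ))
  by-degree (no neq) rewrite coeff-homog-≢ d (scale c p ++ q) κ neq | coeff-homog-≢ d p κ neq | coeff-homog-≢ d q κ neq =
    K.sym (⊗0⊕ c 0F)

-- Taking top components of G + q = 0: the one of G is x^η alone, because its other terms have lower
-- degree.
homog-corrected : ∀ {n} {η : Comp n} {G} q → Star η G → (∀ θ → coeff G θ ⊕ coeff q θ ≃ 0F) →
  ∀ θ → Dec (∣ θ ∣ ≡ ∣ η ∣) → coeff (mono η ++ homog ∣ η ∣ q) θ ≃ 0F
homog-corrected {η = η} {G} q st G+q≃0 θ (yes eq) = begin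
  coeff (mono η ++ homog ∣ η ∣ q) θ              ≈⟨ coeff-++ (mono η) (homog ∣ η ∣ q) θ ⟩
  coeff (mono η) θ ⊕ coeff (homog ∣ η ∣ q) θ     ≈⟨ K.+-cong (coeff-mono η θ) (K.reflexive (coeff-homog-≡ ∣ η ∣ q θ eq)) ⟩
  δ θ η ⊕ coeff q θ                              ≈⟨ K.+-congʳ (topCoeff (Star.top st) θ (ℕₚ.≤-reflexive (sym eq))) ⟨
  coeff G θ ⊕ coeff q θ                          ≈⟨ G+q≃0 θ ⟩
  0F                                             ∎
  where open ≃-Reasoning
homog-corrected {η = η} {G} q st G+q≃0 θ (no neq) = begin
  coeff (mono η ++ homog ∣ η ∣ q) θ              ≈⟨ coeff-++ (mono η) (homog ∣ η ∣ q) θ ⟩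
  coeff (mono η) θ ⊕ coeff (homog ∣ η ∣ q) θ     ≈⟨ K.+-cong (coeff-mono η θ) (K.reflexive (coeff-homog-≢ ∣ η ∣ q θ neq)) ⟩
  δ θ η ⊕ 0F                                     ≈⟨ K.+-identityʳ (δ θ η) ⟩
  δ θ η                                          ≡⟨ δ-≢ (λ e → neq (cong ∣_∣ (sym e))) ⟩
  0F                                             ∎
  where open ≃-Reasoning

-- Nonvanishing of d_η

-- Over the denominator r the factor is (a+1) + (l+1) r, whose constant term a+1 is nonzero.
factor-nonZero : ∀ a l → ¬ (αF *F ℕ→𝔽 (suc a) +F ℕ→𝔽 (suc l) ≃ 0F)
factor-nonZero a l (mk≃ e) = ℕₚ.1+n≢0 (ℚ-injective (suc a) 0 (begin
  + suc a ℚ./ 1                                 ≡⟨ simplify (+ suc a ℚ./ 1) (+ suc l ℚ./ 1) ⟨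
  (1ℚ ℚ.* (+ suc a ℚ./ 1)) ℚ.* 1ℚ ℚ.+ (+ suc l ℚ./ 1) ℚ.* 0ℚ
    ≡⟨ cong₂ ℚ._+_ (trans (rcoef-0-* (num y) 1ᵣ) (cong (ℚ._* 1ℚ) (rcoef-0-* 1ᵣ ((+ suc a ℚ./ 1) ∷ []))))
                   (trans (rcoef-0-* ((+ suc l ℚ./ 1) ∷ []) (den′ y)) (cong ((+ suc l ℚ./ 1) ℚ.*_) (rcoef-0-* (0ℚ ∷ 1ℚ ∷ []) 1ᵣ))) ⟨
  rcoef 0 (num y *ᵣ 1ᵣ) ℚ.+ rcoef 0 (((+ suc l ℚ./ 1) ∷ []) *ᵣ den′ y)
    ≡⟨ rcoef-+ᵣ (num y *ᵣ 1ᵣ) (((+ suc l ℚ./ 1) ∷ []) *ᵣ den′ y) 0 ⟨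
  rcoef 0 (num x)                               ≡⟨ ℚₚ.*-identityʳ (rcoef 0 (num x)) ⟨
  rcoef 0 (num x) ℚ.* 1ℚ                        ≡⟨ rcoef-0-* (num x) 1ᵣ ⟨
  rcoef 0 (num x *ᵣ 1ᵣ)                         ≡⟨ e 0 ⟩
  0ℚ                                            ∎))
  where
  open ≡.≡-Reasoning
  x y : 𝔽
  y = αF *F ℕ→𝔽 (suc a)
  x = y +F ℕ→𝔽 (suc l)
  simplify : ∀ p q → (1ℚ ℚ.* p) ℚ.* 1ℚ ℚ.+ q ℚ.* 0ℚ ≡ p
  simplify p q = trans (cong₂ ℚ._+_ (trans (ℚₚ.*-identityʳ (1ℚ ℚ.* p)) (ℚₚ.*-identityˡ p)) (ℚₚ.*-zeroʳ q)) (ℚₚ.+-identityʳ p)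

prodF-nonZero : ∀ {xs} → All (λ x → ¬ (x ≃ 0F)) xs → ¬ (prodF xs ≃ 0F)
prodF-nonZero []           e = 1≄0 e
prodF-nonZero {x ∷ xs} (x≄0 ∷ all) e =
  x≄0 (⊗-zero-cancel (prodF-nonZero all) (K.trans (K.reflexive (sym (*F≡⊗ x (prodF xs)))) e))

dη-nonZero : ∀ {n} (η : Comp n) → ¬ (dη η ≃ 0F)
dη-nonZero {n} η = prodF-nonZero (Allₚ.concat⁺ (Allₚ.map⁺ (All.universal
  (λ i → Allₚ.map⁺ (All.universal (λ j → factor-nonZero (arm η i (suc j)) (leg η i (suc j))) (List.upTo (lookup η i))))
  (List.allFin n))))

-- Compositions of a given size

-- A crude superset of the compositions of size at most d, obtained by bounding each entry
-- separately; `compositions` filters it.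
bounded : ∀ n → ℕ → List (Comp n)
bounded zero    d = [] ∷ []
bounded (suc n) d = List.concatMap (λ a → List.map (a ∷_) (bounded n d)) (List.upTo (suc d))

∈-bounded : ∀ {n d} (γ : Comp n) → ∣ γ ∣ ≤ d → γ ∈ bounded n d
∈-bounded []      _   = here refl
∈-bounded {suc n} {d} (a ∷ γ) γ≤d = ∈-concatMap⁺ (λ a → List.map (a ∷_) (bounded n d))
  (Any.map (λ { refl → ∈-map⁺ (a ∷_) (∈-bounded γ (ℕₚ.≤-trans (ℕₚ.m≤n+m _ a) γ≤d)) })
    (∈-upTo⁺ (s≤s (ℕₚ.≤-trans (ℕₚ.m≤m+n a _) γ≤d))))

compositions : ∀ n → ℕ → List (Comp n)
compositions n d = List.filter (λ γ → ∣ γ ∣ ℕ.≟ d) (bounded n d)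

∈-compositions : ∀ {n} (γ : Comp n) → γ ∈ compositions n ∣ γ ∣
∈-compositions γ = ∈-filter⁺ (λ γ′ → ∣ γ′ ∣ ℕ.≟ ∣ γ ∣) (∈-bounded γ ℕₚ.≤-refl) refl

-- Interpolation with prescribed leading term

module Interpolation {n} (E : Comp n → Poly n) (interp : ∀ η → IsInterp η (E η)) where

  -- This is F_η^{rδ} without the factor d_η. It vanishes where -γ̄ replaces γ̄, and the sign in
  -- front restores the top component of `E η`.
  E⁻ : Comp n → Poly n
  E⁻ η = scale (sgn ∣ η ∣) (negArg (E η))

  coeff-E⁻ : ∀ η θ → coeff (E⁻ η) θ ≃ (sgn ∣ η ∣ ⊗ sgn ∣ θ ∣) ⊗ coeff (E η) θ
  coeff-E⁻ η θ = K.trans (coeff-scale (sgn ∣ η ∣) (negArg (E η)) θ)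
    (K.trans (K.*-congˡ (coeff-negArg (E η) θ)) (K.sym (K.*-assoc (sgn ∣ η ∣) (sgn ∣ θ ∣) _)))

  coeff-E⁻-top : ∀ η θ → ∣ θ ∣ ≡ ∣ η ∣ → coeff (E⁻ η) θ ≃ coeff (E η) θ
  coeff-E⁻-top η θ eq = K.trans (coeff-E⁻ η θ) (K.trans (K.*-congʳ
    (K.trans (K.reflexive (cong (λ k → sgn ∣ η ∣ ⊗ sgn k) eq)) (sgn² ∣ η ∣))) (K.*-identityˡ _))

  E⁻-degree : ∀ η → DegreeBelow (suc ∣ η ∣) (E⁻ η)
  E⁻-degree η = mkDegreeBelow λ θ η<θ → K.trans (coeff-E⁻ η θ)
    (K.trans (K.*-congˡ (mk≃ (IsInterp.degree (interp η) θ η<θ))) (K.zeroʳ _))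

  E⁻-vanishing : ∀ η γ → γ ≢ η → ∣ γ ∣ ≤ ∣ η ∣ → eval (E⁻ η) (point 0 γ) ≃ 0F
  E⁻-vanishing η γ γ≢η γ≤η = begin
    eval (E⁻ η) (point 0 γ)                              ≈⟨ pair-scale (monomial (point 0 γ)) (sgn ∣ η ∣) (negArg (E η)) ⟩
    sgn ∣ η ∣ ⊗ eval (negArg (E η)) (point 0 γ)          ≡⟨ cong (λ v → sgn ∣ η ∣ ⊗ eval (negArg (E η)) v) (map-⊖-bar γ) ⟨
    sgn ∣ η ∣ ⊗ eval (negArg (E η)) (Vec.map ⊖_ (bar γ)) ≈⟨ K.*-congˡ (eval-negArg (E η) (bar γ)) ⟩
    sgn ∣ η ∣ ⊗ eval (E η) (bar γ)                       ≡⟨ cong (sgn ∣ η ∣ ⊗_) (evalP≡eval (E η) (bar γ)) ⟨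
    sgn ∣ η ∣ ⊗ evalP (E η) (bar γ)                      ≈⟨ K.*-congˡ (mk≃ (IsInterp.vanishing (interp η) γ γ≢η γ≤η)) ⟩
    sgn ∣ η ∣ ⊗ 0F                                       ≈⟨ K.zeroʳ (sgn ∣ η ∣) ⟩
    0F                                                   ∎
    where open ≃-Reasoning

  -- Otherwise `E⁻ η` would vanish at -γ̄ for all γ of size at most that of η and be zero by
  -- uniqueness, against its coefficient 1 on x^η.
  E⁻-nonZero : ∀ η → ¬ (eval (E⁻ η) (point 0 η) ≃ 0F)
  E⁻-nonZero η e = 1≄0 (K.trans (K.sym (mk≃ (IsInterp.leading (interp η))))
    (K.trans (K.sym (coeff-E⁻-top η η refl))
      (≃0-of-Vanishes n 0 (suc ∣ η ∣) (E⁻ η) (E⁻-degree η) (mkVanishes van) η)))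
    where
    van : ∀ γ → ∣ γ ∣ < suc ∣ η ∣ → eval (E⁻ η) (point 0 γ) ≃ 0F
    van γ (s≤s γ≤η) with γ ≟ᶜ η
    ... | yes refl = e
    ... | no γ≢η   = E⁻-vanishing η γ γ≢η γ≤η

  -- Linear combinations are given by their construction rather than by coefficients, so that
  -- degree, vanishing and the action of `Ξ` each follow by induction on it.
  data Span (d : ℕ) : Poly n → Set where
    nil : Span d []
    add : ∀ c γ {q} → ∣ γ ∣ ≡ d → Span d q → Span d (scale c (E⁻ γ) ++ q)

  Span-degree : ∀ {d q} → Span d q → DegreeBelow (suc d) q
  Span-degree nil                = mkDegreeBelow λ _ _ → K.refl
  Span-degree (add c γ {q} refl sp) = mkDegreeBelow λ θ d<θ → begin
    coeff (scale c (E⁻ γ) ++ q) θ               ≈⟨ coeff-++ (scale c (E⁻ γ)) q θ ⟩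
    coeff (scale c (E⁻ γ)) θ ⊕ coeff q θ        ≈⟨ K.+-cong (coeff-scale c (E⁻ γ) θ) (coeffAbove (Span-degree sp) θ d<θ) ⟩
    c ⊗ coeff (E⁻ γ) θ ⊕ 0F                     ≈⟨ K.+-congʳ (K.*-congˡ (coeffAbove (E⁻-degree γ) θ d<θ)) ⟩
    c ⊗ 0F ⊕ 0F                                 ≈⟨ ⊗0⊕ c 0F ⟩
    0F                                          ∎
    where open ≃-Reasoning

  eval-add : ∀ p c γ q v → eval (p ++ (scale c (E⁻ γ) ++ q)) v ≃ eval (p ++ q) v ⊕ c ⊗ eval (E⁻ γ) v
  eval-add p c γ q v = begin
    eval (p ++ (scale c (E⁻ γ) ++ q)) v                ≈⟨ K.trans (pair-++ φ p _) (K.+-congˡ (K.trans (pair-++ φ (scale c (E⁻ γ)) q) (K.+-congʳ (pair-scale φ c (E⁻ γ))))) ⟩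
    eval p v ⊕ (c ⊗ eval (E⁻ γ) v ⊕ eval q v)          ≈⟨ S.solve 3 (λ a b c → a S.:+ (b S.:+ c) S.:= (a S.:+ c) S.:+ b) K.refl (eval p v) (c ⊗ eval (E⁻ γ) v) (eval q v) ⟩
    (eval p v ⊕ eval q v) ⊕ c ⊗ eval (E⁻ γ) v          ≈⟨ K.+-congʳ (pair-++ φ p q) ⟨
    eval (p ++ q) v ⊕ c ⊗ eval (E⁻ γ) v                ∎
    where
    open ≃-Reasoning
    φ : Comp n → 𝔽
    φ = monomial v

  Span-vanishing : ∀ {d q} → Span d q → Vanishes 0 d q
  Span-vanishing nil = mkVanishes λ _ _ → K.refl
  Span-vanishing (add c γ {q} refl sp) = mkVanishes λ γ′ γ′<γ → K.trans (eval-add [] c γ q (point 0 γ′))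
    (K.trans (K.+-cong (vanishAt (Span-vanishing sp) γ′ γ′<γ)
      (K.*-congˡ (E⁻-vanishing γ γ′ (λ e → ℕₚ.<-irrefl (cong ∣_∣ e) γ′<γ) (ℕₚ.<⇒≤ γ′<γ))))
      (K.trans (K.+-identityˡ _) (K.zeroʳ c)))

  -- On the points of one size the `E⁻ γ` are a dual basis up to nonzero scalars. Each value can
  -- therefore be cancelled without disturbing the others.
  correct-on : ∀ {d} p {γs} → All (λ γ → ∣ γ ∣ ≡ d) γs →
    ∃ λ q → Span d q × All (λ γ → eval (p ++ q) (point 0 γ) ≃ 0F) γs
  correct-on p []                            = [] , nil , []
  correct-on {d} p {γ ∷ γs} (γ≡d ∷ γs≡d) with correct-on p γs≡d | zeroF? (eval (E⁻ γ) (point 0 γ))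
  ... | q , sp , van | inj₁ e≃0         = ⊥-elim (E⁻-nonZero γ e≃0)
  ... | q , sp , van | inj₂ (e⁻¹ , inv) = scale c (E⁻ γ) ++ q , add c γ γ≡d sp , at-γ ∷ All.zipWith (λ {γ′} → step γ′) (γs≡d , van)
    where
    open ≃-Reasoning
    x c : 𝔽
    x = eval (p ++ q) (point 0 γ)
    c = ⊖ x ⊗ e⁻¹
    e : 𝔽
    e = eval (E⁻ γ) (point 0 γ)
    at-γ : eval (p ++ (scale c (E⁻ γ) ++ q)) (point 0 γ) ≃ 0F
    at-γ = begin
      eval (p ++ (scale c (E⁻ γ) ++ q)) (point 0 γ)   ≈⟨ eval-add p c γ q (point 0 γ) ⟩
      x ⊕ (⊖ x ⊗ e⁻¹) ⊗ e                             ≈⟨ K.+-congˡ (K.trans (K.*-assoc (⊖ x) e⁻¹ e) (K.*-congˡ (K.trans (K.*-comm e⁻¹ e) inv))) ⟩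
      x ⊕ ⊖ x ⊗ 1F                                    ≈⟨ K.+-congˡ (K.*-identityʳ (⊖ x)) ⟩
      x ⊕ ⊖ x                                         ≈⟨ K.-‿inverseʳ x ⟩
      0F                                              ∎
    step : ∀ γ′ → ∣ γ′ ∣ ≡ d × eval (p ++ q) (point 0 γ′) ≃ 0F → eval (p ++ (scale c (E⁻ γ) ++ q)) (point 0 γ′) ≃ 0F
    step γ′ (γ′≡d , van′) with γ′ ≟ᶜ γ
    -- The list is not assumed free of repetitions, so γ may occur in it again.
    ... | yes refl = at-γ
    ... | no γ′≢γ  = K.trans (eval-add p c γ q (point 0 γ′)) (K.trans
      (K.+-cong van′ (K.*-congˡ (E⁻-vanishing γ γ′ γ′≢γ (ℕₚ.≤-reflexive (trans γ′≡d (sym γ≡d))))))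
      (K.trans (K.+-identityˡ _) (K.zeroʳ c)))

  correct : ∀ {d} p → Vanishes 0 d p → ∃ λ q → Span d q × Vanishes 0 (suc d) (p ++ q)
  correct {d} p van with correct-on p (Allₚ.all-filter (λ γ → ∣ γ ∣ ℕ.≟ d) (bounded n d))
  ... | q , sp , all = q , sp , mkVanishes λ γ γ≤d → main γ γ≤d (ℕₚ.m≤n⇒m<n∨m≡n (ℕₚ.≤-pred γ≤d))
    where
    main : ∀ γ → ∣ γ ∣ < suc d → ∣ γ ∣ < d ⊎ ∣ γ ∣ ≡ d → eval (p ++ q) (point 0 γ) ≃ 0F
    main γ _ (inj₂ refl) = All.lookup all (∈-compositions γ)
    main γ _ (inj₁ γ<d)  = K.trans (pair-++ (monomial (point 0 γ)) p q)
      (K.trans (K.+-cong (vanishAt van γ γ<d) (vanishAt (Span-vanishing sp) γ γ<d)) (K.+-identityˡ 0F))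

  -- x^η is corrected at sizes 0, 1, and so on below its own degree. The correction at size k has
  -- degree at most k, so it spoils neither the leading term nor, by `Span-vanishing`, the zeros
  -- already obtained.
  interpolate : ∀ η k → k ≤ ∣ η ∣ → ∃ λ p → Top η p × Vanishes 0 k p
  interpolate η zero    _   = mono η , Top-mono η , mkVanishes λ _ ()
  interpolate η (suc k) k<η with interpolate η k (ℕₚ.<⇒≤ k<η)
  ... | p , top , van with correct p van
  ...   | q , sp , van′ = p ++ q , mkTop top′ , van′
    where
    top′ : ∀ θ → ∣ η ∣ ≤ ∣ θ ∣ → coeff (p ++ q) θ ≃ δ θ η
    top′ θ η≤θ = K.trans (coeff-++ p q θ) (K.trans
      (K.+-cong (topCoeff top θ η≤θ) (coeffAbove (Span-degree sp) θ (ℕₚ.≤-trans k<η η≤θ))) (K.+-identityʳ _))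

  Star-exists : ∀ η → ∃ (Star η)
  Star-exists η with interpolate η ∣ η ∣ ℕₚ.≤-refl
  ... | p , top , van = p , record { top = top ; vanishing = van }

  corrected≃0 : ∀ {η G q} → Star η G → Span ∣ η ∣ q → Vanishes 0 (suc ∣ η ∣) (G ++ q) →
    ∀ θ → coeff G θ ⊕ coeff q θ ≃ 0F
  corrected≃0 {η} {G} {q} st sp van θ = K.trans (K.sym (coeff-++ G q θ))
    (≃0-of-Vanishes n 0 (suc ∣ η ∣) (G ++ q) (mkDegreeBelow degree) van θ)
    where
    degree : ∀ μ → ∣ η ∣ < ∣ μ ∣ → coeff (G ++ q) μ ≃ 0F
    degree μ η<μ = K.trans (coeff-++ G q μ) (K.trans
      (K.+-cong (K.trans (topCoeff (Star.top st) μ (ℕₚ.<⇒≤ η<μ)) (δ-degree η<μ)) (coeffAbove (Span-degree sp) μ η<μ))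
      (K.+-identityˡ 0F))

  -- Values of `Ξ` on monomials

  module Intertwiner (Ξ : Poly n → Poly n) (linear : IsLinear Ξ) (Ξ-F : ∀ η → Ξ (Fα E η) ≈ₚ Frδ E η) where

    Ξ-resp : ∀ p q → p ≃ₚ q → Ξ p ≃ₚ Ξ q
    Ξ-resp p q e κ = mk≃ (IsLinear.respects linear p q (λ κ → _≃_.eq (e κ)) κ)

    Ξ-++ : ∀ p q κ → coeff (Ξ (p ++ q)) κ ≃ coeff (Ξ p) κ ⊕ coeff (Ξ q) κ
    Ξ-++ p q κ = K.trans (mk≃ (IsLinear.additive linear p q κ)) (coeff-++ (Ξ p) (Ξ q) κ)

    Ξ-scale : ∀ c p κ → coeff (Ξ (scale c p)) κ ≃ c ⊗ coeff (Ξ p) κ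
    Ξ-scale c p κ = K.trans (mk≃ (IsLinear.homogen linear c p κ)) (coeff-scale c (Ξ p) κ)

    Ξ-[] : Ξ [] ≃ₚ []
    Ξ-[] κ = Kₚ.+-cancelˡ x x 0F (K.trans (K.sym (Ξ-++ [] [] κ)) (K.sym (K.+-identityʳ x)))
      where x = coeff (Ξ []) κ

    homog-E⁻ : ∀ γ θ → Dec (∣ θ ∣ ≡ ∣ γ ∣) → coeff (homog ∣ γ ∣ (E⁻ γ)) θ ≃ coeff (homog ∣ γ ∣ (E γ)) θ
    homog-E⁻ γ θ (yes eq) = K.trans (K.reflexive (coeff-homog-≡ ∣ γ ∣ (E⁻ γ) θ eq))
      (K.trans (coeff-E⁻-top γ θ eq) (K.reflexive (sym (coeff-homog-≡ ∣ γ ∣ (E γ) θ eq))))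
    homog-E⁻ γ θ (no neq) = K.reflexive
      (trans (coeff-homog-≢ ∣ γ ∣ (E⁻ γ) θ neq) (sym (coeff-homog-≢ ∣ γ ∣ (E γ) θ neq)))

    -- Serves to cancel d = d_γ from both sides of the defining relation of `Ξ`.
    Ξ-unscale : ∀ d d⁻¹ s p q q′ → d ⊗ d⁻¹ ≃ 1F → q′ ≃ₚ q →
      Ξ (scale d q) ≃ₚ scale (s *F d) p → Ξ q′ ≃ₚ scale s p
    Ξ-unscale d d⁻¹ s p q q′ inv q′≃q Ξ-dq κ = begin
      coeff (Ξ q′) κ                            ≈⟨ Ξ-resp q′ (scale d⁻¹ (scale d q)) rescale κ ⟩
      coeff (Ξ (scale d⁻¹ (scale d q))) κ       ≈⟨ Ξ-scale d⁻¹ (scale d q) κ ⟩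
      d⁻¹ ⊗ coeff (Ξ (scale d q)) κ             ≈⟨ K.*-congˡ (Ξ-dq κ) ⟩
      d⁻¹ ⊗ coeff (scale (s *F d) p) κ          ≈⟨ K.*-congˡ (coeff-scale (s *F d) p κ) ⟩
      d⁻¹ ⊗ ((s *F d) ⊗ coeff p κ)              ≡⟨ cong (λ x → d⁻¹ ⊗ (x ⊗ coeff p κ)) (*F≡⊗ s d) ⟩
      d⁻¹ ⊗ ((s ⊗ d) ⊗ coeff p κ)               ≈⟨ S.solve 4 (λ i s d x → i S.:* ((s S.:* d) S.:* x) S.:= (d S.:* i) S.:* (s S.:* x)) K.refl d⁻¹ s d (coeff p κ) ⟩
      (d ⊗ d⁻¹) ⊗ (s ⊗ coeff p κ)               ≈⟨ K.trans (K.*-congʳ inv) (K.*-identityˡ (s ⊗ coeff p κ)) ⟩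
      s ⊗ coeff p κ                             ≈⟨ coeff-scale s p κ ⟨
      coeff (scale s p) κ                       ∎
      where
      open ≃-Reasoning
      rescale : q′ ≃ₚ scale d⁻¹ (scale d q)
      rescale θ = begin
        coeff q′ θ                              ≈⟨ q′≃q θ ⟩
        coeff q θ                               ≈⟨ K.*-identityˡ (coeff q θ) ⟨
        1F ⊗ coeff q θ                          ≈⟨ K.*-congʳ (K.trans (K.*-comm d⁻¹ d) inv) ⟨
        (d⁻¹ ⊗ d) ⊗ coeff q θ                   ≈⟨ K.*-assoc d⁻¹ d (coeff q θ) ⟩
        d⁻¹ ⊗ (d ⊗ coeff q θ)                   ≈⟨ K.*-congˡ (coeff-scale d q θ) ⟨
        d⁻¹ ⊗ coeff (scale d q) θ               ≈⟨ coeff-scale d⁻¹ (scale d q) θ ⟨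
        coeff (scale d⁻¹ (scale d q)) θ         ∎

    -- The relation between F_γ^{(α)} and F_γ^{rδ} with d_γ divided out. In the top component of
    -- `E⁻ γ` the two signs cancel, which leaves E_γ^{(α)} as the argument of `Ξ`.
    Ξ-E : ∀ γ → Ξ (homog ∣ γ ∣ (E⁻ γ)) ≃ₚ E⁻ γ
    Ξ-E γ = by-inverse (zeroF? (dη γ))
      where
      by-inverse : dη γ ≃ 0F ⊎ (∃ λ d⁻¹ → dη γ ⊗ d⁻¹ ≃ 1F) → Ξ (homog ∣ γ ∣ (E⁻ γ)) ≃ₚ E⁻ γ
      by-inverse (inj₁ d≃0)         = ⊥-elim (dη-nonZero γ d≃0)
      by-inverse (inj₂ (d⁻¹ , inv)) = Ξ-unscale (dη γ) d⁻¹ (sgn ∣ γ ∣) (negArg (E γ)) (homog ∣ γ ∣ (E γ)) (homog ∣ γ ∣ (E⁻ γ))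
        inv (λ θ → homog-E⁻ γ θ (∣ θ ∣ ℕ.≟ ∣ γ ∣)) (λ θ → mk≃ (Ξ-F γ θ))

    Ξ-add : ∀ d c p q → Ξ (homog d p) ≃ₚ p → Ξ (homog d q) ≃ₚ q → Ξ (homog d (scale c p ++ q)) ≃ₚ scale c p ++ q
    Ξ-add d c p q Ξp Ξq κ = begin
      coeff (Ξ (homog d (scale c p ++ q))) κ                           ≈⟨ Ξ-resp (homog d (scale c p ++ q)) (scale c (homog d p) ++ homog d q) (homog-add d c p q) κ ⟩
      coeff (Ξ (scale c (homog d p) ++ homog d q)) κ                   ≈⟨ Ξ-++ (scale c (homog d p)) (homog d q) κ ⟩
      coeff (Ξ (scale c (homog d p))) κ ⊕ coeff (Ξ (homog d q)) κ      ≈⟨ K.+-cong (K.trans (Ξ-scale c (homog d p) κ) (K.*-congˡ (Ξp κ))) (Ξq κ) ⟩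
      c ⊗ coeff p κ ⊕ coeff q κ                                        ≈⟨ K.+-congʳ (coeff-scale c p κ) ⟨
      coeff (scale c p) κ ⊕ coeff q κ                                  ≈⟨ coeff-++ (scale c p) q κ ⟨
      coeff (scale c p ++ q) κ                                         ∎
      where open ≃-Reasoning

    Ξ-Span : ∀ {d q} → Span d q → Ξ (homog d q) ≃ₚ q
    Ξ-Span nil                     = Ξ-[]
    Ξ-Span (add c γ {q} refl sp) = Ξ-add ∣ γ ∣ c (E⁻ γ) q (Ξ-E γ) (Ξ-Span sp)

    Ξ-corrected : ∀ {η G} q → Star η G → Span ∣ η ∣ q → (∀ θ → coeff G θ ⊕ coeff q θ ≃ 0F) → Ξ (mono η) ≃ₚ G
    Ξ-corrected {η} {G} q st sp G+q≃0 κ = Kₚ.+-cancelʳ (coeff q κ) (coeff (Ξ (mono η)) κ) (coeff G κ) (begin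
      coeff (Ξ (mono η)) κ ⊕ coeff q κ                      ≈⟨ K.+-congˡ (Ξ-Span sp κ) ⟨
      coeff (Ξ (mono η)) κ ⊕ coeff (Ξ (homog ∣ η ∣ q)) κ    ≈⟨ Ξ-++ (mono η) (homog ∣ η ∣ q) κ ⟨
      coeff (Ξ (mono η ++ homog ∣ η ∣ q)) κ                 ≈⟨ Ξ-resp (mono η ++ homog ∣ η ∣ q) [] (λ θ → homog-corrected q st G+q≃0 θ (∣ θ ∣ ℕ.≟ ∣ η ∣)) κ ⟩
      coeff (Ξ []) κ                                        ≈⟨ Ξ-[] κ ⟩
      0F                                                    ≈⟨ G+q≃0 κ ⟨
      coeff G κ ⊕ coeff q κ                                 ∎)
      where open ≃-Reasoning

    -- Since G is arbitrary, this applies equally to `σ⁺ i G` and `Φ⁺ G` with their new exponents.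
    -- Both halves of the theorem follow by comparing two instances.
    Ξ-mono : ∀ {η G} → Star η G → Ξ (mono η) ≃ₚ G
    Ξ-mono {η} {G} st = from-correction (correct G (Star.vanishing st))
      where
      from-correction : (∃ λ q → Span ∣ η ∣ q × Vanishes 0 (suc ∣ η ∣) (G ++ q)) → Ξ (mono η) ≃ₚ G
      from-correction (q , sp , van) = Ξ-corrected q st sp (corrected≃0 st sp van)

-- The intertwining relations

-- `σ⁺` works on term lists, while `Ξ (mono η)` is known only up to coefficients. Pulling the
-- coefficient functional back to the argument reduces the matter to `pair-resp`.
σ⁺-resp : ∀ {m} (i : Fin m) p q → p ≃ₚ q → σ⁺ i p ≃ₚ σ⁺ i q
σ⁺-resp i p q e κ = begin
  coeff (σ⁺ i p) κ      ≈⟨ coeff≃pair (σ⁺ i p) κ ⟩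
  pair (δ κ) (σ⁺ i p)   ≈⟨ pair-σ⁺ i (δ κ) p ⟩
  pair (σ* i (δ κ)) p   ≈⟨ pair-resp (σ* i (δ κ)) p q e ⟩
  pair (σ* i (δ κ)) q   ≈⟨ pair-σ⁺ i (δ κ) q ⟨
  pair (δ κ) (σ⁺ i q)   ≈⟨ coeff≃pair (σ⁺ i q) κ ⟨
  coeff (σ⁺ i q) κ      ∎
  where open ≃-Reasoning

Φ⁺-resp : ∀ {m} (p q : Poly (suc m)) → p ≃ₚ q → Φ⁺ p ≃ₚ Φ⁺ q
Φ⁺-resp {m} p q e κ = begin
  coeff (Φ⁺ p) κ        ≈⟨ coeff≃pair (Φ⁺ p) κ ⟩
  pair (δ κ) (Φ⁺ p)     ≈⟨ pair-Φ⁺ (δ κ) p ⟩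
  pair φ p              ≈⟨ pair-resp φ p q e ⟩
  pair φ q              ≈⟨ pair-Φ⁺ (δ κ) q ⟨
  pair (δ κ) (Φ⁺ q)     ≈⟨ coeff≃pair (Φ⁺ q) κ ⟨
  coeff (Φ⁺ q) κ        ∎
  where
  open ≃-Reasoning
  φ : Comp (suc m) → 𝔽
  φ μ = pair (δ κ) (Φ⁺mono μ)

theorem3p13 : (m : ℕ)
    → (E : Comp (suc m) → Poly (suc m))
    → (∀ η → IsInterp η (E η))
    → (Ξ : Poly (suc m) → Poly (suc m))
    → IsLinear Ξ
    → (∀ η → Ξ (Fα E η) ≈ₚ Frδ E η)
    → ((η : Comp (suc m)) (i : Fin m) → Ξ (mono (swapC i η)) ≈ₚ σ⁺ i (Ξ (mono η)))
    × ((η : Comp (suc m)) → Ξ (mono (ΦC η)) ≈ₚ Φ⁺ (Ξ (mono η)))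
theorem3p13 m E interp Ξ linear Ξ-F =
    (λ η i κ → _≃_.eq (swap η i (Star-exists η) κ))
  , (λ η κ → _≃_.eq (shift η (Star-exists η) κ))
  where
  open Interpolation E interp
  open Intertwiner Ξ linear Ξ-F
  swap : ∀ η i → ∃ (Star η) → Ξ (mono (swapC i η)) ≃ₚ σ⁺ i (Ξ (mono η))
  swap η i (G , st) κ = K.trans (Ξ-mono (Star-σ⁺ i st) κ) (K.sym (σ⁺-resp i (Ξ (mono η)) G (Ξ-mono st) κ))
  shift : ∀ η → ∃ (Star η) → Ξ (mono (ΦC η)) ≃ₚ Φ⁺ (Ξ (mono η))
  shift η (G , st) κ = K.trans (Ξ-mono (Star-Φ⁺ st) κ) (K.sym (Φ⁺-resp (Ξ (mono η)) G (Ξ-mono st) κ))
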